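{- Let $\epsilon=(\alpha,\beta,\gamma)$ be a one-face embedding of a graph $G$ and $\nu$ a vertex of $G$ with $k=deg(\nu)$. Let $D_\nu$ be the diagonal of the localization of $\epsilon$ at $\nu$ and suppose $D_\nu$ has cycle type $(1^{a_1},2^{a_2},\ldots,k^{a_k})$. Then the probability $prob_1(\nu)$ that a reembedding of $\nu$ yields a one-face embedding satisfies $$\frac{2}{deg(\nu)-a_1+2}\leq prob_1(\nu)\leq\frac{2}{deg(\nu)-a_1+\frac{19}{29}}.$$ In particular, $prob_1(\nu)\geq\frac{2}{deg(\nu)+2}$ for every vertex $\nu$.
   Context: A map with $m$ edges is a triple $(\alpha,\beta,\gamma)$ of permutations of $[2m]$ (half-edges), $\alpha$ a fixed-point-free involution (edges), cycles of $\beta$ the cyclic orders of half-edges at vertices, $\gamma=\alpha\beta$ (composition $(\sigma\tau)(x)=\sigma(\tau(x))$), whose cycles are the faces; one-face means $\gamma$ is a single cycle. The graph is $G=(\alpha,Par_\beta)$, vertices are the blocks of $Par_\beta$ (partition into cycles of $\beta$), $deg(\nu)=|\nu|$. Localization at $\nu$: let $s_\nu$ be the permutation of $\nu$ with $s_\nu(v)=\gamma^j(v)$ where $j\geq1$ is least with $\gamma^j(v)\in\nu$, let $\pi_\nu=\beta|_\nu$, and $D_\nu=s_\nu\circ\pi_\nu^{ -1}$. A reembedding of $\nu$ is a permutation $\beta'$ with $\beta'(x)=\beta(x)$ for $x\notin\nu$ and $\beta'|_\nu$ a single cycle on $\nu$; there are $(deg(\nu)-1)!$ of them (including $\beta$).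 $prob_1(\nu)$ is the number of reembeddings $\beta'$ for which $\alpha\beta'$ is a single cycle, divided by $(deg(\nu)-1)!$. -}

module Defs where

open import Data.Nat using (ℕ; zero; suc; _+_; _*_; _∸_; _!)
open import Data.Nat.Properties using (_!≢0)
open import Data.Fin using (Fin; _≟_)
open import Data.Fin.Permutation using (Permutation′; _⟨$⟩ʳ_; _⟨$⟩ˡ_)
open import Data.Bool using (Bool; true; false; if_then_else_; _∧_)
open import Data.List using (List; []; _∷_; map; concatMap; allFin; upTo)
open import Data.Bool.ListAction using (all; any)
open import Data.Vec using (Vec; lookup)
import Data.Vec as V
open import Data.Integer using (+_)
open import Data.Rational using (ℚ; _/_)
open import Data.Product using (∃)
open import Relation.Nullary.Decidable using (⌊_⌋)
open import Relation.Binary.PropositionalEquality using (_≡_; _≢_)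

-- Half-edges are the elements of Fin n (n = 2m).

iter : ∀ {n} → (Fin n → Fin n) → ℕ → Fin n → Fin n
iter f zero    x = x
iter f (suc j) x = f (iter f j x)

_==_ : ∀ {n} → Fin n → Fin n → Bool
x == y = ⌊ x ≟ y ⌋

count : ∀ {A : Set} → (A → Bool) → List A → ℕ
count p []       = 0
count p (x ∷ xs) = if p x then suc (count p xs) else count p xs

IsFPFInvolution : ∀ {n} → Permutation′ n → Set
IsFPFInvolution α = ∀ x → (α ⟨$⟩ʳ (α ⟨$⟩ʳ x) ≡ x) Data.Product.× (α ⟨$⟩ʳ x ≢ x)
  where import Data.Product

face : ∀ {n} → Permutation′ n → Permutation′ n → Fin n → Fin n
face α β x = α ⟨$⟩ʳ (β ⟨$⟩ʳ x)

IsSingleCycle : ∀ {n} → (Fin n → Fin n) → Set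
IsSingleCycle f = ∀ x y → ∃ λ j → iter f j x ≡ y

OneFace : ∀ {n} → Permutation′ n → Permutation′ n → Set
OneFace α β = IsSingleCycle (face α β)

-- y is in the orbit of x under f (f^j x = y for some j < n; orbits of
-- maps on Fin n are reached within n steps)
reach : ∀ {n} → (Fin n → Fin n) → Fin n → Fin n → Bool
reach {n} f x y = any (λ j → iter f j x == y) (upTo n)

singleCycleB : ∀ {n} → (Fin n → Fin n) → Bool
singleCycleB {n} f = all (λ x → all (λ y → reach f x y) (allFin n)) (allFin n)

-- Vertices: the vertex ν containing half-edge h is the β-cycle of h

inVertex : ∀ {n} → Permutation′ n → Fin n → Fin n → Bool
inVertex β h x = reach (β ⟨$⟩ʳ_) h x

deg : ∀ {n} → Permutation′ n → Fin n → ℕ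
deg {n} β h = count (inVertex β h) (allFin n)

-- first return to ν under γ: s_ν(v) = γ^j(v), j ≥ 1 least with γ^j(v) ∈ ν
-- (fuel n suffices since γ is a permutation and v ∈ ν)
firstReturn : ∀ {n} → (Fin n → Bool) → (Fin n → Fin n) → ℕ → Fin n → Fin n
firstReturn inν g zero    y = y
firstReturn inν g (suc k) y = if inν y then y else firstReturn inν g k (g y)

sLoc : ∀ {n} → Permutation′ n → Permutation′ n → Fin n → Fin n → Fin n
sLoc {n} α β h v = firstReturn (inVertex β h) (face α β) n (face α β v)

-- D_ν(v) = s_ν(π_ν⁻¹(v)), with π_ν = β|ν so π_ν⁻¹ = β⁻¹ on ν
diagonal : ∀ {n} → Permutation′ n → Permutation′ n → Fin n → Fin n → Fin n
diagonal α β h v = sLoc α β h (β ⟨$⟩ˡ v)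

a₁ : ∀ {n} → Permutation′ n → Permutation′ n → Fin n → ℕ
a₁ {n} α β h = count (λ v → inVertex β h v ∧ (diagonal α β h v == v)) (allFin n)

allVecs : ∀ {n} (k : ℕ) → List (Vec (Fin n) k)
allVecs zero    = V.[] ∷ []
allVecs {n} (suc k) = concatMap (λ i → map (i V.∷_) (allVecs k)) (allFin n)

-- β' (given by its table b) agrees with β off ν and restricts to a
-- single cycle on ν
isReembedding : ∀ {n} → Permutation′ n → Fin n → Vec (Fin n) n → Bool
isReembedding {n} β h b =
  all (λ x → if inVertex β h x then inVertex β h (lookup b x)
                               else (lookup b x == (β ⟨$⟩ʳ x))) (allFin n)
  ∧ all (λ x → all (λ y → if inVertex β h x ∧ inVertex β h y
                            then reach (lookup b) x y else true)
                   (allFin n)) (allFin n)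

oneFaceReembeddings : ∀ {n} → Permutation′ n → Permutation′ n → Fin n → ℕ
oneFaceReembeddings {n} α β h =
  count (λ b → isReembedding β h b ∧ singleCycleB (λ x → α ⟨$⟩ʳ lookup b x))
        (allVecs n)

prob₁ : ∀ {n} → Permutation′ n → Permutation′ n → Fin n → ℚ
prob₁ α β h = (+ oneFaceReembeddings α β h) / ((deg β h ∸ 1) !)
  where instance _ = (deg β h ∸ 1) !≢0

{-# OPTIONS --safe #-}
-- Let Θ be the map α β with β replaced by the identity on ν.  Reembedding ν by
-- a cyclic permutation π of ν turns the face permutation into Θ π, and D_ν is
-- the first-return map of Θ to ν, so prob₁(ν) is the proportion of the cyclic
-- π for which D_ν π is cyclic.  Inserting the points of ν into π one by one
-- multiplies Θ π by transpositions, which join or split cycles; when a cycle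
-- with l points of ν gets weight Aˡ − Bˡ the resulting recursion on cycle
-- types can be solved, and it yields Boccara's formula
--   prob₁(ν) = I(λ) = ∫ ∏ᵢ (t^λᵢ − (t − 1)^λᵢ) dt  over [0,1],
-- λ being the cycle type of D_ν.  In terms of x = 2t − 1 and w = t (1 − t) the
-- factors are f₀ = 0, f₁ = 1, fₘ₊₂ = x fₘ₊₁ + w fₘ, with derivative
-- (m/2) fₘ₋₁, and w ≥ 0.  Let F be their product and N = deg(ν) − a₁.
-- Integrating (x F)′ over [-1,1] and using x fₘ₋₁ = fₘ − w fₘ₋₂ ≤ fₘ gives
-- 2 ≤ (N + 2) I(λ).  For the upper bound, f_a f_b ≤ f₃ f_{a+b−3} and
-- f₂ f_b ≤ f₃ f_{b−1} reduce to the case that λ contains a 3; then the same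
-- integral and f₃ = 1 − 3w give (4N + 6) I(λ) ≤ 6 + N I(λ ∖ 3), from which the
-- bound follows by induction.
module Submission where

open import Defs
open import Data.Product using (_×_; _,_; ∃; proj₁; proj₂)
open import Data.Sum using (_⊎_; inj₁; inj₂; [_,_]′)
open import Data.Empty using (⊥; ⊥-elim)
open import Data.Unit using (⊤; tt)
open import Data.Bool using (Bool; true; false; if_then_else_; _∧_)
open import Data.List using (List; []; _∷_; _++_; length; map; concat; concatMap; upTo; allFin)
import Data.List.Properties as List
open import Data.List.Relation.Unary.All using (All; []; _∷_)
import Data.List.Relation.Unary.All as All
import Data.List.Relation.Unary.All.Properties as All
open import Data.List.Relation.Unary.Any using (Any; here; there)
open import Data.List.Relation.Unary.AllPairs using ([]; _∷_)
import Data.List.Relation.Unary.AllPairs as AllPairs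
open import Data.List.Membership.Propositional using (_∈_; _∉_; find; lose)
open import Data.List.Membership.Propositional.Properties using (∈-++⁺ˡ; ∈-++⁺ʳ; ∈-++⁻; ∈-∃++; ∈-map⁻; ∈-map⁺; ∈-concatMap⁻; ∈-concatMap⁺; ∈-concat⁺′; ∈-concat⁻′; ∈-insert; ∈-upTo⁺; ∈-allFin; ∈-lookup)
open import Data.List.Relation.Unary.Unique.Propositional using (Unique)
import Data.List.Relation.Unary.Unique.Propositional.Properties as Unique
open import Function using (_∘_; id)
open import Relation.Nullary using (yes; no)

-- Boccara's integral enters as a linear functional given by its beta values on monomials.
-- Positivity means non-negative values on all products of powers of `x` and `w`, which a recurrence
-- with coefficients `x` and `w` preserves. The recursion on cycle types is solvable because
-- choosing one of the m points of a cycle and lengthening it by one is the derivation A² ∂/∂A on Aᵐ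
-- - Bᵐ; rescaling monomials by i! j! makes it multiplication by A up to a correction. Splits bring
-- in (Aˡ - Bˡ)/(A - B), but in the closed forms of the two colours this term has opposite signs and
-- cancels in their sum. At the end, a functional that depends on the degree alone annihilates every
-- product with a factor Aᵐ - Bᵐ, so only single-cycle configurations survive. The boundary term of
-- ∫ (x F)′ is F(1) + F(-1), which is 2 or 0. It is 0 only for odd F, and then I(λ) = 0 as well, so
-- the lower bound would fail. This case is excluded by the given embedding, which is itself counted
-- as a one-face reembedding.

module Integral where

  open import Data.Nat using (ℕ; zero; suc; pred; z≤n; s≤s) renaming (_+_ to _+ℕ_; _≤_ to _≤ℕ_; _<_ to _<ℕ_; _*_ to _*ℕ_)
  import Data.Nat.Properties as ℕ
  open import Data.Nat.Induction using (<-rec)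
  open import Data.Nat.Tactic.RingSolver using () renaming (solve-∀ to solveℕ-∀)
  open import Data.Rational hiding (NonZero)
  open import Data.Rational.Properties
  import Tactic.RingSolver.Core.AlmostCommutativeRing as ACR
  open import Tactic.RingSolver using (solve-∀)
  open import Data.Sum using (map₂)
  open import Relation.Nullary.Decidable using (dec⇒maybe)
  open import Relation.Binary.PropositionalEquality

  -- Linear functionals on polynomials in A and B, and a positivity cone.

  R : ACR.AlmostCommutativeRing _ _
  R = ACR.fromCommutativeRing +-*-commutativeRing (λ x → dec⇒maybe (0ℚ ≟ x))

  ι : ℕ → ℚ
  ι zero = 0ℚ
  ι (suc n) = 1ℚ + ι n

  -- Linear functionals on polynomials in A and B, given by their values on the
  -- monomials Aⁱ Bʲ; a polynomial operator acts on them by its transpose.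
  Fn : Set
  Fn = ℕ → ℕ → ℚ

  infix 4 _≗₂_
  _≗₂_ : Fn → Fn → Set
  θ ≗₂ η = ∀ i j → θ i j ≡ η i j

  infixl 6 _⊕_ _⊖_
  infixr 7 _⊙_
  _⊕_ _⊖_ : Fn → Fn → Fn
  (θ ⊕ η) i j = θ i j + η i j
  (θ ⊖ η) i j = θ i j - η i j

  _⊙_ : ℚ → Fn → Fn
  (c ⊙ θ) i j = c * θ i j

  -- Multiplication by Aᵐ − Bᵐ, and by the product of these over ms.
  φ : ℕ → Fn → Fn
  φ m θ i j = θ (m +ℕ i) j - θ i (m +ℕ j)

  F : List ℕ → Fn → Fn
  F []       θ = θ
  F (m ∷ ms) θ = F ms (φ m θ)

  φ-cong : ∀ m {θ η} → θ ≗₂ η → φ m θ ≗₂ φ m η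
  φ-cong m e i j = cong₂ _-_ (e _ _) (e _ _)

  F-cong : ∀ ms {θ η} → θ ≗₂ η → F ms θ ≗₂ F ms η
  F-cong []       e = e
  F-cong (m ∷ ms) e = F-cong ms (φ-cong m e)

  F-vanish : ∀ ms {θ} → (∀ i j → θ i j ≡ 0ℚ) → ∀ i j → F ms θ i j ≡ 0ℚ
  F-vanish []       h = h
  F-vanish (m ∷ ms) h = F-vanish ms (λ i j → cong₂ _-_ (h (m +ℕ i) j) (h i (m +ℕ j)))

  interchange-+- : ∀ w x y z → (w + x) - (y + z) ≡ (w - y) + (x - z)
  interchange-+- = solve-∀ R

  interchange-- : ∀ w x y z → (w - x) - (y - z) ≡ (w - y) - (x - z)
  interchange-- = solve-∀ R

  F-⊕ : ∀ ms θ η → F ms (θ ⊕ η) ≗₂ F ms θ ⊕ F ms η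
  F-⊕ []       θ η i j = refl
  F-⊕ (m ∷ ms) θ η i j =
    trans (F-cong ms (λ i j → interchange-+- (θ (m +ℕ i) j) (η (m +ℕ i) j) (θ i (m +ℕ j)) (η i (m +ℕ j))) i j)
          (F-⊕ ms (φ m θ) (φ m η) i j)

  F-⊖ : ∀ ms θ η → F ms (θ ⊖ η) ≗₂ F ms θ ⊖ F ms η
  F-⊖ []       θ η i j = refl
  F-⊖ (m ∷ ms) θ η i j =
    trans (F-cong ms (λ i j → interchange-- (θ (m +ℕ i) j) (η (m +ℕ i) j) (θ i (m +ℕ j)) (η i (m +ℕ j))) i j)
          (F-⊖ ms (φ m θ) (φ m η) i j)

  *-distribˡ-- : ∀ c x y → c * x - c * y ≡ c * (x - y)
  *-distribˡ-- = solve-∀ R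

  F-⊙ : ∀ ms c θ → F ms (c ⊙ θ) ≗₂ c ⊙ F ms θ
  F-⊙ []       c θ i j = refl
  F-⊙ (m ∷ ms) c θ i j =
    trans (F-cong ms (λ i j → *-distribˡ-- c (θ (m +ℕ i) j) (θ i (m +ℕ j))) i j) (F-⊙ ms c (φ m θ) i j)

  swap-+ : ∀ m n i → m +ℕ (n +ℕ i) ≡ n +ℕ (m +ℕ i)
  swap-+ m n i = trans (sym (ℕ.+-assoc m n i)) (trans (cong (_+ℕ i) (ℕ.+-comm m n)) (ℕ.+-assoc n m i))

  φ-comm-lem : ∀ w x y z → (w - x) - (y - z) ≡ (w - y) - (x - z)
  φ-comm-lem = solve-∀ R

  φ-comm : ∀ m n θ → φ m (φ n θ) ≗₂ φ n (φ m θ)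
  φ-comm m n θ i j
    rewrite swap-+ m n i | swap-+ m n j = φ-comm-lem (θ (n +ℕ (m +ℕ i)) j) (θ (m +ℕ i) (n +ℕ j)) (θ (n +ℕ i) (m +ℕ j)) _

  -- Multiplication by A + B and by − A B.
  X W : Fn → Fn
  X θ i j = θ (suc i) j + θ i (suc j)
  W θ i j = - θ (suc i) (suc j)

  X-cong : ∀ {θ η} → θ ≗₂ η → X θ ≗₂ X η
  X-cong e i j = cong₂ _+_ (e _ _) (e _ _)

  W-cong : ∀ {θ η} → θ ≗₂ η → W θ ≗₂ W η
  W-cong e i j = cong -_ (e _ _)

  -- Functionals factoring through A − B = 1.
  Harm : Fn → Set
  Harm θ = ∀ i j → θ (suc i) j - θ i (suc j) ≡ θ i j

  φ-harm : ∀ m {θ} → Harm θ → Harm (φ m θ)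
  φ-harm m {θ} h i j rewrite ℕ.+-suc m i | ℕ.+-suc m j =
    trans (interchange-- (θ (suc (m +ℕ i)) j) (θ (suc i) (m +ℕ j)) (θ (m +ℕ i) (suc j)) (θ i (suc (m +ℕ j))))
          (cong₂ _-_ (h _ _) (h _ _))

  W-harm : ∀ {θ} → Harm θ → Harm (W θ)
  W-harm {θ} h i j = trans (lem (θ (suc (suc i)) (suc j)) _) (cong -_ (h _ _))
    where lem : ∀ x y → - x - - y ≡ - (x - y)
          lem = solve-∀ R

  X-harm : ∀ {θ} → Harm θ → Harm (X θ)
  X-harm {θ} h i j = trans (interchange-+- (θ (suc (suc i)) j) (θ (suc i) (suc j)) (θ (suc i) (suc j)) _)
                           (cong₂ _+_ (h _ _) (h _ _))

  -- The value of θ at xˢ wᵏ. These monomials generate the cone on which positivity is tested.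
  value : ℕ → ℕ → Fn → ℚ
  value (suc s) k       θ = value s k (X θ)
  value zero    (suc k) θ = value zero k (W θ)
  value zero    zero    θ = θ 0 0

  value-cong : ∀ s k {θ η} → θ ≗₂ η → value s k θ ≡ value s k η
  value-cong (suc s) k       e = value-cong s k (X-cong e)
  value-cong zero    (suc k) e = value-cong zero k (W-cong e)
  value-cong zero    zero    e = e 0 0

  value-⊕ : ∀ s k θ η → value s k (θ ⊕ η) ≡ value s k θ + value s k η
  value-⊕ (suc s) k       θ η = trans (value-cong s k λ i j → lem (θ (suc i) j) (η (suc i) j) _ _) (value-⊕ s k (X θ) (X η))
    where lem : ∀ w x y z → (w + x) + (y + z) ≡ (w + y) + (x + z)
          lem = solve-∀ R
  value-⊕ zero    (suc k) θ η = trans (value-cong zero k λ i j → neg-distrib-+ (θ (suc i) (suc j)) _) (value-⊕ zero k (W θ) (W η))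
  value-⊕ zero    zero    θ η = refl

  value-W : ∀ s k θ → value s k (W θ) ≡ value s (suc k) θ
  value-W (suc s) k θ = trans (value-cong s k λ i j → sym (neg-distrib-+ (θ (suc (suc i)) (suc j)) _)) (value-W s k (X θ))
  value-W zero    k θ = refl

  -- Positivity on the cone spanned by the xˢ wᵏ replaces pointwise positivity on [-1,1]. It
  -- survives multiplication by `x`, although `x` changes sign there; the integral qualifies because
  -- its odd moments against wᵏ vanish.
  record Pos (θ : Fn) : Set where
    constructor mkPos
    field
      harmonic : Harm θ
      nonneg   : ∀ s k → 0ℚ ≤ value s k θ
  open Pos

  0≤+ : ∀ {x y} → 0ℚ ≤ x → 0ℚ ≤ y → 0ℚ ≤ x + y
  0≤+ p q = +-mono-≤ p q

  0≤* : ∀ {x y} → 0ℚ ≤ x → 0ℚ ≤ y → 0ℚ ≤ x * y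
  0≤* {x} {y} p q = subst (_≤ x * y) (*-zeroʳ x) (*-monoˡ-≤-nonNeg x {{nonNegative p}} q)

  0≤ι : ∀ n → 0ℚ ≤ ι n
  0≤ι zero    = ≤-refl
  0≤ι (suc n) = 0≤+ (<⇒≤ (positive⁻¹ 1ℚ)) (0≤ι n)

  ≤-from-diff : ∀ {x y d} → 0ℚ ≤ d → y - x ≡ d → x ≤ y
  ≤-from-diff {x} {y} {d} p e = subst₂ _≤_ (+-identityʳ x) (trans (cong (λ z → x + z) (sym e)) (lem x y)) (+-monoʳ-≤ x p)
    where lem : ∀ x y → x + (y - x) ≡ y
          lem = solve-∀ R

  diff-≤ : ∀ {x y} → x ≤ y → 0ℚ ≤ y - x
  diff-≤ {x} {y} p = subst (_≤ y - x) (+-inverseʳ x) (+-monoˡ-≤ (- x) p)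

  Pos-cong : ∀ {θ η} → θ ≗₂ η → Pos θ → Pos η
  Pos-cong e (mkPos h n) = mkPos
    (λ i j → trans (cong₂ _-_ (sym (e _ _)) (sym (e _ _))) (trans (h i j) (e i j)))
    (λ s k → subst (0ℚ ≤_) (value-cong s k e) (n s k))

  Pos-X : ∀ {θ} → Pos θ → Pos (X θ)
  Pos-X (mkPos h n) = mkPos (X-harm h) (λ s k → n (suc s) k)

  Pos-W : ∀ {θ} → Pos θ → Pos (W θ)
  Pos-W {θ} (mkPos h n) = mkPos (W-harm h) (λ s k → subst (0ℚ ≤_) (sym (value-W s k θ)) (n s (suc k)))

  Pos-⊕ : ∀ {θ η} → Pos θ → Pos η → Pos (θ ⊕ η)
  Pos-⊕ {θ} {η} (mkPos h n) (mkPos h′ n′) = mkPos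
    (λ i j → trans (interchange-+- (θ (suc i) j) _ _ _) (cong₂ _+_ (h i j) (h′ i j)))
    (λ s k → subst (0ℚ ≤_) (sym (value-⊕ s k θ η)) (0≤+ (n s k) (n′ s k)))

  value-vanish : ∀ s k {θ} → (∀ i j → θ i j ≡ 0ℚ) → value s k θ ≡ 0ℚ
  value-vanish (suc s) k       h = value-vanish s k (λ i j → cong₂ _+_ (h (suc i) j) (h i (suc j)))
  value-vanish zero    (suc k) h = value-vanish zero k (λ i j → cong -_ (h (suc i) (suc j)))
  value-vanish zero    zero    h = h 0 0

  φ₀ : ∀ θ i j → φ 0 θ i j ≡ 0ℚ
  φ₀ θ i j = +-inverseʳ (θ i j)

  φ₁ : ∀ {θ} → Harm θ → φ 1 θ ≗₂ θ
  φ₁ h i j = h i j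

  -- On A − B = 1 the Aᵐ − Bᵐ are thus Fibonacci polynomials in X and W.
  φ-step : ∀ m θ → φ (suc (suc m)) θ ≗₂ X (φ (suc m) θ) ⊕ W (φ m θ)
  φ-step m θ i j rewrite ℕ.+-suc m i | ℕ.+-suc m j =
    lem (θ (suc (suc (m +ℕ i))) j) (θ (suc i) (suc (m +ℕ j))) (θ (suc (m +ℕ i)) (suc j)) _
    where lem : ∀ p q r s → p - s ≡ ((p - q) + (r - s)) + - (r - q)
          lem = solve-∀ R

  -- The Fibonacci recurrence reaches two steps back, hence the pair; its coefficients `X` and `W`
  -- both preserve `Pos`.
  Pos-φ : ∀ m {θ} → Pos θ → Pos (φ m θ) × Pos (φ (suc m) θ)
  Pos-φ zero {θ} p = mkPos (φ-harm 0 (harmonic p)) (λ s k → ≤-reflexive (sym (value-vanish s k (φ₀ θ))))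
                 , Pos-cong (λ i j → sym (φ₁ (harmonic p) i j)) p
  Pos-φ (suc m) {θ} p with Pos-φ m p
  ... | p₀ , p₁ = p₁ , Pos-cong (λ i j → sym (φ-step m θ i j)) (Pos-⊕ (Pos-X p₁) (Pos-W p₀))

  Pos-φ′ : ∀ m {θ} → Pos θ → Pos (φ m θ)
  Pos-φ′ m p = proj₁ (Pos-φ m p)

  Pos-F : ∀ ms {θ} → Pos θ → Pos (F ms θ)
  Pos-F [] p = p
  Pos-F (m ∷ ms) p = Pos-F ms (Pos-φ′ m p)

  Pos-0 : ∀ {θ} → Pos θ → 0ℚ ≤ θ 0 0
  Pos-0 p = nonneg p 0 0

  -- Differentiation of the products, and inequalities between the factors.

  ι-+ : ∀ m n → ι (m +ℕ n) ≡ ι m + ι n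
  ι-+ zero    n = sym (+-identityˡ (ι n))
  ι-+ (suc m) n = trans (cong (λ z → 1ℚ + z) (ι-+ m n)) (sym (+-assoc 1ℚ (ι m) (ι n)))

  -- Transposes of ∂/∂A, ∂/∂B and their sum. The sum kills A - B and becomes d/dt under A = t, B = t
  -- - 1.
  ∂A ∂B U : Fn → Fn
  ∂A θ zero    j = 0ℚ
  ∂A θ (suc i) j = ι (suc i) * θ i j
  ∂B θ i zero    = 0ℚ
  ∂B θ i (suc j) = ι (suc j) * θ i j
  U θ i j = ∂A θ i j + ∂B θ i j

  -- Evaluation of θ at the derivative of the product over `ms`, since (Aᵐ - Bᵐ)′ = m (Aᵐ⁻¹ - Bᵐ⁻¹).
  -- At m = 0 the truncation in `pred` is harmless because the coefficient is 0.
  D : List ℕ → Fn → Fn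
  D []       θ i j = 0ℚ
  D (m ∷ ms) θ i j = ι m * F ms (φ (pred m) θ) i j + D ms (φ m θ) i j

  D-cong : ∀ ms {θ η} → θ ≗₂ η → D ms θ ≗₂ D ms η
  D-cong []       e i j = refl
  D-cong (m ∷ ms) e i j = cong₂ _+_ (cong (λ z → ι m * z) (F-cong ms (φ-cong (pred m) e) i j)) (D-cong ms (φ-cong m e) i j)

  private
    ∂A-φ : ∀ m θ i j → ∂A θ (suc (m +ℕ i)) j - ∂A θ i (suc (m +ℕ j))
                      ≡ ∂A (φ (suc m) θ) i j + ι (suc m) * θ (m +ℕ i) j
    ∂A-φ m θ zero j rewrite ℕ.+-identityʳ m = lem (ι (suc m) * θ m j)
      where lem : ∀ x → x - 0ℚ ≡ 0ℚ + x
            lem = solve-∀ R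
    ∂A-φ m θ (suc i) j rewrite ℕ.+-suc m i | ι-+ m i = lem (ι m) (ι i) (θ (suc (m +ℕ i)) j) (θ i (suc (m +ℕ j)))
      where lem : ∀ m i x y → (1ℚ + (1ℚ + (m + i))) * x - (1ℚ + i) * y ≡ (1ℚ + i) * (x - y) + (1ℚ + m) * x
            lem = solve-∀ R

    ∂B-φ : ∀ m θ i j → ∂B θ (suc (m +ℕ i)) j - ∂B θ i (suc (m +ℕ j))
                      ≡ ∂B (φ (suc m) θ) i j - ι (suc m) * θ i (m +ℕ j)
    ∂B-φ m θ i zero rewrite ℕ.+-identityʳ m = refl
    ∂B-φ m θ i (suc j) rewrite ℕ.+-suc m j | ι-+ m j = lem (ι m) (ι j) (θ (suc (m +ℕ i)) j) (θ i (suc (m +ℕ j)))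
      where lem : ∀ m i x y → (1ℚ + i) * x - (1ℚ + (1ℚ + (m + i))) * y ≡ (1ℚ + i) * (x - y) - (1ℚ + m) * y
            lem = solve-∀ R

  -- The product rule for one factor, transposed.
  φ-U : ∀ m θ → φ m (U θ) ≗₂ U (φ m θ) ⊕ (ι m ⊙ φ (pred m) θ)
  φ-U zero θ i j = trans (+-inverseʳ (U θ i j)) (sym (trans (cong (λ z → z + 0ℚ * φ 0 θ i j) (U-φ₀ i j)) (lem (φ 0 θ i j))))
    where
    lem : ∀ x → 0ℚ + 0ℚ * x ≡ 0ℚ
    lem = solve-∀ R
    lem0 : ∀ x y → x * (y - y) ≡ 0ℚ
    lem0 = solve-∀ R
    U-φ₀ : ∀ i j → U (φ 0 θ) i j ≡ 0ℚ
    U-φ₀ zero zero = refl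
    U-φ₀ (suc i) zero = cong (_+ 0ℚ) (lem0 (ι (suc i)) (θ i 0))
    U-φ₀ zero (suc j) = cong (0ℚ +_) (lem0 (ι (suc j)) (θ 0 j))
    U-φ₀ (suc i) (suc j) = cong₂ _+_ (lem0 (ι (suc i)) (θ i (suc j))) (lem0 (ι (suc j)) (θ (suc i) j))
  φ-U (suc m) θ i j = trans (interchange-+- (∂A θ (suc (m +ℕ i)) j) (∂B θ (suc (m +ℕ i)) j) (∂A θ i (suc (m +ℕ j))) (∂B θ i (suc (m +ℕ j))))
    (trans (cong₂ _+_ (∂A-φ m θ i j) (∂B-φ m θ i j)) (lem (∂A (φ (suc m) θ) i j) (∂B (φ (suc m) θ) i j) (ι (suc m)) (θ (m +ℕ i) j) (θ i (m +ℕ j))))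
    where lem : ∀ a b c x y → (a + c * x) + (b - c * y) ≡ (a + b) + c * (x - y)
          lem = solve-∀ R

  F-U : ∀ ms θ → F ms (U θ) ≗₂ U (F ms θ) ⊕ D ms θ
  F-U []       θ i j = sym (+-identityʳ (U θ i j))
  F-U (m ∷ ms) θ i j = trans (F-cong ms (φ-U m θ) i j) (trans (F-⊕ ms (U (φ m θ)) (ι m ⊙ φ (pred m) θ) i j)
    (trans (cong₂ _+_ (F-U ms (φ m θ) i j) (F-⊙ ms (ι m) (φ (pred m) θ) i j))
           (lem (U (F ms (φ m θ)) i j) (D ms (φ m θ) i j) (ι m * F ms (φ (pred m) θ) i j))))
    where lem : ∀ x y z → x + y + z ≡ x + (z + y)
          lem = solve-∀ R

  φ-X : ∀ m θ → φ m (X θ) ≗₂ X (φ m θ)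
  φ-X m θ i j rewrite ℕ.+-suc m i | ℕ.+-suc m j =
    interchange-+- (θ (suc (m +ℕ i)) j) (θ (m +ℕ i) (suc j)) (θ (suc i) (m +ℕ j)) _

  X-U : ∀ θ → X (U θ) ≗₂ U (X θ) ⊕ (ι 2 ⊙ θ)
  X-U θ zero zero = lem (θ 0 0)
    where lem : ∀ x → ((1ℚ + 0ℚ) * x + 0ℚ) + (0ℚ + (1ℚ + 0ℚ) * x) ≡ (0ℚ + 0ℚ) + (1ℚ + (1ℚ + 0ℚ)) * x
          lem = solve-∀ R
  X-U θ (suc i) zero = lem (ι i) (θ (suc i) 0) (θ i 1)
    where lem : ∀ n x y → ((1ℚ + (1ℚ + n)) * x + 0ℚ) + ((1ℚ + n) * y + (1ℚ + 0ℚ) * x) ≡ ((1ℚ + n) * (x + y) + 0ℚ) + (1ℚ + (1ℚ + 0ℚ)) * x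
          lem = solve-∀ R
  X-U θ zero (suc j) = lem (ι j) (θ 0 (suc j)) (θ 1 j)
    where lem : ∀ n x y → ((1ℚ + 0ℚ) * x + (1ℚ + n) * y) + (0ℚ + (1ℚ + (1ℚ + n)) * x) ≡ (0ℚ + (1ℚ + n) * (y + x)) + (1ℚ + (1ℚ + 0ℚ)) * x
          lem = solve-∀ R
  X-U θ (suc i) (suc j) = lem (ι i) (ι j) (θ (suc i) (suc j)) (θ i (suc (suc j))) (θ (suc (suc i)) j)
    where lem : ∀ n m x y z → ((1ℚ + (1ℚ + n)) * x + (1ℚ + m) * z) + ((1ℚ + n) * y + (1ℚ + (1ℚ + m)) * x)
                            ≡ ((1ℚ + n) * (x + y) + (1ℚ + m) * (z + x)) + (1ℚ + (1ℚ + 0ℚ)) * x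
          lem = solve-∀ R

  -- Dual form of ∫ (x F)′ = [x F] over [-1,1].
  boundary : ∀ ms θ → F ms (X (U θ)) 0 0 ≡ ι 2 * F ms θ 0 0 + D ms (X θ) 0 0
  boundary ms θ = trans (F-cong ms (X-U θ) 0 0) (trans (F-⊕ ms (U (X θ)) (ι 2 ⊙ θ) 0 0)
    (trans (cong₂ _+_ (F-U ms (X θ) 0 0) (F-⊙ ms (ι 2) θ 0 0)) (lem (D ms (X θ) 0 0) (ι 2 * F ms θ 0 0))))
    where lem : ∀ x y → (0ℚ + 0ℚ) + x + y ≡ y + x
          lem = solve-∀ R

  moved : ℕ → ℕ
  moved 0             = 0
  moved 1             = 0
  moved (suc (suc m)) = suc (suc m)

  support : List ℕ → ℕ
  support []       = 0
  support (m ∷ ms) = moved m +ℕ support ms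

  -- A part 1 contributes nothing, because its derivative is f₀ = 0. This is why deg(ν) - a₁ and not
  -- deg(ν) appears in the bounds. A part m ≥ 2 leaves the slack m w fₘ₋₂ times the other factors.
  D-lower : ∀ ms {θ} → Pos θ → All (1 ≤ℕ_) ms → D ms (X θ) 0 0 ≤ ι (support ms) * F ms θ 0 0
  D-lower [] {θ} p [] = ≤-reflexive (sym (*-zeroˡ (θ 0 0)))
  D-lower (suc zero ∷ ms) {θ} p (_ ∷ q) = ≤-trans (≤-reflexive eq) (D-lower ms (Pos-φ′ 1 p) q)
    where
    z : F ms (φ 0 (X θ)) 0 0 ≡ 0ℚ
    z = F-vanish ms (φ₀ (X θ)) 0 0
    lem : ∀ x → ι 1 * 0ℚ + x ≡ x
    lem = solve-∀ R
    eq : D (1 ∷ ms) (X θ) 0 0 ≡ D ms (X (φ 1 θ)) 0 0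
    eq = trans (cong (λ y → ι 1 * y + D ms (φ 1 (X θ)) 0 0) z) (trans (lem _) (D-cong ms (φ-X 1 θ) 0 0))
  D-lower (suc (suc m) ∷ ms) {θ} p (_ ∷ q) = ≤-from-diff
    (0≤+ (diff-≤ (D-lower ms (Pos-φ′ (suc (suc m)) p) q)) (0≤* (0≤ι (suc (suc m))) (Pos-0 (Pos-F ms (Pos-W (Pos-φ′ m p))))))
    eq
    where
    k = suc (suc m)
    f = F ms (φ k θ) 0 0
    w = F ms (W (φ m θ)) 0 0
    d = D ms (X (φ k θ)) 0 0
    x : F ms (φ (suc m) (X θ)) 0 0 ≡ f - w
    x = trans (F-cong ms (λ i j → trans (φ-X (suc m) θ i j) (trans (lem (X (φ (suc m) θ) i j) (W (φ m θ) i j)) (cong (_- W (φ m θ) i j) (sym (φ-step m θ i j))))) 0 0)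
              (F-⊖ ms (φ k θ) (W (φ m θ)) 0 0)
      where lem : ∀ x y → x ≡ x + y - y
            lem = solve-∀ R
    lem : ∀ s k f w d → (k + s) * f - (k * (f - w) + d) ≡ (s * f - d) + k * w
    lem = solve-∀ R
    eq : ι (k +ℕ support ms) * f - D (k ∷ ms) (X θ) 0 0 ≡ (ι (support ms) * f - d) + ι k * w
    eq = trans (cong₂ (λ a b → a * f - b) (ι-+ k (support ms)) (cong₂ (λ a b → ι k * a + b) x (D-cong ms (φ-X k θ) 0 0)))
               (lem (ι (support ms)) (ι k) f w d)

  -- 1 = (A - B)³ = (A³ - B³) - 3 A B (A - B), where the last A - B is again 1.
  φ₃+3W : ∀ {θ} → Harm θ → φ 3 θ ⊕ (ι 3 ⊙ W θ) ≗₂ θ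
  φ₃+3W {θ} h i j = sym (trans (sym (e i j)) (trans (cong₂ _-_ (sym (e (suc i) j)) (sym (e i (suc j))))
     (trans (cong₂ _-_ (cong₂ _-_ (sym (e (suc (suc i)) j)) (sym (e (suc i) (suc j)))) (cong₂ _-_ (sym (e (suc i) (suc j))) (sym (e i (suc (suc j))))))
     (trans (lem a b c d) (cong (λ z → a - d + ι 3 * - z) (e (suc i) (suc j)))))))
    where
    e = h
    a = θ (suc (suc (suc i))) j
    b = θ (suc (suc i)) (suc j)
    c = θ (suc i) (suc (suc j))
    d = θ i (suc (suc (suc j)))
    lem : ∀ a b c d → (a - b) - (b - c) - ((b - c) - (c - d)) ≡ a - d + ι 3 * - (b - c)
    lem = solve-∀ R

  diag : ℕ → Fn → Fn
  diag c θ i j = θ (c +ℕ i) (c +ℕ j)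

  -- With A, B the two shifts, this is
  -- (Aᶜ⁺ᵃ − Bᶜ⁺ᵃ)(Aᶜ⁺ᵇ − Bᶜ⁺ᵇ) − (Aᶜ − Bᶜ)(Aᶜ⁺ᵃ⁺ᵇ − Bᶜ⁺ᵃ⁺ᵇ) = (A B)ᶜ (Aᵃ − Bᵃ)(Aᵇ − Bᵇ).
  exchange : ∀ c a b θ → φ (c +ℕ a) (φ (c +ℕ b) θ) ⊖ φ c (φ (c +ℕ a +ℕ b) θ) ≗₂ φ a (φ b (diag c θ))
  exchange c a b θ i j = trans
    (cong₂ _-_ (cong₂ _-_ (cong₂ (λ x y → θ x j - θ y (c +ℕ b +ℕ j)) (e₁ i) (ℕ.+-assoc c a i))
                          (cong₂ (λ x y → θ (c +ℕ b +ℕ i) y - θ i x) (e₁ j) (ℕ.+-assoc c a j)))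
               refl)
    (trans (lem (θ (c +ℕ a +ℕ b +ℕ (c +ℕ i)) j) (θ (c +ℕ (a +ℕ i)) (c +ℕ b +ℕ j)) (θ (c +ℕ b +ℕ i) (c +ℕ (a +ℕ j))) (θ i (c +ℕ a +ℕ b +ℕ (c +ℕ j)))
                (θ (c +ℕ i) (c +ℕ a +ℕ b +ℕ j)) (θ (c +ℕ a +ℕ b +ℕ i) (c +ℕ j)))
    (cong₂ _-_ (cong₂ (λ x y → θ x (c +ℕ j) - θ (c +ℕ (a +ℕ i)) y) (e₂ i) (ℕ.+-assoc c b j))
               (cong₂ (λ x y → θ x (c +ℕ (a +ℕ j)) - θ (c +ℕ i) y) (ℕ.+-assoc c b i) (e₂ j))))
    where
    e₁ : ∀ i → c +ℕ b +ℕ (c +ℕ a +ℕ i) ≡ c +ℕ a +ℕ b +ℕ (c +ℕ i)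
    e₁ i = assoc c a b i
      where
      assoc : ∀ c a b i → c +ℕ b +ℕ (c +ℕ a +ℕ i) ≡ c +ℕ a +ℕ b +ℕ (c +ℕ i)
      assoc = solveℕ-∀
    e₂ : ∀ i → c +ℕ a +ℕ b +ℕ i ≡ c +ℕ (b +ℕ (a +ℕ i))
    e₂ i = assoc c a b i
      where
      assoc : ∀ c a b i → c +ℕ a +ℕ b +ℕ i ≡ c +ℕ (b +ℕ (a +ℕ i))
      assoc = solveℕ-∀
    lem : ∀ p q r s x y → ((p - q) - (r - s)) - ((p - x) - (y - s)) ≡ (y - q) - (r - x)
    lem = solve-∀ R

  infix 4 _⊑_
  _⊑_ : Fn → Fn → Set
  θ ⊑ η = Pos (η ⊖ θ)

  ⊑-W : ∀ {θ η} → θ ⊑ η → W θ ⊑ W η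
  ⊑-W {θ} {η} p = Pos-cong (λ i j → lem (η (suc i) (suc j)) (θ (suc i) (suc j))) (Pos-W p)
    where lem : ∀ x y → - (x - y) ≡ - x - - y
          lem = solve-∀ R

  ⊑-F : ∀ ms {θ η} → θ ⊑ η → F ms θ 0 0 ≤ F ms η 0 0
  ⊑-F ms {θ} {η} p = ≤-from-diff (Pos-0 (Pos-F ms p)) (sym (F-⊖ ms η θ 0 0))

  -- `exchange` with c = 1, a = m, b = 2: as f₁ = 1 and A B = -w, the difference is w f₂ fₘ.
  φ-sum-≤ : ∀ m {θ} → Pos θ → φ (suc m) (φ 3 θ) ⊑ φ (suc (suc (suc m))) θ
  φ-sum-≤ m {θ} p = Pos-cong eq (Pos-φ′ m (Pos-φ′ 2 (Pos-W p)))
    where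
    lem : ∀ x y → - (y - x) ≡ x - y
    lem = solve-∀ R
    lem2 : ∀ a b c d → (- a - - b) - (- c - - d) ≡ - ((a - b) - (c - d))
    lem2 = solve-∀ R
    eq : φ m (φ 2 (W θ)) ≗₂ φ (suc (suc (suc m))) θ ⊖ φ (suc m) (φ 3 θ)
    eq i j = trans (lem2 (θ (suc (suc (suc (m +ℕ i)))) (suc j)) (θ (suc (m +ℕ i)) (suc (suc (suc j)))) (θ (3 +ℕ i) (suc (m +ℕ j))) (θ (suc i) (3 +ℕ (m +ℕ j))))
      (trans (cong -_ (sym (exchange 1 m 2 θ i j)))
      (trans (cong (λ z → - (φ (suc m) (φ 3 θ) i j - z)) (trans (φ₁ (φ-harm (suc (m +ℕ 2)) (harmonic p)) i j) (cong (λ k → φ (suc k) θ i j) (ℕ.+-comm m 2))))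
             (lem (φ (suc (suc (suc m))) θ i j) (φ (suc m) (φ 3 θ) i j))))

  -- The difference is w³ f_a f_b: the odd power (A B)³ = -w³ reverses the sign in `exchange`.
  exchange₃ : ∀ a b {θ} → Pos θ → φ (3 +ℕ a) (φ (3 +ℕ b) θ) ⊑ φ 3 (φ (3 +ℕ a +ℕ b) θ)
  exchange₃ a b {θ} p = Pos-cong
    (λ i j → trans (trans (lem2 (θ (3 +ℕ (b +ℕ (a +ℕ i))) (3 +ℕ j)) (θ (3 +ℕ (a +ℕ i)) (3 +ℕ (b +ℕ j))) (θ (3 +ℕ (b +ℕ i)) (3 +ℕ (a +ℕ j))) (θ (3 +ℕ i) (3 +ℕ (b +ℕ (a +ℕ j))))) (cong -_ (sym (exchange 3 a b θ i j))))
                   (lem (φ (3 +ℕ a) (φ (3 +ℕ b) θ) i j) (φ 3 (φ (3 +ℕ a +ℕ b) θ) i j)))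
    (Pos-φ′ a (Pos-φ′ b (Pos-W (Pos-W (Pos-W p)))))
    where
    lem : ∀ x y → - (x - y) ≡ y - x
    lem = solve-∀ R
    lem2 : ∀ a b c d → (- - - a - - - - b) - (- - - c - - - - d) ≡ - ((a - b) - (c - d))
    lem2 = solve-∀ R

  -- `exchange` with c = 2, a = 1. The even power (A B)² = w² gives the opposite sign to c = 3, but
  -- here the 3 stands on the other side of the identity, so again the pair containing a 3 is the
  -- larger.
  exchange₂ : ∀ b {θ} → Pos θ → φ 2 (φ (3 +ℕ b) θ) ⊑ φ 3 (φ (2 +ℕ b) θ)
  exchange₂ b {θ} p = Pos-cong
    (λ i j → trans (lem2 (θ (2 +ℕ (b +ℕ (1 +ℕ i))) (2 +ℕ j)) (θ (2 +ℕ (1 +ℕ i)) (2 +ℕ (b +ℕ j))) (θ (2 +ℕ (b +ℕ i)) (2 +ℕ (1 +ℕ j))) (θ (2 +ℕ i) (2 +ℕ (b +ℕ (1 +ℕ j))))) (sym (exchange 2 1 b θ i j)))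
    (Pos-φ′ 1 (Pos-φ′ b (Pos-W (Pos-W p))))
    where
    lem2 : ∀ a b c d → (- - a - - - b) - (- - c - - - d) ≡ (a - b) - (c - d)
    lem2 = solve-∀ R

  -- For one factor fₘ the claim is (4 f₃ - 1) fₘ ≤ 3 f₃ (fₘ - w fₘ₋₂). After inserting f₃ = 1 - 3w
  -- it becomes 3w f₃ fₘ₋₂ ≤ 3w fₘ, that is, `φ-sum-≤` multiplied by 3w.
  D-upper : ∀ ms {θ} → Pos θ → All (2 ≤ℕ_) ms →
            ι (support ms) * (ι 4 * F ms (φ 3 θ) 0 0 - F ms θ 0 0) ≤ ι 3 * D ms (X (φ 3 θ)) 0 0
  D-upper [] {θ} p [] = ≤-reflexive (trans (*-zeroˡ (ι 4 * φ 3 θ 0 0 - θ 0 0)) (sym (*-zeroʳ (ι 3))))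
  D-upper (suc zero ∷ ms) p (s≤s () ∷ q)
  D-upper (suc (suc m) ∷ ms) {θ} p (_ ∷ q) = ≤-from-diff
    (0≤+ (diff-≤ (D-upper ms (Pos-φ′ k p) q)) (0≤* (0≤ι k) (0≤* (0≤ι 3) (diff-≤ (⊑-F ms (⊑-W {φ m (φ 3 θ)} {φ k θ} (sub m)))))))
    eq
    where
    k = suc (suc m)
    sub : ∀ m → φ m (φ 3 θ) ⊑ φ (suc (suc m)) θ
    sub zero = Pos-cong (λ i j → trans (sym (+-identityʳ (φ 2 θ i j))) (cong (λ z → φ 2 θ i j - z) (sym (φ₀ (φ 3 θ) i j)))) (Pos-φ′ 2 p)
    sub (suc m) = φ-sum-≤ m p
    f₃ = F ms (φ k (φ 3 θ)) 0 0
    f  = F ms (φ k θ) 0 0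
    w₃ = F ms (W (φ m (φ 3 θ))) 0 0
    w  = F ms (W (φ k θ)) 0 0
    f₃′ = F ms (φ 3 (φ k θ)) 0 0
    d = D ms (X (φ 3 (φ k θ))) 0 0
    N = ι (support ms)
    x : F ms (φ (suc m) (X (φ 3 θ))) 0 0 ≡ f₃ - w₃
    x = trans (F-cong ms (λ i j → trans (φ-X (suc m) (φ 3 θ) i j) (trans (lem (X (φ (suc m) (φ 3 θ)) i j) (W (φ m (φ 3 θ)) i j)) (cong (_- W (φ m (φ 3 θ)) i j) (sym (φ-step m (φ 3 θ) i j))))) 0 0)
              (F-⊖ ms (φ k (φ 3 θ)) (W (φ m (φ 3 θ))) 0 0)
      where lem : ∀ x y → x ≡ x + y - y
            lem = solve-∀ R
    comm : f₃ ≡ f₃′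
    comm = F-cong ms (φ-comm k 3 θ) 0 0
    fw : f ≡ f₃′ + ι 3 * w
    fw = trans (F-cong ms (λ i j → sym (φ₃+3W (φ-harm k (harmonic p)) i j)) 0 0)
         (trans (F-⊕ ms (φ 3 (φ k θ)) (ι 3 ⊙ W (φ k θ)) 0 0) (cong (f₃′ +_) (F-⊙ ms (ι 3) (W (φ k θ)) 0 0)))
    lem : ∀ k N f w w₃ d → ι 3 * (k * (f - w₃) + d) - (k + N) * (ι 4 * f - (f + ι 3 * w))
          ≡ (ι 3 * d - N * (ι 4 * f - (f + ι 3 * w))) + k * (ι 3 * (w - w₃))
    lem = solve-∀ R
    eq : ι 3 * D (k ∷ ms) (X (φ 3 θ)) 0 0 - ι (k +ℕ support ms) * (ι 4 * f₃ - f)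
       ≡ (ι 3 * d - N * (ι 4 * f₃′ - f)) + ι k * (ι 3 * (w - w₃))
    eq = trans (cong₂ _-_ (cong (ι 3 *_) (cong₂ (λ a b → ι k * a + b) (trans x (cong (_- w₃) comm))
                     (D-cong ms (λ i j → trans (φ-X k (φ 3 θ) i j) (X-cong (φ-comm k 3 θ) i j)) 0 0)))
                 (cong₂ (λ a b → a * b) (ι-+ k (support ms)) (cong₂ (λ a b → ι 4 * a - b) comm fw)))
         (trans (lem (ι k) N f₃′ w w₃ d) (cong (λ z → (ι 3 * d - N * (ι 4 * f₃′ - z)) + ι k * (ι 3 * (w - w₃))) (sym fw)))

  -- The beta integral, its boundary values and its parity.

  sg : ℕ → ℚ
  sg zero    = 1ℚ
  sg (suc n) = - sg n

  fact : ℕ → ℚ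
  fact zero    = 1ℚ
  fact (suc n) = ι (suc n) * fact n

  ι-pos : ∀ n → Positive (ι (suc n))
  ι-pos n = positive (<-≤-trans (positive⁻¹ 1ℚ) (≤-from-diff {1ℚ} {ι (suc n)} (0≤ι n) (lem (ι n))))
    where lem : ∀ x → 1ℚ + x - 1ℚ ≡ x
          lem = solve-∀ R

  opaque
    -- Reciprocal factorials. They are opaque so that type checking uses only the two equations
    -- below and never unfolds a rational inverse.
    rfact : ℕ → ℚ
    rfact zero    = 1ℚ
    rfact (suc n) = (1/ ι (suc n)) {{pos⇒nonZero (ι (suc n)) {{ι-pos n}}}} * rfact n

    rfact-zero : rfact 0 ≡ 1ℚ
    rfact-zero = refl

    rfact-suc : ∀ n → ι (suc n) * rfact (suc n) ≡ rfact n
    rfact-suc n = trans (sym (*-assoc (ι (suc n)) _ (rfact n)))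
      (trans (cong (_* rfact n) (*-inverseʳ (ι (suc n)) {{pos⇒nonZero (ι (suc n)) {{ι-pos n}}}})) (*-identityˡ (rfact n)))

  fact-rfact : ∀ n → fact n * rfact n ≡ 1ℚ
  fact-rfact zero    = trans (*-identityˡ (rfact 0)) rfact-zero
  fact-rfact (suc n) = trans (lem (ι (suc n)) (fact n) (rfact (suc n)))
                       (trans (cong (λ z → fact n * z) (rfact-suc n)) (fact-rfact n))
    where lem : ∀ x y z → x * y * z ≡ y * (x * z)
          lem = solve-∀ R

  -- L i j is the integral over [0,1] of tⁱ (t − 1)ʲ.
  L : Fn
  L i j = sg j * (fact i * fact j * rfact (suc (i +ℕ j)))

  L-harm : Harm L
  L-harm i j rewrite ℕ.+-suc i j = trans
    (lem (sg j) (ι i) (ι j) (fact i) (fact j) (rfact (suc (suc (i +ℕ j)))))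
    (cong (λ z → sg j * (fact i * fact j * z))
      (trans (cong (_* rfact (suc (suc (i +ℕ j)))) (cong (λ z → 1ℚ + (1ℚ + z)) (sym (ι-+ i j)))) (rfact-suc (suc (i +ℕ j)))))
    where
    lem : ∀ s i j x y r → s * ((1ℚ + i) * x * y * r) - (- s) * (x * ((1ℚ + j) * y) * r)
                        ≡ s * (x * y * ((1ℚ + (1ℚ + (i + j))) * r))
    lem = solve-∀ R

  δ₀ : ℕ → ℚ
  δ₀ zero    = 1ℚ
  δ₀ (suc _) = 0ℚ

  -- Evaluation at t = 1, where (A , B) = (1 , 0), plus e times evaluation at t = 0, where (A , B) =
  -- (0 , -1).
  E : ℚ → Fn
  E e i j = δ₀ j + e * δ₀ i * sg j

  UL-00 : ∀ i j → U L (suc i) (suc j) ≡ 0ℚ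
  UL-00 i j rewrite ℕ.+-suc i j = lem (ι i) (ι j) (fact i) (fact j) (sg j) (rfact (suc (suc (i +ℕ j))))
    where lem : ∀ i j x y s r → (1ℚ + i) * ((- s) * (x * ((1ℚ + j) * y) * r)) + (1ℚ + j) * (s * ((1ℚ + i) * x * y * r)) ≡ 0ℚ
          lem = solve-∀ R

  UL-i0 : ∀ i → U L (suc i) 0 ≡ 1ℚ
  UL-i0 i rewrite ℕ.+-identityʳ i = trans (lem (ι i) (fact i) (rfact (suc i))) (fact-rfact (suc i))
    where lem : ∀ i x r → (1ℚ + i) * (1ℚ * (x * 1ℚ * r)) + 0ℚ ≡ (1ℚ + i) * x * r
          lem = solve-∀ R

  UL-0j : ∀ j → U L 0 (suc j) ≡ sg j
  UL-0j j = trans (lem (ι j) (fact j) (rfact (suc j)) (sg j)) (trans (cong (λ z → sg j * z) (fact-rfact (suc j))) (*-identityʳ (sg j)))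
    where lem : ∀ i x r s → 0ℚ + (1ℚ + i) * (s * (1ℚ * x * r)) ≡ s * ((1ℚ + i) * x * r)
          lem = solve-∀ R

  -- The fundamental theorem of calculus: A + B is 1 at t = 1 and -1 at t = 0, so the boundary
  -- difference of (A + B) p is the sum of the two end values of p.
  X-U-L : X (U L) ≗₂ E 1ℚ
  X-U-L zero    zero    = cong₂ _+_ (UL-i0 0) (UL-0j 0)
  X-U-L (suc i) zero    = cong₂ _+_ (UL-i0 (suc i)) (UL-00 i 0)
  X-U-L zero    (suc j) = trans (cong₂ _+_ (UL-00 0 j) (UL-0j (suc j))) (lem (- sg j))
    where lem : ∀ x → 0ℚ + x ≡ 0ℚ + 1ℚ * 1ℚ * x
          lem = solve-∀ R
  X-U-L (suc i) (suc j) = trans (cong₂ _+_ (UL-00 (suc i) j) (UL-00 i (suc j))) (lem (- sg j))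
    where lem : ∀ x → 0ℚ + 0ℚ ≡ 0ℚ + 1ℚ * 0ℚ * x
          lem = solve-∀ R

  sg-+ : ∀ m n → sg (m +ℕ n) ≡ sg m * sg n
  sg-+ zero    n = sym (*-identityˡ (sg n))
  sg-+ (suc m) n = trans (cong -_ (sg-+ m n)) (neg-distribˡ-* (sg m) (sg n))

  φ-E : ∀ m e → φ (suc m) (E e) ≗₂ E (e * sg m)
  φ-E m e i j = trans (cong (λ z → δ₀ j + e * 0ℚ * sg j - (0ℚ + e * δ₀ i * (- z))) (sg-+ m j)) (lem (δ₀ j) e (sg j) (δ₀ i) (sg m))
    where lem : ∀ d e s d′ m → d + e * 0ℚ * s - (0ℚ + e * d′ * (- (m * s))) ≡ d + e * m * d′ * s
          lem = solve-∀ R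

  -- Parity under t ↦ 1 - t, which exchanges A with -B.
  Sym : ℚ → Fn → Set
  Sym e θ = ∀ i j → θ i j ≡ e * (sg (i +ℕ j) * θ j i)

  φ-Sym : ∀ m e {θ} → Sym e θ → Sym (e * sg m) (φ (suc m) θ)
  φ-Sym m e {θ} h i j = trans (cong₂ _-_ (h (suc (m +ℕ i)) j) (h i (suc (m +ℕ j))))
    (trans (cong₂ (λ a b → e * (- a * θ j (suc (m +ℕ i))) - e * (b * θ (suc (m +ℕ j)) i))
             (trans (cong sg (ℕ.+-assoc m i j)) (sg-+ m (i +ℕ j)))
             (trans (cong sg (ℕ.+-suc i (m +ℕ j))) (cong -_ (trans (cong sg (swap-+ i m j)) (sg-+ m (i +ℕ j))))))
           (lem e (sg m) (sg (i +ℕ j)) (θ j (suc (m +ℕ i))) (θ (suc (m +ℕ j)) i)))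
    where lem : ∀ e m s x y → e * (- (m * s) * x) - e * (- (m * s) * y) ≡ e * m * (s * (y - x))
          lem = solve-∀ R

  sg-sq : ∀ n → sg n * sg n ≡ 1ℚ
  sg-sq zero    = refl
  sg-sq (suc n) = trans (lem (sg n)) (sg-sq n)
    where lem : ∀ x → - x * - x ≡ x * x
          lem = solve-∀ R

  L-Sym : Sym 1ℚ L
  L-Sym i j = sym (trans (cong₂ (λ a b → 1ℚ * (a * (sg i * (fact j * fact i * rfact (suc b))))) (sg-+ i j) (ℕ.+-comm j i))
    (trans (lem (sg i) (sg j) (fact j) (fact i) (rfact (suc (i +ℕ j)))) (trans (cong (_* L i j) (sg-sq i)) (*-identityˡ (L i j)))))
    where lem : ∀ s t x y r → 1ℚ * (s * t * (s * (x * y * r))) ≡ s * s * (t * (y * x * r))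
          lem = solve-∀ R

  sg-cases : ∀ e m → e ≡ 1ℚ ⊎ e ≡ - 1ℚ → e * sg m ≡ 1ℚ ⊎ e * sg m ≡ - 1ℚ
  sg-cases e zero    p = subst (λ z → z ≡ 1ℚ ⊎ z ≡ - 1ℚ) (sym (*-identityʳ e)) p
  sg-cases e (suc m) p with sg-cases e m p
  ... | inj₁ q = inj₂ (trans (sym (neg-distribʳ-* e (sg m))) (cong -_ q))
  ... | inj₂ q = inj₁ (trans (sym (neg-distribʳ-* e (sg m))) (cong -_ q))

  x≡-x⇒x≡0 : ∀ x → x ≡ (- 1ℚ) * x → x ≡ 0ℚ
  x≡-x⇒x≡0 x p = trans (lem x) (trans (cong (λ z → ½ * (x + z)) p) (lem2 x))
    where lem : ∀ x → x ≡ ½ * (x + x)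
          lem = solve-∀ R
          lem2 : ∀ x → ½ * (x + (- 1ℚ) * x) ≡ 0ℚ
          lem2 = solve-∀ R

  -- One sign e governs both quantities: a factor changes its value at t = 0 and the parity of the
  -- functional by the same sign. With final sign -1 the two end values cancel and the functional
  -- vanishes by oddness.
  parity-cases : ∀ ms {e η θ} → All (1 ≤ℕ_) ms → e ≡ 1ℚ ⊎ e ≡ - 1ℚ → η ≗₂ E e → Sym e θ →
                 F ms η 0 0 ≡ ι 2 ⊎ (F ms η 0 0 ≡ 0ℚ × F ms θ 0 0 ≡ 0ℚ)
  parity-cases [] [] (inj₁ refl) h k = inj₁ (h 0 0)
  parity-cases [] {θ = θ} [] (inj₂ refl) h k = inj₂ (h 0 0 , x≡-x⇒x≡0 (θ 0 0) (trans (k 0 0) (cong (λ z → (- 1ℚ) * z) (*-identityˡ (θ 0 0)))))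
  parity-cases (suc m ∷ ms) {e} {η} {θ} (_ ∷ q) c h k =
    parity-cases ms q (sg-cases e m c) (λ i j → trans (φ-cong (suc m) h i j) (φ-E m e i j)) (φ-Sym m e k)

  parity : ∀ ms → All (1 ≤ℕ_) ms →
           F ms (X (U L)) 0 0 ≡ ι 2 ⊎ (F ms (X (U L)) 0 0 ≡ 0ℚ × F ms L 0 0 ≡ 0ℚ)
  parity ms q = parity-cases ms q (inj₁ refl) X-U-L L-Sym

  -- Positivity of the integral and its two basic inequalities.

  open import Data.Unit using (tt)
  open import Data.Sum using (map₂; [_,_]′)
  open import Data.Empty using (⊥-elim)
  open import Data.Nat.Tactic.RingSolver using () renaming (solve-∀ to solveℕ-∀)

  ι-* : ∀ m n → ι (m *ℕ n) ≡ ι m * ι n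
  ι-* zero    n = sym (*-zeroˡ (ι n))
  ι-* (suc m) n = trans (ι-+ n (m *ℕ n)) (trans (cong (λ z → ι n + z) (ι-* m n)) (lem (ι m) (ι n)))
    where lem : ∀ x y → y + x * y ≡ (1ℚ + x) * y
          lem = solve-∀ R

  ι-mono : ∀ {m n} → m ≤ℕ n → ι m ≤ ι n
  ι-mono {n = n} z≤n = 0≤ι n
  ι-mono (s≤s p)     = +-monoʳ-≤ 1ℚ (ι-mono p)

  fact-pos : ∀ n → 0ℚ ≤ fact n
  fact-pos zero    = <⇒≤ (positive⁻¹ 1ℚ)
  fact-pos (suc n) = 0≤* (0≤ι (suc n)) (fact-pos n)

  rfact-pos : ∀ n → 0ℚ ≤ rfact n
  rfact-pos zero    = subst (0ℚ ≤_) (sym rfact-zero) (fact-pos 0)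
  rfact-pos (suc n) = *-cancelˡ-≤-pos (ι (suc n)) {{ι-pos n}}
    (subst₂ _≤_ (sym (*-zeroʳ (ι (suc n)))) (sym (rfact-suc n)) (rfact-pos n))

  W-U : ∀ θ → W (U θ) ≗₂ U (W θ) ⊖ X θ
  W-U θ zero zero = lem (θ 0 1) (θ 1 0)
    where lem : ∀ x y → - ((1ℚ + 0ℚ) * x + (1ℚ + 0ℚ) * y) ≡ (0ℚ + 0ℚ) - (y + x)
          lem = solve-∀ R
  W-U θ (suc i) zero = lem (ι i) (θ (suc i) 1) (θ (suc (suc i)) 0)
    where lem : ∀ n x y → - ((1ℚ + (1ℚ + n)) * x + (1ℚ + 0ℚ) * y) ≡ ((1ℚ + n) * - x + 0ℚ) - (y + x)
          lem = solve-∀ R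
  W-U θ zero (suc j) = lem (ι j) (θ 0 (suc (suc j))) (θ 1 (suc j))
    where lem : ∀ n x y → - ((1ℚ + 0ℚ) * x + (1ℚ + (1ℚ + n)) * y) ≡ (0ℚ + (1ℚ + n) * - y) - (y + x)
          lem = solve-∀ R
  W-U θ (suc i) (suc j) = lem (ι i) (ι j) (θ (suc i) (suc (suc j))) (θ (suc (suc i)) (suc j))
    where lem : ∀ n m x y → - ((1ℚ + (1ℚ + n)) * x + (1ℚ + (1ℚ + m)) * y) ≡ ((1ℚ + n) * - x + (1ℚ + m) * - y) - (y + x)
          lem = solve-∀ R

  value-⊙ : ∀ s k c θ → value s k (c ⊙ θ) ≡ c * value s k θ
  value-⊙ (suc s) k       c θ = trans (value-cong s k λ i j → sym (*-distribˡ-+ c (θ (suc i) j) _)) (value-⊙ s k c (X θ))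
  value-⊙ zero    (suc k) c θ = trans (value-cong zero k λ i j → neg-distribʳ-* c _) (value-⊙ zero k c (W θ))
  value-⊙ zero    zero    c θ = refl

  value-⊖ : ∀ s k θ η → value s k (θ ⊖ η) ≡ value s k θ - value s k η
  value-⊖ s k θ η = trans (value-cong s k λ i j → lem (θ i j) (η i j)) (trans (value-⊕ s k θ ((- 1ℚ) ⊙ η))
    (trans (cong (λ z → value s k θ + z) (value-⊙ s k (- 1ℚ) η)) (sym (lem (value s k θ) (value s k η)))))
    where lem : ∀ x y → x - y ≡ x + (- 1ℚ) * y
          lem = solve-∀ R

  value-U₀ : ∀ k θ → value 0 (suc k) (U θ) ≡ - (ι (suc k) * value 1 k θ)
  value-U₀ zero θ = trans (W-U θ 0 0) (lem (X θ 0 0))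
    where lem : ∀ x → (0ℚ + 0ℚ) - x ≡ - ((1ℚ + 0ℚ) * x)
          lem = solve-∀ R
  value-U₀ (suc k) θ = trans (value-cong 0 (suc k) (W-U θ)) (trans (value-⊖ 0 (suc k) (U (W θ)) (X θ))
    (trans (cong (_- value 1 (suc k) θ) (trans (value-U₀ k (W θ)) (cong (λ z → - (ι (suc k) * z)) (value-W 1 k θ)))) (lem (ι k) (value 1 (suc k) θ))))
    where lem : ∀ n x → - ((1ℚ + n) * x) - x ≡ - ((1ℚ + (1ℚ + n)) * x)
          lem = solve-∀ R

  -- The product rule for xˢ⁺¹ wᵏ⁺¹, with x′ = 2 and w′ = -x as derivatives in t.
  value-U : ∀ s k θ → value (suc s) (suc k) (U θ) ≡ ι 2 * ι (suc s) * value s (suc k) θ - ι (suc k) * value (suc (suc s)) k θ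
  value-U zero k θ = trans (value-cong 0 (suc k) (X-U θ)) (trans (value-⊕ 0 (suc k) (U (X θ)) (ι 2 ⊙ θ))
    (trans (cong₂ _+_ (value-U₀ k (X θ)) (value-⊙ 0 (suc k) (ι 2) θ)) (lem (ι (suc k) * value 2 k θ) (value 0 (suc k) θ))))
    where lem : ∀ x y → - x + ι 2 * y ≡ ι 2 * (1ℚ + 0ℚ) * y - x
          lem = solve-∀ R
  value-U (suc s) k θ = trans (value-cong (suc s) (suc k) (X-U θ)) (trans (value-⊕ (suc s) (suc k) (U (X θ)) (ι 2 ⊙ θ))
    (trans (cong₂ _+_ (value-U s k (X θ)) (value-⊙ (suc s) (suc k) (ι 2) θ)) (lem (ι s) (value (suc s) (suc k) θ) (ι (suc k) * value (suc (suc (suc s))) k θ))))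
    where lem : ∀ n x y → (ι 2 * (1ℚ + n) * x - y) + ι 2 * x ≡ ι 2 * (1ℚ + (1ℚ + n)) * x - y
          lem = solve-∀ R

  -- The derivative of xˢ⁺¹ wᵏ⁺¹ integrates to 0, as w vanishes at both ends. Two powers of x are
  -- thereby traded for one of w.
  value-step-L : ∀ s k → ι (suc k) * value (suc (suc s)) k L ≡ ι 2 * ι (suc s) * value s (suc k) L
  value-step-L s k = lem _ _ (trans (sym (value-U s k L)) (trans (value-cong s (suc k) X-U-L)
    (trans (sym (value-W s k (E 1ℚ))) (value-vanish s k (λ i j → vanish (sg j))))))
    where
    vanish : ∀ x → - (0ℚ + 1ℚ * 0ℚ * - x) ≡ 0ℚ
    vanish = solve-∀ R
    lem : ∀ x y → x - y ≡ 0ℚ → y ≡ x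
    lem x y p = trans (lem2 x y) (trans (cong (λ z → x - z) p) (+-identityʳ x))
      where lem2 : ∀ x y → y ≡ x - (x - y)
            lem2 = solve-∀ R

  value-diag : ∀ k {θ} → (∀ i → 0ℚ ≤ sg i * θ i i) → 0ℚ ≤ value 0 k θ
  value-diag zero    {θ} h = subst (0ℚ ≤_) (*-identityˡ (θ 0 0)) (h 0)
  value-diag (suc k) {θ} h = value-diag k (λ i → subst (0ℚ ≤_) (lem (sg i) (θ (suc i) (suc i))) (h (suc i)))
    where lem : ∀ x y → (- x) * y ≡ x * - y
          lem = solve-∀ R

  -- Induction on s in steps of two: for s = 0 the signs of (-A B)ᵏ and of the beta value cancel,
  -- for s = 1 the value vanishes by symmetry, and `value-step-L` does the rest.
  value-L : ∀ s k → 0ℚ ≤ value s k L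
  value-L zero k = value-diag k (λ i → subst (0ℚ ≤_)
    (trans (sym (*-identityˡ (body i))) (trans (cong (_* body i) (sym (sg-sq i))) (*-assoc (sg i) (sg i) (body i))))
    (0≤* (0≤* (fact-pos i) (fact-pos i)) (rfact-pos _)))
    where body : ℕ → ℚ
          body i = fact i * fact i * rfact (suc (i +ℕ i))
  value-L (suc zero) k = value-diag k (λ i → ≤-reflexive (sym (trans (cong (λ z → sg i * (L (suc i) i + (- sg i) * (fact i * fact (suc i) * rfact (suc z)))) (ℕ.+-suc i i))
      (lem (sg i) (fact i) (fact (suc i)) (rfact (suc (suc (i +ℕ i))))))))
    where lem : ∀ s x y r → s * (s * (y * x * r) + (- s) * (x * y * r)) ≡ 0ℚ
          lem = solve-∀ R
  value-L (suc (suc s)) k = *-cancelˡ-≤-pos (ι (suc k)) {{ι-pos k}}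
    (subst₂ _≤_ (sym (*-zeroʳ (ι (suc k)))) (sym (value-step-L s k)) (0≤* (0≤* (0≤ι 2) (0≤ι (suc s))) (value-L s (suc k))))

  Pos-L : Pos L
  Pos-L = mkPos L-harm value-L

  I : List ℕ → ℚ
  I ms = F ms L 0 0

  I-nonneg : ∀ ms → 0ℚ ≤ I ms
  I-nonneg ms = Pos-0 (Pos-F ms Pos-L)

  private
    lower-lem : ∀ n x d t → t ≡ ι 2 → t ≡ ι 2 * x + d → d ≤ n * x → ι 2 ≤ (1ℚ + (1ℚ + n)) * x
    lower-lem n x d t e e′ p = ≤-from-diff (diff-≤ p) (trans (cong (λ z → (1ℚ + (1ℚ + n)) * x - z) (trans (sym e) e′)) (lem n x d))
      where lem : ∀ n x d → (1ℚ + (1ℚ + n)) * x - (ι 2 * x + d) ≡ n * x - d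
            lem = solve-∀ R

    boundary-lem : ∀ {x t} → t ≡ ι 2 ⊎ t ≡ 0ℚ → t ≡ x → x ≤ ι 2
    boundary-lem (inj₁ e) f = ≤-reflexive (trans (sym f) e)
    boundary-lem {x} (inj₂ e) f = subst (_≤ ι 2) (trans (sym e) f) (0≤ι 2)

  I-lower : ∀ ms → All (1 ≤ℕ_) ms → I ms ≡ 0ℚ ⊎ ι 2 ≤ ι (2 +ℕ support ms) * I ms
  I-lower ms q = [ (λ e → inj₂ (lower-lem (ι (support ms)) (I ms) (D ms (X L) 0 0) _ e (boundary ms L) (D-lower ms Pos-L q)))
                 , (λ z → inj₁ (proj₂ z)) ]′ (parity ms q)

  boundary-≤ : ∀ ms → All (1 ≤ℕ_) ms → ι 2 * I ms + D ms (X L) 0 0 ≤ ι 2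
  boundary-≤ ms q = boundary-lem (map₂ proj₁ (parity ms q)) (boundary ms L)

  weaken : ∀ {ms} → All (2 ≤ℕ_) ms → All (1 ≤ℕ_) ms
  weaken []      = []
  weaken (p ∷ q) = ℕ.≤-trans (ℕ.n≤1+n 1) p ∷ weaken q

  -- Three times the boundary inequality for `3 ∷ ms`, plus `D-upper`. The additional factor f₃ is
  -- differentiated separately, x · 3 f₂ = 3 (f₃ - w), and w is eliminated through f₃ = 1 - 3w.
  I-step : ∀ ms → All (2 ≤ℕ_) ms →
           ι (6 +ℕ 4 *ℕ (3 +ℕ support ms)) * I (3 ∷ ms) ≤ ι 6 + ι (3 +ℕ support ms) * I ms
  I-step ms q = ≤-from-diff
    (0≤+ (0≤* (0≤ι 3) (diff-≤ (boundary-≤ (3 ∷ ms) (s≤s z≤n ∷ weaken q)))) (diff-≤ (D-upper ms Pos-L q)))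
    (trans (cong₂ (λ a b → (ι 6 + b) - a * i₃)
                  (trans (ι-+ 6 (4 *ℕ (3 +ℕ support ms))) (cong (λ z → ι 6 + z) (trans (ι-* 4 (3 +ℕ support ms)) (cong (λ z → ι 4 * z) (ι-+ 3 (support ms)))))) (cong₂ _*_ (ι-+ 3 (support ms)) iw))
           (trans (lem N i₃ w d) (cong₂ (λ a b → ι 3 * (ι 2 - (ι 2 * i₃ + a)) + (ι 3 * d - N * (ι 4 * i₃ - b))) (sym dd) (sym iw))))
    where
    N = ι (support ms)
    i₃ = I (3 ∷ ms)
    w = F ms (W L) 0 0
    d = D ms (X (φ 3 L)) 0 0
    iw : I ms ≡ i₃ + ι 3 * w
    iw = trans (F-cong ms (λ i j → sym (φ₃+3W L-harm i j)) 0 0)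
         (trans (F-⊕ ms (φ 3 L) (ι 3 ⊙ W L) 0 0) (cong (i₃ +_) (F-⊙ ms (ι 3) (W L) 0 0)))
    x : F ms (φ 2 (X L)) 0 0 ≡ i₃ - w
    x = trans (F-cong ms (λ i j → trans (φ-X 2 L i j) (trans (lem′ (X (φ 2 L) i j) (W L i j))
                (cong (_- W L i j) (trans (cong (λ z → X (φ 2 L) i j + z) (sym (W-cong (φ₁ L-harm) i j))) (sym (φ-step 1 L i j)))))) 0 0)
              (F-⊖ ms (φ 3 L) (W L) 0 0)
      where lem′ : ∀ x y → x ≡ x + y - y
            lem′ = solve-∀ R
    dd : D (3 ∷ ms) (X L) 0 0 ≡ ι 3 * (i₃ - w) + d
    dd = cong₂ (λ a b → ι 3 * a + b) x (D-cong ms (φ-X 3 L) 0 0)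
    lem : ∀ N i w d → (ι 6 + (ι 3 + N) * (i + ι 3 * w)) - (ι 6 + ι 4 * (ι 3 + N)) * i
        ≡ ι 3 * (ι 2 - (ι 2 * i + (ι 3 * (i - w) + d))) + (ι 3 * d - N * (ι 4 * i - (i + ι 3 * w)))
    lem = solve-∀ R

  -- Reduction to cycle types containing a 3, and the induction for the upper bound.

  open import Data.Sum using ([_,_]′)
  open import Data.Nat.Induction using (<-rec)
  open import Data.Nat.Tactic.RingSolver using () renaming (solve-∀ to solveℕ-∀)
  open import Data.Unit using (tt)

  infix 4 _≼_
  -- Quantifying over all `Pos` functionals instead of fixing `L` is what makes `≼-cons` work: a
  -- further factor is absorbed into θ.
  record _≼_ (ms ns : List ℕ) : Set where
    constructor dominated
    field apply : ∀ {θ} → Pos θ → F ms θ 0 0 ≤ F ns θ 0 0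
  open _≼_

  F-swap : ∀ a b ms θ → F (a ∷ b ∷ ms) θ ≗₂ F (b ∷ a ∷ ms) θ
  F-swap a b ms θ = F-cong ms (φ-comm b a θ)

  ≼-swap : ∀ a b ms → (a ∷ b ∷ ms) ≼ (b ∷ a ∷ ms)
  ≼-swap a b ms = dominated λ {θ} p → ≤-reflexive (F-swap a b ms θ 0 0)

  ≼-trans : ∀ {ms ns ls} → ms ≼ ns → ns ≼ ls → ms ≼ ls
  ≼-trans p q = dominated λ r → ≤-trans (apply p r) (apply q r)

  ≼-cons : ∀ m {ms ns} → ms ≼ ns → (m ∷ ms) ≼ (m ∷ ns)
  ≼-cons m p = dominated λ r → apply p (Pos-φ′ m r)

  ≼-exchange₃ : ∀ a b ms → (3 +ℕ b ∷ 3 +ℕ a ∷ ms) ≼ (3 ∷ 3 +ℕ a +ℕ b ∷ ms)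
  ≼-exchange₃ a b ms = dominated λ {θ} p → ≤-trans (⊑-F ms (exchange₃ a b p)) (≤-reflexive (F-swap (3 +ℕ a +ℕ b) 3 ms θ 0 0))

  ≼-exchange₂ : ∀ b ms → (3 +ℕ b ∷ 2 ∷ ms) ≼ (3 ∷ 2 +ℕ b ∷ ms)
  ≼-exchange₂ b ms = dominated λ {θ} p → ≤-trans (⊑-F ms (exchange₂ b p)) (≤-reflexive (F-swap (2 +ℕ b) 3 ms θ 0 0))

  -- The exchange inequalities produce a 3 except from twos alone or from one part above 3; these
  -- two shapes are integrated directly. An exchange keeps the sum of the parts, so removing the 3
  -- lowers the support by exactly 3.
  data Shape (ms : List ℕ) : Set where
    twos   : All (_≡ 2) ms → Shape ms
    single : ∀ j → ms ≡ 4 +ℕ j ∷ [] → Shape ms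
    three  : ∀ ns → All (2 ≤ℕ_) ns → support ms ≡ 3 +ℕ support ns → ms ≼ (3 ∷ ns) → Shape ms

  2≤2+ : ∀ {m} → 2 ≤ℕ suc (suc m)
  2≤2+ = s≤s (s≤s z≤n)

  shape : ∀ ms → All (2 ≤ℕ_) ms → Shape ms
  shape [] [] = twos []
  shape (1 ∷ ms) (s≤s () ∷ q)
  shape (2 ∷ ms) (_ ∷ q) with shape ms q
  ... | twos t = twos (refl ∷ t)
  ... | single j refl = three (3 +ℕ j ∷ []) (2≤2+ ∷ []) refl (≼-trans (≼-swap 2 (4 +ℕ j) []) (≼-exchange₂ (suc j) []))
  ... | three ns r e p = three (2 ∷ ns) (2≤2+ ∷ r)
          (trans (cong (2 +ℕ_) e) refl) (≼-trans (≼-cons 2 p) (≼-swap 2 3 ns))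
  shape (3 ∷ ms) (_ ∷ q) = three ms q refl (dominated λ _ → ≤-refl)
  shape (suc (suc (suc (suc a))) ∷ ms) (_ ∷ q) with shape ms q
  shape (suc (suc (suc (suc a))) ∷ []) (_ ∷ q) | _ = single a refl
  shape (suc (suc (suc (suc a))) ∷ _ ∷ ms′) (_ ∷ q) | twos (refl ∷ t) = three (3 +ℕ a ∷ ms′) (2≤2+ ∷ tail q) (lem a (support ms′)) (≼-exchange₂ (suc a) ms′)
    where
    tail : ∀ {x xs} → All (2 ≤ℕ_) (x ∷ xs) → All (2 ≤ℕ_) xs
    tail (_ ∷ q) = q
    lem : ∀ a s → 4 +ℕ a +ℕ (2 +ℕ s) ≡ 3 +ℕ (3 +ℕ a +ℕ s)
    lem = solveℕ-∀
  -- Two parts above 3: one is cut down to 3 and its excess goes to the other.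
  shape (suc (suc (suc (suc a))) ∷ ms@(_ ∷ _)) (_ ∷ q) | single j refl = three (3 +ℕ suc j +ℕ suc a ∷ []) (2≤2+ ∷ []) (lem a j) (≼-exchange₃ (suc j) (suc a) [])
    where
    lem : ∀ a j → 4 +ℕ a +ℕ (4 +ℕ j +ℕ 0) ≡ 3 +ℕ (3 +ℕ suc j +ℕ suc a +ℕ 0)
    lem = solveℕ-∀
  shape (suc (suc (suc (suc a))) ∷ ms@(_ ∷ _)) (_ ∷ q) | three ns r e p = three (4 +ℕ a ∷ ns) (2≤2+ ∷ r)
          (trans (cong (4 +ℕ a +ℕ_) e) (lem a (support ns))) (≼-trans (≼-cons (4 +ℕ a) p) (≼-swap (4 +ℕ a) 3 ns))
    where
    lem : ∀ a s → 4 +ℕ a +ℕ (3 +ℕ s) ≡ 3 +ℕ (4 +ℕ a +ℕ s)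
    lem = solveℕ-∀

  -- Bounds are kept in the form x · denominator ≤ numerator, so that comparing two fractions is an
  -- inequality in ℕ, settled by evaluation or by an explicit slack.
  cross : ∀ x p q d c → x * ι (suc p) ≤ ι q → q *ℕ d ≤ℕ c *ℕ suc p → x * ι d ≤ ι c
  cross x p q d c h k = *-cancelʳ-≤-pos (ι (suc p)) {{ι-pos p}}
    (≤-trans (≤-reflexive (lem x (ι d) (ι (suc p))))
    (≤-trans (*-monoʳ-≤-nonNeg (ι d) {{nonNegative (0≤ι d)}} h)
    (≤-trans (≤-reflexive (sym (ι-* q d))) (≤-trans (ι-mono k) (≤-reflexive (ι-* c (suc p)))))))
    where lem : ∀ x d p → x * d * p ≡ x * p * d
          lem = solve-∀ R

  -- I λ ≤ num N / (1 + den N) for N = support λ.  From N = 7 on this is the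
  -- upper bound of the theorem; the smaller values start the induction in steps
  -- of 3.  The step from 6 to 9 is an equality, which is where 19/29 comes from.
  num den : ℕ → ℕ
  num 0 = 1
  num 1 = 2
  num 2 = 1
  num 3 = 1
  num 4 = 2
  num 5 = 1
  num 6 = 3
  num (suc (suc (suc (suc (suc (suc (suc _))))))) = 58
  den 0 = 0
  den 1 = 2
  den 2 = 1
  den 3 = 1
  den 4 = 4
  den 5 = 2
  den 6 = 9
  den (suc (suc (suc (suc (suc (suc (suc n))))))) = 18 +ℕ 29 *ℕ (7 +ℕ n)

  Bounded : List ℕ → Set
  Bounded ms = I ms * ι (suc (den (support ms))) ≤ ι (num (support ms))

  ≤!_ : ∀ {m n} k → m +ℕ k ≡ n → m ≤ℕ n
  (≤! k) e = ℕ.≤-trans (ℕ.m≤m+n _ k) (ℕ.≤-reflexive e)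

  bounded-two : ∀ n x → x * ι (2 +ℕ n) ≤ ι 2 → x * ι (suc (den n)) ≤ ι (num n)
  bounded-two 0 x h = cross x 1 2 (suc (den 0)) (num 0) h (ℕ.≤ᵇ⇒≤ _ _ tt)
  bounded-two 1 x h = cross x 2 2 (suc (den 1)) (num 1) h (ℕ.≤ᵇ⇒≤ _ _ tt)
  bounded-two 2 x h = cross x 3 2 (suc (den 2)) (num 2) h (ℕ.≤ᵇ⇒≤ _ _ tt)
  bounded-two 3 x h = cross x 4 2 (suc (den 3)) (num 3) h (ℕ.≤ᵇ⇒≤ _ _ tt)
  bounded-two 4 x h = cross x 5 2 (suc (den 4)) (num 4) h (ℕ.≤ᵇ⇒≤ _ _ tt)
  bounded-two 5 x h = cross x 6 2 (suc (den 5)) (num 5) h (ℕ.≤ᵇ⇒≤ _ _ tt)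
  bounded-two 6 x h = cross x 7 2 (suc (den 6)) (num 6) h (ℕ.≤ᵇ⇒≤ _ _ tt)
  bounded-two (suc (suc (suc (suc (suc (suc (suc n))))))) x h = cross x (8 +ℕ n) 2 (suc (18 +ℕ 29 *ℕ (7 +ℕ n))) 58 h ((≤! 78) (lem n))
    where lem : ∀ n → 2 *ℕ suc (18 +ℕ 29 *ℕ (7 +ℕ n)) +ℕ 78 ≡ 58 *ℕ (9 +ℕ n)
          lem = solveℕ-∀

  bounded-single : ∀ n x → x * ι (5 +ℕ n) ≤ ι 2 → x * ι (suc (den (4 +ℕ n))) ≤ ι (num (4 +ℕ n))
  bounded-single 0 x h = cross x 4 2 (suc (den 4)) (num 4) h (ℕ.≤ᵇ⇒≤ _ _ tt)
  bounded-single 1 x h = cross x 5 2 (suc (den 5)) (num 5) h (ℕ.≤ᵇ⇒≤ _ _ tt)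
  bounded-single 2 x h = cross x 6 2 (suc (den 6)) (num 6) h (ℕ.≤ᵇ⇒≤ _ _ tt)
  bounded-single (suc (suc (suc n))) x h = cross x (7 +ℕ n) 2 (suc (18 +ℕ 29 *ℕ (7 +ℕ n))) 58 h ((≤! 20) (lem n))
    where lem : ∀ n → 2 *ℕ suc (18 +ℕ 29 *ℕ (7 +ℕ n)) +ℕ 20 ≡ 58 *ℕ (8 +ℕ n)
          lem = solveℕ-∀

  -- The bound for N = n inserted into `I-step`, with denominators cleared. From n = 7 on both sides
  -- are quadratic with the same leading coefficient, so the slack is linear in n.
  step-≤ : ∀ n → (6 *ℕ suc (den n) +ℕ (3 +ℕ n) *ℕ num n) *ℕ suc (den (3 +ℕ n))
               ≤ℕ num (3 +ℕ n) *ℕ ((6 +ℕ 4 *ℕ (3 +ℕ n)) *ℕ suc (den n))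
  step-≤ 0 = ℕ.≤ᵇ⇒≤ _ _ tt
  step-≤ 1 = ℕ.≤ᵇ⇒≤ _ _ tt
  step-≤ 2 = ℕ.≤ᵇ⇒≤ _ _ tt
  step-≤ 3 = ℕ.≤ᵇ⇒≤ _ _ tt
  step-≤ 4 = ℕ.≤ᵇ⇒≤ _ _ tt
  step-≤ 5 = ℕ.≤ᵇ⇒≤ _ _ tt
  step-≤ 6 = ℕ.≤ᵇ⇒≤ _ _ tt
  step-≤ (suc (suc (suc (suc (suc (suc (suc n))))))) = (≤! (1488 +ℕ 1740 *ℕ n)) (lem n)
    where lem : ∀ n → (6 *ℕ suc (18 +ℕ 29 *ℕ (7 +ℕ n)) +ℕ (10 +ℕ n) *ℕ 58) *ℕ suc (18 +ℕ 29 *ℕ (10 +ℕ n)) +ℕ (1488 +ℕ 1740 *ℕ n)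
                    ≡ 58 *ℕ ((6 +ℕ 4 *ℕ (10 +ℕ n)) *ℕ suc (18 +ℕ 29 *ℕ (7 +ℕ n)))
          lem = solveℕ-∀

  bounded-step : ∀ n x y → ι (6 +ℕ 4 *ℕ (3 +ℕ n)) * x ≤ ι 6 + ι (3 +ℕ n) * y →
                 y * ι (suc (den n)) ≤ ι (num n) → x * ι (suc (den (3 +ℕ n))) ≤ ι (num (3 +ℕ n))
  bounded-step n x y h k = cross x (den n +ℕ (5 +ℕ 4 *ℕ (3 +ℕ n)) *ℕ suc (den n)) (6 *ℕ suc (den n) +ℕ (3 +ℕ n) *ℕ num n) (suc (den (3 +ℕ n))) (num (3 +ℕ n))
    (≤-trans (≤-reflexive (trans (cong (λ z → x * z) (ι-* (6 +ℕ 4 *ℕ (3 +ℕ n)) (suc (den n)))) (lem₁ x (ι (6 +ℕ 4 *ℕ (3 +ℕ n))) d)))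
    (≤-trans (*-monoʳ-≤-nonNeg d {{nonNegative (0≤ι (suc (den n)))}} h)
    (≤-trans (≤-reflexive (lem₂ (ι 6) (ι (3 +ℕ n)) y d))
    (≤-trans (+-monoʳ-≤ (ι 6 * d) (*-monoˡ-≤-nonNeg (ι (3 +ℕ n)) {{nonNegative (0≤ι (3 +ℕ n))}} k))
             (≤-reflexive (sym (trans (ι-+ (6 *ℕ suc (den n)) ((3 +ℕ n) *ℕ num n)) (cong₂ _+_ (ι-* 6 (suc (den n))) (ι-* (3 +ℕ n) (num n))))))))))
    (step-≤ n)
    where
    d = ι (suc (den n))
    lem₁ : ∀ x p d → x * (p * d) ≡ p * x * d
    lem₁ = solve-∀ R
    lem₂ : ∀ s n y d → (s + n * y) * d ≡ s * d + n * (y * d)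
    lem₂ = solve-∀ R

  open import Data.Sum using ([_,_]′)
  open import Data.Nat.Induction using (<-rec)
  open import Data.Nat.Tactic.RingSolver using () renaming (solve-∀ to solveℕ-∀)
  open import Data.Unit using (tt)
  open import Data.Nat using () renaming (_<_ to _<ℕ_)

  sg-±1 : ∀ m → sg m ≡ 1ℚ ⊎ sg m ≡ - 1ℚ
  sg-±1 m = subst (λ z → z ≡ 1ℚ ⊎ z ≡ - 1ℚ) (*-identityˡ (sg m)) (sg-cases 1ℚ m (inj₁ refl))

  -- The integral of a single factor is (1 - (-1)ᵐ)/(m + 1).
  I-single : ∀ m → I (m ∷ []) * ι (suc m) ≤ ι 2
  I-single m = ≤-trans (≤-reflexive (trans (cong₂ (λ a b → (1ℚ * (fact a * 1ℚ * rfact (suc b)) - sg a * (1ℚ * fact a * rfact (suc a))) * ι (suc m)) (ℕ.+-identityʳ m) (trans (ℕ.+-identityʳ (m +ℕ 0)) (ℕ.+-identityʳ m)))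
     (trans (lem (fact m) (rfact (suc m)) (ι (suc m)) (sg m)) (trans (cong (λ z → (1ℚ - sg m) * (fact m * z)) (rfact-suc m))
       (trans (cong (λ z → (1ℚ - sg m) * z) (fact-rfact m)) (*-identityʳ (1ℚ - sg m))))))) (bound (sg-±1 m))
    where
    lem : ∀ f r n s → (1ℚ * (f * 1ℚ * r) - s * (1ℚ * f * r)) * n ≡ (1ℚ - s) * (f * (n * r))
    lem = solve-∀ R
    bound : ∀ {s} → s ≡ 1ℚ ⊎ s ≡ - 1ℚ → 1ℚ - s ≤ ι 2
    bound (inj₁ e) = subst (λ s → 1ℚ - s ≤ ι 2) (sym e) (≤ᵇ⇒≤ tt)
    bound (inj₂ e) = subst (λ s → 1ℚ - s ≤ ι 2) (sym e) (≤ᵇ⇒≤ tt)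

  φ₂-X : ∀ {θ} → Harm θ → φ 2 θ ≗₂ X θ
  φ₂-X {θ} h i j = trans (φ-step 0 θ i j) (trans (cong₂ _+_ (X-cong (φ₁ h) i j) (cong -_ (φ₀ θ (suc i) (suc j)))) (+-identityʳ (X θ i j)))

  -- For m = 2 the slack of `D-lower` contains f₀ = 0, so the estimate is an equality and the
  -- boundary identity also bounds the integral from above.
  D-twos : ∀ ms {θ} → Harm θ → All (_≡ 2) ms → D ms (X θ) 0 0 ≡ ι (support ms) * F ms θ 0 0
  D-twos [] {θ} h [] = sym (*-zeroˡ (θ 0 0))
  D-twos (.2 ∷ ms) {θ} h (refl ∷ q) = trans
    (cong₂ (λ a b → ι 2 * a + b)
      (F-cong ms (λ i j → trans (φ₁ (X-harm h) i j) (sym (φ₂-X h i j))) 0 0)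
      (trans (D-cong ms (φ-X 2 θ) 0 0) (D-twos ms (φ-harm 2 h) q)))
    (trans (lem (F ms (φ 2 θ) 0 0) (ι (support ms))) (cong (_* F ms (φ 2 θ) 0 0) (sym (ι-+ 2 (support ms)))))
    where lem : ∀ x n → ι 2 * x + n * x ≡ (ι 2 + n) * x
          lem = solve-∀ R

  I-twos : ∀ ms → All (_≡ 2) ms → All (2 ≤ℕ_) ms → I ms * ι (2 +ℕ support ms) ≤ ι 2
  I-twos ms t q = ≤-trans (≤-reflexive (trans (lem (I ms) (ι (support ms))) (cong (λ z → ι 2 * I ms + z) (sym (D-twos ms L-harm t)))))
                          (boundary-≤ ms (weaken q))
    where lem : ∀ x n → x * (1ℚ + (1ℚ + n)) ≡ ι 2 * x + n * x
          lem = solve-∀ R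

  private
    P : ℕ → Set
    P n = ∀ ms → All (2 ≤ℕ_) ms → support ms ≡ n → Bounded ms

    bounded-at : ∀ {n ms} → support ms ≡ n → I ms * ι (suc (den n)) ≤ ι (num n) → Bounded ms
    bounded-at {n} {ms} e h = subst (λ k → I ms * ι (suc (den k)) ≤ ι (num k)) (sym e) h

    bounded-by-shape : ∀ n → (∀ {k} → k <ℕ n → P k) → ∀ ms → All (2 ≤ℕ_) ms → support ms ≡ n → Shape ms → Bounded ms
    bounded-by-shape n ih ms q e (twos t) = bounded-two (support ms) (I ms) (I-twos ms t q)
    bounded-by-shape n ih ms q e (single j refl) = bounded-at {4 +ℕ j} {ms} (ℕ.+-identityʳ (4 +ℕ j)) (bounded-single j (I (4 +ℕ j ∷ [])) (I-single (4 +ℕ j)))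
    bounded-by-shape n ih ms q e (three ns r f p) = bounded-at {3 +ℕ support ns} {ms} f
      (≤-trans (*-monoʳ-≤-nonNeg (ι d) {{nonNegative (0≤ι d)}} (apply p Pos-L))
               (bounded-step (support ns) (I (3 ∷ ns)) (I ns) (I-step ns r)
                 (ih (ℕ.≤-trans (s≤s (ℕ.m≤n+m (support ns) 2)) (ℕ.≤-reflexive (trans (sym f) e))) ns r refl)))
      where d = suc (den (3 +ℕ support ns))

  bounded : ∀ ms → All (2 ≤ℕ_) ms → Bounded ms
  bounded ms q = <-rec P (λ n ih ms q e → bounded-by-shape n ih ms q e (shape ms q)) (support ms) ms q refl

  final-≤ : ∀ n x → x * ι (suc (den n)) ≤ ι (num n) → x * ι (19 +ℕ 29 *ℕ n) ≤ ι 58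
  final-≤ n x h = cross x (den n) (num n) (19 +ℕ 29 *ℕ n) 58 h (lem n)
    where
    lem : ∀ n → num n *ℕ (19 +ℕ 29 *ℕ n) ≤ℕ 58 *ℕ suc (den n)
    lem 0 = ℕ.≤ᵇ⇒≤ _ _ tt
    lem 1 = ℕ.≤ᵇ⇒≤ _ _ tt
    lem 2 = ℕ.≤ᵇ⇒≤ _ _ tt
    lem 3 = ℕ.≤ᵇ⇒≤ _ _ tt
    lem 4 = ℕ.≤ᵇ⇒≤ _ _ tt
    lem 5 = ℕ.≤ᵇ⇒≤ _ _ tt
    lem 6 = ℕ.≤ᵇ⇒≤ _ _ tt
    lem (suc (suc (suc (suc (suc (suc (suc n))))))) = ℕ.≤-refl

  big : List ℕ → List ℕ
  big []                   = []
  big (suc (suc m) ∷ ms) = suc (suc m) ∷ big ms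
  big (_ ∷ ms)           = big ms

  big-≥2 : ∀ ms → All (2 ≤ℕ_) (big ms)
  big-≥2 []                   = []
  big-≥2 (0 ∷ ms)             = big-≥2 ms
  big-≥2 (1 ∷ ms)             = big-≥2 ms
  big-≥2 (suc (suc m) ∷ ms) = 2≤2+ ∷ big-≥2 ms

  support-big : ∀ ms → support (big ms) ≡ support ms
  support-big []                   = refl
  support-big (0 ∷ ms)             = support-big ms
  support-big (1 ∷ ms)             = support-big ms
  support-big (suc (suc m) ∷ ms) = cong (suc (suc m) +ℕ_) (support-big ms)

  F-big : ∀ ms {θ} → Harm θ → All (1 ≤ℕ_) ms → F (big ms) θ ≗₂ F ms θ
  F-big []                   h q       i j = refl
  F-big (1 ∷ ms)             h (_ ∷ q) i j = trans (F-cong (big ms) (λ i j → sym (φ₁ h i j)) i j) (F-big ms (φ-harm 1 h) q i j)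
  F-big (suc (suc m) ∷ ms) h (_ ∷ q) i j = F-big ms (φ-harm (suc (suc m)) h) q i j

  I-upper : ∀ ms → All (1 ≤ℕ_) ms → I ms * ι (19 +ℕ 29 *ℕ support ms) ≤ ι 58
  I-upper ms q = subst₂ (λ x n → x * ι (19 +ℕ 29 *ℕ n) ≤ ι 58) (F-big ms L-harm q 0 0) (support-big ms)
    (final-≤ (support (big ms)) (I (big ms)) (bounded (big ms) (big-≥2 ms)))

-- Signed weights of cycle types and the solution of the insertion recursion.

module Weights where

  open Integral
  open import Data.Nat using (ℕ; zero; suc) renaming (_+_ to _+ℕ_)
  import Data.Nat.Properties as ℕ
  open import Data.Rational hiding (NonZero)
  open import Data.Rational.Properties
  open import Tactic.RingSolver using (solve-∀)
  open import Relation.Binary.PropositionalEquality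

  open import Data.List using (map; foldr; concatMap)
  open import Function using (_∘_; id)

  -- Multiplication by Aˡ, by Bˡ and by (Aˡ − Bˡ)/(A − B).
  shiftA shiftB geom : ℕ → Fn → Fn
  shiftA l θ i j = θ (l +ℕ i) j
  shiftB l θ i j = θ i (l +ℕ j)
  geom zero    θ i j = 0ℚ
  geom (suc l) θ i j = geom l (shiftA 1 θ) i j + θ i (l +ℕ j)

  geom-cong : ∀ l {θ η} → θ ≗₂ η → geom l θ ≗₂ geom l η
  geom-cong zero    e i j = refl
  geom-cong (suc l) e i j = cong₂ _+_ (geom-cong l (λ i j → e (suc i) j) i j) (e i (l +ℕ j))

  -- `δA`, `δB` and `τ` are the transposes of A² ∂/∂A, B² ∂/∂B and their sum. `σ` is the transpose
  -- of that sum plus multiplication by A + B, which is what the sum becomes when A - B is taken out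
  -- as a factor (`σ-A-B`).
  A-B AB δA δB τ σ hat : Fn → Fn
  A-B θ i j = θ (suc i) j - θ i (suc j)
  AB  θ i j = θ (suc i) (suc j)
  δA  θ i j = ι i * θ (suc i) j
  δB  θ i j = ι j * θ i (suc j)
  τ   θ i j = ι i * θ (suc i) j + ι j * θ i (suc j)
  σ   θ i j = ι (suc i) * θ (suc i) j + ι (suc j) * θ i (suc j)
  hat θ i j = sg j * (fact i * fact j * θ i j)

  hat-cong : ∀ {θ η} → θ ≗₂ η → hat θ ≗₂ hat η
  hat-cong e i j = cong (λ z → sg j * (fact i * fact j * z)) (e i j)

  geom-A-B : ∀ l θ → geom l (A-B θ) ≗₂ φ l θ
  geom-A-B zero    θ i j = sym (φ₀ θ i j)
  geom-A-B (suc l) θ i j = trans (cong (_+ A-B θ i (l +ℕ j)) (geom-A-B l (shiftA 1 θ) i j))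
                                 (lem (θ (suc (l +ℕ i)) j) (θ (suc i) (l +ℕ j)) (θ i (suc (l +ℕ j))))
    where lem : ∀ x y z → (x - y) + (y - z) ≡ x - z
          lem = solve-∀ R

  geom-B : ∀ l θ → geom (suc l) θ ≗₂ geom l (shiftB 1 θ) ⊕ shiftA l θ
  geom-B zero    θ i j = refl
  geom-B (suc l) θ i j = trans (cong (_+ θ i (suc l +ℕ j)) (geom-B l (shiftA 1 θ) i j))
                               (lem (geom l (AB θ) i j) (θ (suc (l +ℕ i)) j) (θ i (suc (l +ℕ j))))
    where lem : ∀ x y z → (x + y) + z ≡ (x + z) + y
          lem = solve-∀ R

  Config : Set
  Config = ℕ × List ℕ

  -- A configuration (l , ms) is a cycle type with a distinguished cycle of
  -- length l.  Colour every cycle by A or B, a B-cycle contributing a sign: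
  -- pA and pB are the weights with the distinguished cycle coloured A resp. B,
  -- and pR is their sum divided by A − B.
  pA pB pR : Fn → Config → ℚ
  pA θ (l , ms) = F ms (shiftA l θ) 0 0
  pB θ (l , ms) = - F ms (shiftB l θ) 0 0
  pR θ (l , ms) = F ms (geom l θ) 0 0

  pA-cong : ∀ {θ η} → θ ≗₂ η → ∀ c → pA θ c ≡ pA η c
  pA-cong e (l , ms) = F-cong ms (λ i j → e _ _) 0 0

  pB-cong : ∀ {θ η} → θ ≗₂ η → ∀ c → pB θ c ≡ pB η c
  pB-cong e (l , ms) = cong -_ (F-cong ms (λ i j → e _ _) 0 0)

  pR-cong : ∀ {θ η} → θ ≗₂ η → ∀ c → pR θ c ≡ pR η c
  pR-cong e (l , ms) = F-cong ms (geom-cong l e) 0 0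

  pR-A-B : ∀ θ c → pR (A-B θ) c ≡ pA θ c + pB θ c
  pR-A-B θ (l , ms) = trans (F-cong ms (geom-A-B l θ) 0 0) (F-⊖ ms (shiftA l θ) (shiftB l θ) 0 0)

  -- The arguments k and k′ count the active points before and after the chosen one on a cycle with
  -- l of them, so k + k′ + 1 = l.
  splitSum : ℕ → (ℕ → ℕ → ℚ) → ℚ
  splitSum zero    g = 0ℚ
  splitSum (suc l) g = g 0 l + splitSum l (λ k k′ → g (suc k) k′)

  pickSum : List ℕ → (ℕ → List ℕ → ℚ) → ℚ
  pickSum []       g = 0ℚ
  pickSum (m ∷ ms) g = g m ms + pickSum ms (λ m′ r → g m′ (m ∷ r))

  pickSum-cong : ∀ ms {g h : ℕ → List ℕ → ℚ} → (∀ m r → g m r ≡ h m r) → pickSum ms g ≡ pickSum ms h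
  pickSum-cong []       e = refl
  pickSum-cong (m ∷ ms) e = cong₂ _+_ (e m ms) (pickSum-cong ms (λ m′ r → e m′ (m ∷ r)))

  pickSum-neg : ∀ ms (g : ℕ → List ℕ → ℚ) → pickSum ms (λ m r → - g m r) ≡ - pickSum ms g
  pickSum-neg []       g = refl
  pickSum-neg (m ∷ ms) g = trans (cong (λ z → - g m ms + z) (pickSum-neg ms (λ m′ r → g m′ (m ∷ r)))) (sym (neg-distrib-+ (g m ms) _))

  splitSum-neg : ∀ l (g : ℕ → ℕ → ℚ) → splitSum l (λ k k′ → - g k k′) ≡ - splitSum l g
  splitSum-neg zero    g = refl
  splitSum-neg (suc l) g = trans (cong (λ z → - g 0 l + z) (splitSum-neg l (λ k k′ → g (suc k) k′))) (sym (neg-distrib-+ (g 0 l) _))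

  -- Multiplying by a transposition (i y): y lies on the distinguished cycle
  -- (grow) or on a cycle of its own (attach), i is any active point.
  grow attach : (Config → ℚ) → Config → ℚ
  grow g (l , ms)   = splitSum l (λ k k′ → g (suc k , suc k′ ∷ ms)) + pickSum ms (λ m r → ι m * g (l +ℕ suc m , r))
  attach g (l , ms) = pickSum (l ∷ ms) (λ m r → ι m * g (suc m , r))

  -- In the sum of A^(k+1) (A^(k′+1) - B^(k′+1)) over k + k′ + 1 = l, the first products are all
  -- Aˡ⁺¹ and the second ones add up to A B (Aˡ - Bˡ)/(A - B).
  splitSum-A : ∀ ms l θ → splitSum l (λ k k′ → F ms (φ (suc k′) (shiftA (suc k) θ)) 0 0)
                        ≡ ι l * F ms (shiftA (suc l) θ) 0 0 - F ms (geom l (AB θ)) 0 0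
  splitSum-A ms zero θ = sym (trans (cong (λ z → 0ℚ * F ms (shiftA 1 θ) 0 0 - z) (F-vanish ms (λ _ _ → refl) 0 0)) (lem (F ms (shiftA 1 θ) 0 0)))
    where
    lem : ∀ x → 0ℚ * x - 0ℚ ≡ 0ℚ
    lem = solve-∀ R
  splitSum-A ms (suc l) θ = trans
    (cong₂ _+_ (F-⊖ ms (shiftA (suc (suc l)) θ) (λ i j → θ (suc i) (suc l +ℕ j)) 0 0) (splitSum-A ms l (shiftA 1 θ)))
    (trans (lem (F ms (shiftA (suc (suc l)) θ) 0 0) (F ms (λ i j → θ (suc i) (suc l +ℕ j)) 0 0) (ι l) (F ms (geom l (AB (shiftA 1 θ))) 0 0))
           (cong (λ z → ι (suc l) * F ms (shiftA (suc (suc l)) θ) 0 0 - z)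
                 (sym (F-⊕ ms (geom l (AB (shiftA 1 θ))) (λ i j → θ (suc i) (suc l +ℕ j)) 0 0))))
    where lem : ∀ x y n z → (x - y) + (n * x - z) ≡ (1ℚ + n) * x - (z + y)
          lem = solve-∀ R

  splitSum-B : ∀ ms l θ → splitSum l (λ k k′ → F ms (φ (suc k′) (shiftB (suc k) θ)) 0 0)
                        ≡ F ms (geom l (AB θ)) 0 0 - ι l * F ms (shiftB (suc l) θ) 0 0
  splitSum-B ms zero θ = sym (trans (cong (λ z → z - 0ℚ * F ms (shiftB 1 θ) 0 0) (F-vanish ms (λ _ _ → refl) 0 0)) (lem (F ms (shiftB 1 θ) 0 0)))
    where
    lem : ∀ x → 0ℚ - 0ℚ * x ≡ 0ℚ
    lem = solve-∀ R
  splitSum-B ms (suc l) θ = trans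
    (cong₂ _+_ (F-⊖ ms (shiftA l (AB θ)) (shiftB (suc (suc l)) θ) 0 0) (splitSum-B ms l (shiftB 1 θ)))
    (trans (lem (F ms (shiftA l (AB θ)) 0 0) (F ms (shiftB (suc (suc l)) θ) 0 0) (ι l) (F ms (geom l (AB (shiftB 1 θ))) 0 0))
           (cong (λ z → z - ι (suc l) * F ms (shiftB (suc (suc l)) θ) 0 0)
                 (sym (trans (F-cong ms (geom-B l (AB θ)) 0 0) (F-⊕ ms (geom l (AB (shiftB 1 θ))) (shiftA l (AB θ)) 0 0)))))
    where lem : ∀ x y n z → (x - y) + (z - n * y) ≡ (z + x) - (1ℚ + n) * y
          lem = solve-∀ R

  φ-δA : ∀ m θ → φ m (δA θ) ≗₂ δA (φ m θ) ⊕ (ι m ⊙ shiftA (suc m) θ)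
  φ-δA m θ i j = trans (cong (λ z → z * θ (suc (m +ℕ i)) j - ι i * θ (suc i) (m +ℕ j)) (ι-+ m i))
    (trans (lem (ι m) (ι i) (θ (suc (m +ℕ i)) j) (θ (suc i) (m +ℕ j)))
           (cong (λ z → ι i * (θ z j - θ (suc i) (m +ℕ j)) + ι m * θ (suc (m +ℕ i)) j) (sym (ℕ.+-suc m i))))
    where lem : ∀ m i x y → (m + i) * x - i * y ≡ i * (x - y) + m * x
          lem = solve-∀ R

  φ-δB : ∀ m θ → φ m (δB θ) ≗₂ δB (φ m θ) ⊖ (ι m ⊙ shiftB (suc m) θ)
  φ-δB m θ i j = trans (cong (λ z → ι j * θ (m +ℕ i) (suc j) - z * θ i (suc (m +ℕ j))) (ι-+ m j))
    (trans (lem (ι m) (ι j) (θ (m +ℕ i) (suc j)) (θ i (suc (m +ℕ j))))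
           (cong (λ z → ι j * (θ (m +ℕ i) (suc j) - θ i z) - ι m * θ i (suc (m +ℕ j))) (sym (ℕ.+-suc m j))))
    where lem : ∀ m i x y → i * x - (m + i) * y ≡ i * (x - y) - m * y
          lem = solve-∀ R

  φ-shiftA : ∀ m s θ → φ m (shiftA s θ) ≗₂ shiftA s (φ m θ)
  φ-shiftA m s θ i j = cong (λ z → θ z j - θ (s +ℕ i) (m +ℕ j)) (swap-+ s m i)

  φ-shiftB : ∀ m s θ → φ m (shiftB s θ) ≗₂ shiftB s (φ m θ)
  φ-shiftB m s θ i j = cong (λ z → θ (m +ℕ i) (s +ℕ j) - θ i z) (swap-+ s m j)

  -- Leibniz rule: A² ∂/∂A turns Aᵐ - Bᵐ into m Aᵐ⁺¹, one term for each of the m active points at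
  -- which that cycle can be joined.
  F-δA : ∀ ms θ i j → F ms (δA θ) i j ≡ δA (F ms θ) i j + pickSum ms (λ m r → ι m * F r (shiftA (suc m) θ) i j)
  F-δA []       θ i j = sym (+-identityʳ (δA θ i j))
  F-δA (m ∷ ms) θ i j = trans (F-cong ms (φ-δA m θ) i j) (trans (F-⊕ ms (δA (φ m θ)) (ι m ⊙ shiftA (suc m) θ) i j)
    (trans (cong₂ _+_ (F-δA ms (φ m θ) i j) (F-⊙ ms (ι m) (shiftA (suc m) θ) i j))
    (trans (lem (δA (F ms (φ m θ)) i j) _ (ι m * F ms (shiftA (suc m) θ) i j))
           (cong (λ z → δA (F ms (φ m θ)) i j + (ι m * F ms (shiftA (suc m) θ) i j + z))
                 (pickSum-cong ms (λ m′ r → cong (λ z → ι m′ * z) (F-cong r (λ i j → sym (φ-shiftA m (suc m′) θ i j)) i j)))))))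
    where lem : ∀ x y z → x + y + z ≡ x + (z + y)
          lem = solve-∀ R

  F-δB : ∀ ms θ i j → F ms (δB θ) i j ≡ δB (F ms θ) i j - pickSum ms (λ m r → ι m * F r (shiftB (suc m) θ) i j)
  F-δB []       θ i j = sym (+-identityʳ (δB θ i j))
  F-δB (m ∷ ms) θ i j = trans (F-cong ms (φ-δB m θ) i j) (trans (F-⊖ ms (δB (φ m θ)) (ι m ⊙ shiftB (suc m) θ) i j)
    (trans (cong₂ _-_ (F-δB ms (φ m θ) i j) (F-⊙ ms (ι m) (shiftB (suc m) θ) i j))
    (trans (lem (δB (F ms (φ m θ)) i j) _ (ι m * F ms (shiftB (suc m) θ) i j))
           (cong (λ z → δB (F ms (φ m θ)) i j - (ι m * F ms (shiftB (suc m) θ) i j + z))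
                 (pickSum-cong ms (λ m′ r → cong (λ z → ι m′ * z) (F-cong r (λ i j → sym (φ-shiftB m (suc m′) θ i j)) i j)))))))
    where lem : ∀ x y z → x - y - z ≡ x - (z + y)
          lem = solve-∀ R

  -- A² ∂/∂A applied to the whole weight: the splits supply the derivative of Aˡ and the joins that
  -- of the other factors. Only the A B term of the splits is left over.
  pA-grow : ∀ θ c → grow (pA θ) c ≡ pA (δA θ) c - pR (AB θ) c
  pA-grow θ (l , ms) = trans (cong₂ _+_ (splitSum-A ms l θ) join) (trans (lem (ι l * a) b d) (cong (_- b) (sym der)))
    where
    a = F ms (shiftA (suc l) θ) 0 0
    b = F ms (geom l (AB θ)) 0 0
    d = pickSum ms (λ m r → ι m * F r (shiftA (suc m) (shiftA l θ)) 0 0)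
    lem : ∀ a b d → a - b + d ≡ d + a - b
    lem = solve-∀ R
    join : pickSum ms (λ m r → ι m * pA θ (l +ℕ suc m , r)) ≡ d
    join = pickSum-cong ms (λ m r → cong (λ z → ι m * z) (F-cong r (λ i j → cong (λ z → θ z j) (ℕ.+-assoc l (suc m) i)) 0 0))
    der : pA (δA θ) (l , ms) ≡ d + ι l * a
    der = trans (F-cong ms (λ i j → trans (cong (_* θ (suc (l +ℕ i)) j) (ι-+ l i)) (trans (lem₁ (ι l) (ι i) (θ (suc (l +ℕ i)) j))
                  (cong (λ z → ι i * θ z j + ι l * θ (suc (l +ℕ i)) j) (sym (ℕ.+-suc l i))))) 0 0)
          (trans (F-⊕ ms (δA (shiftA l θ)) (ι l ⊙ shiftA (suc l) θ) 0 0)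
                 (cong₂ _+_ (trans (F-δA ms (shiftA l θ) 0 0) (lem₂ (F ms (shiftA l θ) 1 0) d)) (F-⊙ ms (ι l) (shiftA (suc l) θ) 0 0)))
      where
      lem₁ : ∀ m i x → (m + i) * x ≡ i * x + m * x
      lem₁ = solve-∀ R
      lem₂ : ∀ x y → 0ℚ * x + y ≡ y
      lem₂ = solve-∀ R

  pB-grow : ∀ θ c → grow (pB θ) c ≡ - pB (δB θ) c - pR (AB θ) c
  pB-grow θ (l , ms) = trans (cong₂ _+_ (trans (splitSum-neg l (λ k k′ → F ms (φ (suc k′) (shiftB (suc k) θ)) 0 0)) (cong -_ (splitSum-B ms l θ))) join)
      (trans (lem (ι l * a) b d) (cong (λ z → - - z - b) (sym der)))
    where
    a = F ms (shiftB (suc l) θ) 0 0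
    b = F ms (geom l (AB θ)) 0 0
    d = pickSum ms (λ m r → ι m * F r (shiftB (suc m) (shiftB l θ)) 0 0)
    lem : ∀ a b d → - (b - a) + - d ≡ - - (- d + a) - b
    lem = solve-∀ R
    join : pickSum ms (λ m r → ι m * pB θ (l +ℕ suc m , r)) ≡ - d
    join = trans (pickSum-cong ms (λ m r → trans (cong (λ z → ι m * - z) (F-cong r (λ i j → cong (λ z → θ i z) (ℕ.+-assoc l (suc m) j)) 0 0))
                   (sym (neg-distribʳ-* (ι m) (F r (shiftB (suc m) (shiftB l θ)) 0 0)))))
                 (pickSum-neg ms (λ m r → ι m * F r (shiftB (suc m) (shiftB l θ)) 0 0))
    der : F ms (shiftB l (δB θ)) 0 0 ≡ - d + ι l * a
    der = trans (F-cong ms (λ i j → trans (cong (_* θ i (suc (l +ℕ j))) (ι-+ l j)) (trans (lem₁ (ι l) (ι j) (θ i (suc (l +ℕ j))))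
                  (cong (λ z → ι j * θ i z + ι l * θ i (suc (l +ℕ j))) (sym (ℕ.+-suc l j))))) 0 0)
          (trans (F-⊕ ms (δB (shiftB l θ)) (ι l ⊙ shiftB (suc l) θ) 0 0)
                 (cong₂ _+_ (trans (F-δB ms (shiftB l θ) 0 0) (lem₂ (F ms (shiftB l θ) 0 1) d)) (F-⊙ ms (ι l) (shiftB (suc l) θ) 0 0)))
      where
      lem₁ : ∀ m i x → (m + i) * x ≡ i * x + m * x
      lem₁ = solve-∀ R
      lem₂ : ∀ x y → 0ℚ * x - y ≡ - y
      lem₂ = solve-∀ R

  -- The old distinguished cycle becomes an ordinary one with factor Aˡ - Bˡ, and nothing splits;
  -- hence both colours occur and there is no correction.
  pA-attach : ∀ θ c → attach (pA θ) c ≡ pA (δA θ) c + pB (δA θ) c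
  pA-attach θ (l , ms) = trans (trans (lem (F (l ∷ ms) θ 1 0) _) (sym (F-δA (l ∷ ms) θ 0 0))) (F-⊖ ms (shiftA l (δA θ)) (shiftB l (δA θ)) 0 0)
    where lem : ∀ x y → y ≡ 0ℚ * x + y
          lem = solve-∀ R

  pB-attach : ∀ θ c → attach (pB θ) c ≡ pA (δB θ) c + pB (δB θ) c
  pB-attach θ (l , ms) = trans (pickSum-cong (l ∷ ms) (λ m r → sym (neg-distribʳ-* (ι m) (F r (shiftB (suc m) θ) 0 0))))
    (trans (pickSum-neg (l ∷ ms) (λ m r → ι m * F r (shiftB (suc m) θ) 0 0))
    (trans (trans (lem (F (l ∷ ms) θ 0 1) _) (sym (F-δB (l ∷ ms) θ 0 0))) (F-⊖ ms (shiftA l (δB θ)) (shiftB l (δB θ)) 0 0)))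
    where lem : ∀ x y → - y ≡ 0ℚ * x - y
          lem = solve-∀ R

  ∑ : {A : Set} → List A → (A → ℚ) → ℚ
  ∑ []       f = 0ℚ
  ∑ (x ∷ xs) f = f x + ∑ xs f

  ∑-cong : {A : Set} (xs : List A) {f g : A → ℚ} → (∀ x → f x ≡ g x) → ∑ xs f ≡ ∑ xs g
  ∑-cong []       e = refl
  ∑-cong (x ∷ xs) e = cong₂ _+_ (e x) (∑-cong xs e)

  ∑-+ : {A : Set} (xs : List A) (f g : A → ℚ) → ∑ xs (λ x → f x + g x) ≡ ∑ xs f + ∑ xs g
  ∑-+ []       f g = refl
  ∑-+ (x ∷ xs) f g = trans (cong (λ z → f x + g x + z) (∑-+ xs f g)) (lem (f x) (g x) (∑ xs f) (∑ xs g))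
    where lem : ∀ a b c d → a + b + (c + d) ≡ (a + c) + (b + d)
          lem = solve-∀ R

  ∑-neg : {A : Set} (xs : List A) (f : A → ℚ) → ∑ xs (λ x → - f x) ≡ - ∑ xs f
  ∑-neg []       f = refl
  ∑-neg (x ∷ xs) f = trans (cong (λ z → - f x + z) (∑-neg xs f)) (sym (neg-distrib-+ (f x) (∑ xs f)))

  ∑-- : {A : Set} (xs : List A) (f g : A → ℚ) → ∑ xs (λ x → f x - g x) ≡ ∑ xs f - ∑ xs g
  ∑-- xs f g = trans (∑-+ xs f (λ x → - g x)) (cong (λ z → ∑ xs f + z) (∑-neg xs g))

  hat-δA : ∀ θ → hat (A-B (δA θ)) ≗₂ shiftA 1 (hat (A-B θ)) ⊕ hat (AB θ)
  hat-δA θ i j = lem (sg j) (ι i) (fact i) (fact j) (θ (suc (suc i)) j) (θ (suc i) (suc j))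
    where lem : ∀ s n f g x y → s * (f * g * ((1ℚ + n) * x - n * y)) ≡ s * ((1ℚ + n) * f * g * (x - y)) + s * (f * g * y)
          lem = solve-∀ R

  hat-δB : ∀ θ → hat (A-B (δB θ)) ≗₂ (λ i j → - (shiftB 1 (hat (A-B θ)) i j + hat (AB θ) i j))
  hat-δB θ i j = lem (sg j) (ι j) (fact i) (fact j) (θ (suc i) (suc j)) (θ i (suc (suc j)))
    where lem : ∀ s n f g x y → s * (f * g * (n * x - (1ℚ + n) * y)) ≡ - ((- s) * (f * ((1ℚ + n) * g) * (x - y)) + s * (f * g * x))
          lem = solve-∀ R

  hat-AB-δA : ∀ θ → hat (AB (δA θ)) ≗₂ shiftA 1 (hat (AB θ))
  hat-AB-δA θ i j = lem (sg j) (ι i) (fact i) (fact j) (θ (suc (suc i)) (suc j))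
    where lem : ∀ s n f g x → s * (f * g * ((1ℚ + n) * x)) ≡ s * ((1ℚ + n) * f * g * x)
          lem = solve-∀ R

  hat-AB-δB : ∀ θ → hat (AB (δB θ)) ≗₂ (λ i j → - shiftB 1 (hat (AB θ)) i j)
  hat-AB-δB θ i j = lem (sg j) (ι j) (fact i) (fact j) (θ (suc i) (suc (suc j)))
    where lem : ∀ s n f g x → s * (f * g * ((1ℚ + n) * x)) ≡ - ((- s) * (f * ((1ℚ + n) * g) * x))
          lem = solve-∀ R

  τ-δA : ∀ θ → δA (τ θ) ≗₂ τ (δA θ)
  τ-δA θ i j = lem (ι i) (ι j) (θ (suc (suc i)) j) (θ (suc i) (suc j))
    where lem : ∀ i j x y → i * ((1ℚ + i) * x + j * y) ≡ i * ((1ℚ + i) * x) + j * (i * y)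
          lem = solve-∀ R

  τ-δB : ∀ θ → δB (τ θ) ≗₂ τ (δB θ)
  τ-δB θ i j = lem (ι i) (ι j) (θ (suc i) (suc j)) (θ i (suc (suc j)))
    where lem : ∀ i j x y → j * (i * x + (1ℚ + j) * y) ≡ i * (j * x) + j * ((1ℚ + j) * y)
          lem = solve-∀ R

  σ-A-B : ∀ θ → σ (A-B θ) ≗₂ A-B (τ θ)
  σ-A-B θ i j = lem (ι i) (ι j) (θ (suc (suc i)) j) (θ (suc i) (suc j)) (θ i (suc (suc j)))
    where lem : ∀ i j x y z → (1ℚ + i) * (x - y) + (1ℚ + j) * (y - z) ≡ ((1ℚ + i) * x + j * y) - (i * y + (1ℚ + j) * z)
          lem = solve-∀ R

  -- A right inverse of `A-B`. Multiplication by A - B is injective on polynomials, so every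
  -- functional has this form; its values on the powers of B are free and set to 0.
  prim : Fn → Fn
  prim θ zero    j = 0ℚ
  prim θ (suc i) j = θ i j + prim θ i (suc j)

  A-B-prim : ∀ θ → A-B (prim θ) ≗₂ θ
  A-B-prim θ i j = lem (θ i j) (prim θ i (suc j))
    where lem : ∀ x y → x + y - y ≡ x
          lem = solve-∀ R

  geom-neg : ∀ l θ → geom l (λ i j → - θ i j) ≗₂ (λ i j → - geom l θ i j)
  geom-neg zero    θ i j = refl
  geom-neg (suc l) θ i j = trans (cong (_+ - θ i (l +ℕ j)) (geom-neg l (shiftA 1 θ) i j)) (sym (neg-distrib-+ (geom l (shiftA 1 θ) i j) _))

  -- The values of sumA and sumB below.  The factor i! j! in hat is the Laplace
  -- transform that turns δA and δB into multiplications.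
  valA valB : List ℕ → ℕ → Fn → ℚ
  valA ns l θ = F ns (λ i j → shiftA l (hat (A-B θ)) i j + geom l (hat (AB θ)) i j) 0 0
  valB ns l θ = - F ns (λ i j → shiftB l (hat (A-B θ)) i j + geom l (hat (AB θ)) i j) 0 0

  -- Cycles of lengths ns are completely inserted and l points of the next one are.
  -- Precomposing with τ (with σ for pR) amounts to an extra fixed point, without
  -- which the weights of the first cycle have no polynomial closed form.
  record Partial (ns : List ℕ) (l : ℕ) (C : List Config) : Set where
    field
      sumA : ∀ θ → ∑ C (pA (τ θ)) ≡ valA ns l θ
      sumB : ∀ θ → ∑ C (pB (τ θ)) ≡ valB ns l θ
  open Partial

  Complete : List ℕ → List Config → Set
  Complete ns C = ∀ θ → ∑ C (pR (σ θ)) ≡ F ns (hat θ) 0 0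

  ∑-pR-A-B : ∀ C θ → ∑ C (pR (A-B θ)) ≡ ∑ C (pA θ) + ∑ C (pB θ)
  ∑-pR-A-B C θ = trans (∑-cong C (pR-A-B θ)) (∑-+ C (pA θ) (pB θ))

  -- With θ written as `A-B ψ`, `pR` falls apart into the two colours, the `geom` terms of `valA`
  -- and `valB` cancel, and Aˡ - Bˡ remains.
  complete : ∀ {ns l C} → Partial ns l C → Complete (l ∷ ns) C
  complete {ns} {l} {C} p θ = trans (∑-cong C (pR-cong (λ i j → cong₂ (λ a b → ι (suc i) * a + ι (suc j) * b) (sym (A-B-prim θ (suc i) j)) (sym (A-B-prim θ i (suc j))))))
    (trans (∑-cong C (pR-cong (σ-A-B ψ)))
    (trans (∑-pR-A-B C (τ ψ))
    (trans (cong₂ _+_ (sumA p ψ) (sumB p ψ))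
    (trans (sym (F-⊖ ns (λ i j → shiftA l x i j + geom l y i j) (λ i j → shiftB l x i j + geom l y i j) 0 0))
           (F-cong ns (λ i j → trans (lem (x (l +ℕ i) j) (x i (l +ℕ j)) (geom l y i j))
              (cong₂ _-_ (hat-cong (A-B-prim θ) (l +ℕ i) j) (hat-cong (A-B-prim θ) i (l +ℕ j)))) 0 0)))))
    where
    ψ = prim θ
    x = hat (A-B ψ)
    y = hat (AB ψ)
    lem : ∀ a b c → (a + c) - (b + c) ≡ a - b
    lem = solve-∀ R

  -- Neither colour can be advanced alone: the correction `pR (AB θ)` is known only through
  -- `complete`. For colour A, subtracting the resulting Aˡ - Bˡ replaces the extra Aˡ of `hat-δA`
  -- by the Bˡ that the next geometric sum lacks.
  grow-partial : ∀ {ns l C C′} → (∀ g → ∑ C′ g ≡ ∑ C (grow g)) → Partial ns l C → Partial ns (suc l) C′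
  grow-partial {ns} {l} {C} {C′} e p = record { sumA = a ; sumB = b }
    where
    a : ∀ θ → ∑ C′ (pA (τ θ)) ≡ valA ns (suc l) θ
    a θ = trans (e (pA (τ θ))) (trans (∑-cong C (pA-grow (τ θ))) (trans (∑-- C (pA (δA (τ θ))) (pR (σ (AB θ))))
      (trans (cong₂ _-_ (trans (∑-cong C (pA-cong (τ-δA θ))) (sumA p (δA θ))) (complete p (AB θ)))
      (trans (sym (F-⊖ ns _ (φ l y) 0 0)) (F-cong ns eq 0 0)))))
      where
      x = hat (A-B θ)
      y = hat (AB θ)
      lem : ∀ a b c d → (a + b + c) - (b - d) ≡ a + (c + d)
      lem = solve-∀ R
      eq : (λ i j → (shiftA l (hat (A-B (δA θ))) i j + geom l (hat (AB (δA θ))) i j) - φ l y i j)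
         ≗₂ (λ i j → shiftA (suc l) x i j + geom (suc l) y i j)
      eq i j = trans (cong₂ (λ a b → a + b - φ l y i j) (hat-δA θ (l +ℕ i) j) (geom-cong l (hat-AB-δA θ) i j))
                     (lem (x (suc (l +ℕ i)) j) (y (l +ℕ i) j) (geom l (shiftA 1 y) i j) (y i (l +ℕ j)))
    b : ∀ θ → ∑ C′ (pB (τ θ)) ≡ valB ns (suc l) θ
    b θ = trans (e (pB (τ θ))) (trans (∑-cong C (pB-grow (τ θ))) (trans (∑-- C (λ c → - pB (δB (τ θ)) c) (pR (σ (AB θ))))
      (trans (cong₂ _-_ (trans (∑-neg C (pB (δB (τ θ)))) (cong -_ (trans (∑-cong C (pB-cong (τ-δB θ))) (sumB p (δB θ))))) (complete p (AB θ)))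
      (trans (lem₀ (F ns (λ i j → shiftB l (hat (A-B (δB θ))) i j + geom l (hat (AB (δB θ))) i j) 0 0) (F ns (φ l y) 0 0))
      (cong -_ (trans (sym (F-⊖ ns (φ l y) _ 0 0)) (F-cong ns eq 0 0)))))))
      where
      x = hat (A-B θ)
      y = hat (AB θ)
      lem₀ : ∀ a b → - - a - b ≡ - (b - a)
      lem₀ = solve-∀ R
      lem : ∀ a b c d → (d - b) - (- (a + b) + - c) ≡ a + (c + d)
      lem = solve-∀ R
      eq : (λ i j → φ l y i j - (shiftB l (hat (A-B (δB θ))) i j + geom l (hat (AB (δB θ))) i j))
         ≗₂ (λ i j → shiftB (suc l) x i j + geom (suc l) y i j)
      eq i j = trans (cong₂ (λ a b → φ l y i j - (a + b)) (hat-δB θ i (l +ℕ j)) (trans (geom-cong l (hat-AB-δB θ) i j) (geom-neg l (shiftB 1 y) i j)))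
        (trans (lem (x i (suc (l +ℕ j))) (y i (l +ℕ j)) (geom l (shiftB 1 y) i j) (y (l +ℕ i) j))
               (cong (λ z → x i (suc (l +ℕ j)) + z) (sym (geom-B l y i j))))

  attach-partial : ∀ {ns C C′} → (∀ g → ∑ C′ g ≡ ∑ C (attach g)) → Complete ns C → Partial ns 1 C′
  attach-partial {ns} {C} {C′} e p = record { sumA = a ; sumB = b }
    where
    common : ∀ θ → ∑ C (pA (τ θ)) + ∑ C (pB (τ θ)) ≡ F ns (hat (A-B θ)) 0 0
    common θ = trans (sym (∑-pR-A-B C (τ θ))) (trans (∑-cong C (pR-cong (λ i j → sym (σ-A-B θ i j)))) (p (A-B θ)))
    a : ∀ θ → ∑ C′ (pA (τ θ)) ≡ valA ns 1 θ
    a θ = trans (e (pA (τ θ))) (trans (∑-cong C (λ c → trans (pA-attach (τ θ) c) (cong₂ _+_ (pA-cong (τ-δA θ) c) (pB-cong (τ-δA θ) c))))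
      (trans (∑-+ C (pA (τ (δA θ))) (pB (τ (δA θ)))) (trans (common (δA θ))
        (F-cong ns (λ i j → trans (hat-δA θ i j) (cong (λ z → hat (A-B θ) (suc i) j + z) (sym (+-identityˡ (hat (AB θ) i j))))) 0 0))))
    b : ∀ θ → ∑ C′ (pB (τ θ)) ≡ valB ns 1 θ
    b θ = trans (e (pB (τ θ))) (trans (∑-cong C (λ c → trans (pB-attach (τ θ) c) (cong₂ _+_ (pA-cong (τ-δB θ) c) (pB-cong (τ-δB θ) c))))
      (trans (∑-+ C (pA (τ (δB θ))) (pB (τ (δB θ)))) (trans (common (δB θ))
        (trans (F-cong ns (λ i j → trans (hat-δB θ i j) (trans (cong (λ z → - (hat (A-B θ) i (suc j) + z)) (sym (+-identityˡ (hat (AB θ) i j)))) (lem _))) 0 0)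
        (trans (F-⊙ ns (- 1ℚ) (λ i j → shiftB 1 (hat (A-B θ)) i j + geom 1 (hat (AB θ)) i j) 0 0) (sym (lem _)))))))
      where lem : ∀ x → - x ≡ (- 1ℚ) * x
            lem = solve-∀ R

  start-partial : Partial [] 1 ((1 , []) ∷ [])
  start-partial = record
    { sumA = λ θ → lemA (θ 2 0) (θ 1 1)
    ; sumB = λ θ → lemB (θ 1 1) (θ 0 2) }
    where
    lemA : ∀ x y → (1ℚ + 0ℚ) * x + 0ℚ * y + 0ℚ ≡ 1ℚ * ((1ℚ + 0ℚ) * 1ℚ * 1ℚ * (x - y)) + (0ℚ + 1ℚ * (1ℚ * 1ℚ * y))
    lemA = solve-∀ R
    lemB : ∀ x y → - (0ℚ * x + (1ℚ + 0ℚ) * y) + 0ℚ ≡ - ((- 1ℚ) * (1ℚ * ((1ℚ + 0ℚ) * 1ℚ) * (x - y)) + (0ℚ + 1ℚ * (1ℚ * 1ℚ * x)))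
    lemB = solve-∀ R

  unit : Fn
  unit _ _ = 1ℚ

  private
    affine : ℚ → Fn
    affine c i j = ι i + ι j + c

    geom-affine : ∀ l c i j → geom l (affine c) i j ≡ ι l * (ι i + ι j + c + ι l - 1ℚ)
    geom-affine zero    c i j = sym (*-zeroˡ (ι i + ι j + c + 0ℚ - 1ℚ))
    geom-affine (suc l) c i j = trans (cong₂ _+_
        (trans (geom-cong l (λ i j → lem₁ (ι i) (ι j) c) i j) (geom-affine l (1ℚ + c) i j))
        (cong (λ z → ι i + z + c) (ι-+ l j)))
      (lem₂ (ι l) (ι i) (ι j) c)
      where
      lem₁ : ∀ i j c → 1ℚ + i + j + c ≡ i + j + (1ℚ + c)
      lem₁ = solve-∀ R
      lem₂ : ∀ l i j c → l * (i + j + (1ℚ + c) + l - 1ℚ) + (i + (l + j) + c) ≡ (1ℚ + l) * (i + j + c + (1ℚ + l) - 1ℚ)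
      lem₂ = solve-∀ R

    σ-unit : σ unit ≗₂ affine (ι 2)
    σ-unit i j = lem (ι i) (ι j)
      where lem : ∀ i j → (1ℚ + i) * 1ℚ + (1ℚ + j) * 1ℚ ≡ i + j + ι 2
            lem = solve-∀ R

  -- Evaluation at A = B = 1 detects the configurations with a single cycle.
  pR-single : ∀ l → pR (σ unit) (l , []) ≡ ι l * ι (suc l)
  pR-single l = trans (geom-cong l σ-unit 0 0) (trans (geom-affine l (ι 2) 0 0) (lem (ι l)))
    where lem : ∀ l → l * (0ℚ + 0ℚ + ι 2 + l - 1ℚ) ≡ l * (1ℚ + l)
          lem = solve-∀ R

  -- `σ unit` takes the value i + j + 2 on Aⁱ Bʲ. It sees only the degree, so one factor Aᵐ - Bᵐ is
  -- enough to annihilate it.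
  pR-multiple : ∀ l m ms → pR (σ unit) (l , m ∷ ms) ≡ 0ℚ
  pR-multiple l m ms = F-vanish ms (λ i j → trans (cong₂ _-_ (g (m +ℕ i) j) (g i (m +ℕ j)))
      (trans (cong₂ (λ a b → ι l * (a + ι j + ι 2 + ι l - 1ℚ) - ι l * (ι i + b + ι 2 + ι l - 1ℚ)) (ι-+ m i) (ι-+ m j)) (lem (ι l) (ι m) (ι i) (ι j)))) 0 0
    where
    g : ∀ i j → geom l (σ unit) i j ≡ ι l * (ι i + ι j + ι 2 + ι l - 1ℚ)
    g i j = trans (geom-cong l σ-unit i j) (geom-affine l (ι 2) i j)
    lem : ∀ l m i j → l * (m + i + j + ι 2 + l - 1ℚ) - l * (i + (m + j) + ι 2 + l - 1ℚ) ≡ 0ℚ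
    lem = solve-∀ R

  total : List ℕ → ℕ
  total []       = 0
  total (m ∷ ms) = m +ℕ total ms

  F-degree : ∀ ms (c : ℕ → ℚ) {θ η} → (∀ i j → η i j ≡ c (i +ℕ j) * θ i j) →
             ∀ i j → F ms η i j ≡ c (total ms +ℕ (i +ℕ j)) * F ms θ i j
  F-degree []       c h i j = h i j
  F-degree (m ∷ ms) c {θ} {η} h i j = trans (F-degree ms (λ n → c (m +ℕ n)) h′ i j)
    (cong (λ z → c z * F ms (φ m θ) i j) (sym (ℕ.+-assoc m (total ms) (i +ℕ j))))
    where
    h′ : ∀ i j → φ m η i j ≡ c (m +ℕ (i +ℕ j)) * φ m θ i j
    h′ i j = trans (cong₂ _-_ (trans (h (m +ℕ i) j) (cong (λ z → c z * θ (m +ℕ i) j) (ℕ.+-assoc m i j)))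
                              (trans (h i (m +ℕ j)) (cong (λ z → c z * θ i (m +ℕ j)) (swap-+ i m j))))
                   (*-distribˡ-- (c (m +ℕ (i +ℕ j))) (θ (m +ℕ i) j) (θ i (m +ℕ j)))

  -- Here the integral appears: (-1)ʲ i! j! is (i + j + 1)! times the beta value `L i j`, and
  -- homogeneity takes the factorial out of the product.
  hat-unit : ∀ ms → F ms (hat unit) 0 0 ≡ fact (suc (total ms)) * I ms
  hat-unit ms = trans (F-degree ms (λ n → fact (suc n)) h 0 0) (cong (λ z → fact (suc z) * I ms) (ℕ.+-identityʳ (total ms)))
    where
    h : ∀ i j → hat unit i j ≡ fact (suc (i +ℕ j)) * L i j
    h i j = sym (trans (lem (fact (suc (i +ℕ j))) (sg j) (fact i * fact j) (rfact (suc (i +ℕ j))))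
                       (cong (λ z → sg j * (fact i * fact j * z)) (fact-rfact (suc (i +ℕ j)))))
      where lem : ∀ f s x r → f * (s * (x * r)) ≡ s * (x * (f * r))
            lem = solve-∀ R

-- Cycles of a map written as lists.

module Cycles where

  open import Data.Nat using (ℕ; zero; suc; s≤s; _≤_; _<_)
  import Data.Nat.Properties as ℕ
  open import Data.Fin using (Fin; zero; suc; _≟_)
  import Data.Fin.Properties as Fin
  open import Data.Bool.ListAction using (all; any)
  open import Relation.Binary.PropositionalEquality

  hd : {A : Set} → List A → A → A
  hd []      z = z
  hd (x ∷ _) z = x

  hd-++ : {A : Set} (xs ys : List A) (z : A) → hd (xs ++ ys) z ≡ hd xs (hd ys z)
  hd-++ []       ys z = refl
  hd-++ (x ∷ xs) ys z = refl

  Link : {A : Set} → (A → A) → List A → A → Set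
  Link f []       z = ⊤
  Link f (x ∷ xs) z = f x ≡ hd xs z × Link f xs z

  -- A path that returns to its own head. The default d matters only for the empty list. Repetitions
  -- are allowed; they are excluded separately by `Unique`.
  Cyc : {A : Set} → (A → A) → List A → Set
  Cyc f w = ∀ d → Link f w (hd w d)

  module _ {A : Set} {f : A → A} where

    link-++⁺ : ∀ xs ys {z} → Link f xs (hd ys z) → Link f ys z → Link f (xs ++ ys) z
    link-++⁺ []       ys     p       q = q
    link-++⁺ (x ∷ xs) ys {z} (e , p) q = trans e (sym (hd-++ xs ys z)) , link-++⁺ xs ys p q

    link-++⁻ : ∀ xs ys {z} → Link f (xs ++ ys) z → Link f xs (hd ys z) × Link f ys z
    link-++⁻ []       ys     p       = tt , p
    link-++⁻ (x ∷ xs) ys {z} (e , p) with link-++⁻ xs ys p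
    ... | q , r = (trans e (hd-++ xs ys z) , q) , r

    link-cong : ∀ {g} xs {z} → (∀ {x} → x ∈ xs → g x ≡ f x) → Link f xs z → Link g xs z
    link-cong []       e p       = tt
    link-cong (x ∷ xs) e (q , p) = trans (e (here refl)) q , link-cong xs (e ∘ there) p

    cyc-cong : ∀ {g} w → (∀ {x} → x ∈ w → g x ≡ f x) → Cyc f w → Cyc g w
    cyc-cong w e c d = link-cong w e (c d)

    cyc-rotate : ∀ p q → Cyc f (p ++ q) → Cyc f (q ++ p)
    cyc-rotate p q c d with link-++⁻ p q (c d)
    ... | a , b = subst (Link f (q ++ p)) (sym (hd-++ q p d))
                  (link-++⁺ q p (subst (Link f q) (trans (hd-++ p q d) (around p q)) b)
                                (subst (Link f p) (trans (cong (hd q) (hd-++ p q d)) (sym (around q p))) a))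
      where
      around : ∀ p q → hd p (hd q d) ≡ hd p (hd q (hd p d))
      around []      q = refl
      around (_ ∷ _) q = refl

    link-closed : ∀ xs {z x} → Link f xs z → x ∈ xs → f x ∈ xs ⊎ f x ≡ z
    link-closed (x ∷ [])      (e , _) (here refl) = inj₂ e
    link-closed (x ∷ y ∷ xs)  (e , _) (here refl) = inj₁ (there (here e))
    link-closed (x ∷ xs)      (_ , p) (there m) with link-closed xs p m
    ... | inj₁ m′ = inj₁ (there m′)
    ... | inj₂ e  = inj₂ e

    cyc-closed : ∀ w {x} → Cyc f w → x ∈ w → f x ∈ w
    cyc-closed (a ∷ w) c m with link-closed (a ∷ w) (c a) m
    ... | inj₁ m′ = m′
    ... | inj₂ e  = here e

    link-last : ∀ a xs {z} → Link f (a ∷ xs) z → ∃ λ l → l ∈ a ∷ xs × f l ≡ z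
    link-last a []       (e , _) = a , here refl , e
    link-last a (b ∷ xs) (_ , p) with link-last b xs p
    ... | l , m , e = l , there m , e

    cyc-pred : ∀ w {y} → Cyc f w → y ∈ w → ∃ λ l → l ∈ w × f l ≡ y
    cyc-pred w {y} c m with ∈-∃++ m
    ... | p , q , refl with link-last y (q ++ p) (cyc-rotate p (y ∷ q) c y)
    ... | l , m′ , e = l , back (∈-++⁻ (y ∷ q) m′) , e
      where
      back : l ∈ y ∷ q ⊎ l ∈ p → l ∈ p ++ y ∷ q
      back (inj₁ k) = ∈-++⁺ʳ p k
      back (inj₂ k) = ∈-++⁺ˡ k

    cyc-back : ∀ w {x} → (∀ {a b} → f a ≡ f b → a ≡ b) → Cyc f w → f x ∈ w → x ∈ w
    cyc-back w inj c m with cyc-pred w c m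
    ... | l , m′ , e = subst (_∈ w) (inj e) m′

  module _ {A : Set} {f : A → A} where

    -- The two effects of composing f with the transposition (i y).
    cyc-split : ∀ {g i y} p q t → g i ≡ f y → g y ≡ f i → (∀ {x} → x ∈ p ++ q ++ t → g x ≡ f x) →
                Cyc f (p ++ i ∷ q ++ y ∷ t) → Cyc g (p ++ i ∷ t) × Cyc g (q ++ y ∷ [])
    cyc-split {g} {i} {y} p q t gi gy e c = c₁ , c₂
      where
      split : ∀ d → Link f p i × (f i ≡ hd q y × Link f q y) × (f y ≡ hd t (hd p i) × Link f t (hd p i))
      split d with link-++⁻ p (i ∷ q ++ y ∷ t) (c d)
      ... | a , b , r with link-++⁻ q (y ∷ t) r
      ... | u , v , s = a , (trans b (hd-++ q (y ∷ t) _) , u) ,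
            subst (λ z → f y ≡ hd t z × Link f t z) (hd-++ p (i ∷ q ++ y ∷ t) d) (v , s)
      c₁ : Cyc g (p ++ i ∷ t)
      c₁ d with split d
      ... | a , _ , v , s = link-++⁺ p (i ∷ t) (link-cong p (e ∘ ∈-++⁺ˡ) a)
            (subst (λ z → g i ≡ hd t z × Link g t z) (sym (hd-++ p (i ∷ t) d))
                   (trans gi v , link-cong t (e ∘ ∈-++⁺ʳ p ∘ ∈-++⁺ʳ q) s))
      c₂ : Cyc g (q ++ y ∷ [])
      c₂ d with split d
      ... | _ , (b , u) , _ = link-++⁺ q (y ∷ []) (link-cong q (e ∘ ∈-++⁺ʳ p ∘ ∈-++⁺ˡ) u)
            (trans gy (trans b (sym (hd-++ q (y ∷ []) d))) , tt)

    cyc-join : ∀ {g i y} w p q t → g i ≡ f y → g y ≡ f i → (∀ {x} → x ∈ (w ++ t) ++ (p ++ q) → g x ≡ f x) →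
               Cyc f (w ++ y ∷ t) → Cyc f (p ++ i ∷ q) → Cyc g (w ++ y ∷ q ++ p ++ i ∷ t)
    cyc-join {g} {i} {y} w p q t gi gy e c c′ d with link-++⁻ w (y ∷ t) (c d) | link-++⁻ p (i ∷ q) (c′ d)
    ... | a , b , r | a′ , b′ , r′ =
      link-++⁺ w (y ∷ q ++ p ++ i ∷ t) (link-cong w (e ∘ ∈-++⁺ˡ ∘ ∈-++⁺ˡ) a)
        (trans gy (trans b″ (sym (trans (hd-++ q (p ++ i ∷ t) _) (cong (hd q) (hd-++ p (i ∷ t) _))))) ,
         link-++⁺ q (p ++ i ∷ t) (subst (Link g q) (sym (hd-++ p (i ∷ t) _)) (link-cong q (e ∘ ∈-++⁺ʳ (w ++ t) ∘ ∈-++⁺ʳ p) r″))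
           (link-++⁺ p (i ∷ t) (link-cong p (e ∘ ∈-++⁺ʳ (w ++ t) ∘ ∈-++⁺ˡ) a′)
             (trans gi (trans b (cong (hd t) hw)) , link-cong t (e ∘ ∈-++⁺ˡ ∘ ∈-++⁺ʳ w) (subst (Link f t) hw r))))
      where
      hw : hd (w ++ y ∷ t) d ≡ hd (w ++ y ∷ q ++ p ++ i ∷ t) d
      hw = trans (hd-++ w (y ∷ t) d) (sym (hd-++ w (y ∷ q ++ p ++ i ∷ t) d))
      b″ : f i ≡ hd q (hd p i)
      b″ = trans b′ (cong (hd q) (hd-++ p (i ∷ q) d))
      r″ : Link f q (hd p i)
      r″ = subst (Link f q) (hd-++ p (i ∷ q) d) r′

  module _ {n : ℕ} (f : Fin n → Fin n) where

    iter-suc : ∀ j x → iter f j (f x) ≡ iter f (suc j) x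
    iter-suc zero    x = refl
    iter-suc (suc j) x = cong f (iter-suc j x)

    -- The orbit is cut at its first arrival at z. That z is not in the list is what makes the path
    -- unique and free of repetitions.
    segment : ∀ j x z → iter f j x ≡ z → ∃ λ xs → Link f xs z × hd xs z ≡ x × z ∉ xs
    segment j x z e with x ≟ z
    ... | yes x≡z = [] , tt , sym x≡z , λ ()
    segment zero    x z e | no x≢z = ⊥-elim (x≢z e)
    segment (suc j) x z e | no x≢z with segment j (f x) z (trans (iter-suc j x) e)
    ... | xs , p , h , z∉ = x ∷ xs , (sym h , p) , refl , λ { (here z≡x) → x≢z (sym z≡x) ; (there m) → z∉ m }

    link-det : ∀ xs ys {z} → Link f xs z → Link f ys z → z ∉ xs → z ∉ ys → hd xs z ≡ hd ys z → xs ≡ ys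
    link-det []       []       p q a b e = refl
    link-det []       (y ∷ ys) p q a b e = ⊥-elim (b (here e))
    link-det (x ∷ xs) []       p q a b e = ⊥-elim (a (here (sym e)))
    link-det (x ∷ xs) (.x ∷ ys) (e₁ , p) (e₂ , q) a b refl =
      cong (x ∷_) (link-det xs ys p q (a ∘ there) (b ∘ there) (trans (sym e₁) e₂))

    -- A repeated entry would begin two paths to z of different lengths, contradicting `link-det`.
    link-unique : ∀ xs {z} → Link f xs z → z ∉ xs → Unique xs
    link-unique []       p       a = []
    link-unique (x ∷ xs) {z} (e , p) a = All.tabulate no-return ∷ link-unique xs p (a ∘ there)
      where
      no-return : ∀ {y} → y ∈ xs → x ≢ y
      no-return m refl with ∈-∃++ m
      ... | s , t , refl = absurd s (link-det (x ∷ t) (x ∷ s ++ x ∷ t) (proj₂ (link-++⁻ s (x ∷ t) p)) (e , p)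
                                              (a ∘ there ∘ ∈-++⁺ʳ s) a refl)
        where
        absurd : ∀ s → x ∷ t ≢ x ∷ s ++ x ∷ t
        absurd s h = ℕ.<-irrefl (cong length h)
          (s≤s (ℕ.≤-trans (ℕ.m≤n+m (suc (length t)) (length s)) (ℕ.≤-reflexive (sym (List.length-++ s)))))

    iter-link : ∀ xs {x z y} → Link f (x ∷ xs) z → y ∈ x ∷ xs → ∃ λ j → iter f j x ≡ y
    iter-link xs       p       (here refl) = 0 , refl
    iter-link (x′ ∷ xs) {x} (e , p) (there m) with iter-link xs p m
    ... | j , h = suc j , trans (sym (iter-suc j x)) (trans (cong (iter f j) e) h)

    cyc-iter : ∀ w {x y} → Cyc f w → x ∈ w → y ∈ w → ∃ λ j → iter f j x ≡ y
    cyc-iter w {x} {y} c m m′ with ∈-∃++ m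
    ... | p , q , refl = iter-link (q ++ p) (cyc-rotate p (x ∷ q) c x) (forth (∈-++⁻ p m′))
      where
      forth : y ∈ p ⊎ y ∈ x ∷ q → y ∈ x ∷ q ++ p
      forth (inj₁ k) = ∈-++⁺ʳ (x ∷ q) k
      forth (inj₂ k) = ∈-++⁺ˡ k

    cyc-iter-closed : ∀ w {x} → Cyc f w → x ∈ w → ∀ j → iter f j x ∈ w
    cyc-iter-closed w c m zero    = m
    cyc-iter-closed w c m (suc j) = cyc-closed w c (cyc-iter-closed w c m j)

  unique-length : ∀ {n} {xs : List (Fin n)} → Unique xs → length xs ≤ n
  unique-length {n} {xs} u = Fin.injective⇒≤ (inj xs u)
    where
    open import Data.List using (lookup)
    inj : ∀ xs → Unique xs → ∀ {i j} → lookup xs i ≡ lookup xs j → i ≡ j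
    inj (x ∷ xs) (a ∷ u) {zero}  {zero}  e = refl
    inj (x ∷ xs) (a ∷ u) {zero}  {suc j} e = ⊥-elim (All.lookup a (∈-lookup {xs = xs} j) e)
    inj (x ∷ xs) (a ∷ u) {suc i} {zero}  e = ⊥-elim (All.lookup a (∈-lookup {xs = xs} i) (sym e))
    inj (x ∷ xs) (a ∷ u) {suc i} {suc j} e = cong suc (inj xs u e)

  ==-true : ∀ {n} {x y : Fin n} → x ≡ y → (x == y) ≡ true
  ==-true {x = x} {y} e with x ≟ y
  ... | yes _ = refl
  ... | no ne = ⊥-elim (ne e)

  ==-sound : ∀ {n} {x y : Fin n} → (x == y) ≡ true → x ≡ y
  ==-sound {x = x} {y} e with x ≟ y | e
  ... | yes p | _ = p
  ... | no _  | ()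

  ==-refl : ∀ {n} (x : Fin n) → (x == x) ≡ true
  ==-refl x = ==-true refl

  ==-false : ∀ {n} {x y : Fin n} → x ≢ y → (x == y) ≡ false
  ==-false {x = x} {y} e with x ≟ y
  ... | yes p = ⊥-elim (e p)
  ... | no _  = refl

  any-true : {A : Set} (p : A → Bool) (xs : List A) {x : A} → x ∈ xs → p x ≡ true → any p xs ≡ true
  any-true p (x ∷ xs) (here refl) e rewrite e = refl
  any-true p (x ∷ xs) (there m)   e with p x
  ... | true  = refl
  ... | false = any-true p xs m e

  any-sound : {A : Set} (p : A → Bool) (xs : List A) → any p xs ≡ true → ∃ λ x → p x ≡ true
  any-sound p (x ∷ xs) e with p x in eq
  ... | true  = x , eq
  ... | false = any-sound p xs e

  all-true : {A : Set} (p : A → Bool) (xs : List A) → (∀ {x} → x ∈ xs → p x ≡ true) → all p xs ≡ true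
  all-true p []       h = refl
  all-true p (x ∷ xs) h rewrite h (here refl) = all-true p xs (h ∘ there)

  all-sound : {A : Set} (p : A → Bool) (xs : List A) {x : A} → all p xs ≡ true → x ∈ xs → p x ≡ true
  all-sound p (x ∷ xs) e (here refl) with p x
  ... | true = refl
  all-sound p (x ∷ xs) e (there m) with p x
  ... | true = all-sound p xs e m

  -- Orbits are exhausted before the bound n in the definition of reach.
  reach-complete : ∀ {n} (f : Fin n → Fin n) {x y} j → iter f j x ≡ y → reach f x y ≡ true
  reach-complete {n} f {x} {y} j e with segment f j x y e
  ... | xs , p , h , y∉ = any-true (λ j → iter f j x == y) (upTo n) (∈-upTo⁺ bound) (==-true (arrive xs p h))
    where
    bound : length xs < n
    bound = unique-length (All.tabulate (λ m y≡ → y∉ (subst (_∈ xs) (sym y≡) m)) ∷ link-unique f xs p y∉)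
    arrive : ∀ xs {x} → Link f xs y → hd xs y ≡ x → iter f (length xs) x ≡ y
    arrive []       _       refl = refl
    arrive (x ∷ xs) (e , p) refl = trans (sym (iter-suc f (length xs) x)) (trans (cong (iter f (length xs)) e) (arrive xs p refl))

  reach-sound : ∀ {n} (f : Fin n → Fin n) {x y} → reach f x y ≡ true → ∃ λ j → iter f j x ≡ y
  reach-sound {n} f {x} {y} e with any-sound (λ j → iter f j x == y) (upTo n) e
  ... | j , h = j , ==-sound h

-- Splitting and joining cycles by a transposition; insertion into cyclic words.

module Moves where

  import Data.List.Relation.Binary.Permutation.Propositional as Perm
  import Data.List.Relation.Binary.Permutation.Propositional.Properties as Perm
  open Cycles
  open import Data.Nat using (ℕ; suc; _+_)
  open import Data.Fin using (Fin; suc)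
  open import Data.List.Relation.Binary.Permutation.Propositional using (_↭_; ↭-refl; ↭-trans; ↭-reflexive; refl; prep; swap; trans)
  open import Data.List.Relation.Binary.Permutation.Propositional.Properties using (++⁺ˡ; shift)
  import Data.List.Relation.Binary.Permutation.Setoid.Properties as ↭ₛ
  open import Relation.Binary.PropositionalEquality hiding (trans)
  import Relation.Binary.PropositionalEquality as ≡

  unique-↭ : {A : Set} {xs ys : List A} → xs ↭ ys → Unique xs → Unique ys
  unique-↭ {A} p = ↭ₛ.Unique-resp-↭ (setoid A) (Perm.↭⇒↭ₛ p)

  concat-↭ : {A : Set} {xss yss : List (List A)} → xss ↭ yss → concat xss ↭ concat yss
  concat-↭ refl = ↭-refl
  concat-↭ (prep xs p) = ++⁺ˡ xs (concat-↭ p)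
  concat-↭ (swap xs ys p) = ↭-trans (Perm.shifts xs ys) (++⁺ˡ ys (++⁺ˡ xs (concat-↭ p)))
  concat-↭ (trans p q) = ↭-trans (concat-↭ p) (concat-↭ q)

  unique-++-disjoint : {A : Set} (xs : List A) {ys : List A} {x : A} → Unique (xs ++ ys) → x ∈ xs → x ∉ ys
  unique-++-disjoint (x ∷ xs) (a ∷ u) (here refl) m = All.lookup a (∈-++⁺ʳ xs m) refl
  unique-++-disjoint (x ∷ xs) (a ∷ u) (there k)   m = unique-++-disjoint xs u k m

  unique-∷ : {A : Set} {x : A} {xs : List A} → Unique (x ∷ xs) → x ∉ xs
  unique-∷ (a ∷ u) m = All.lookup a m refl

  picks : {A : Set} → List A → List (A × List A)
  picks []       = []
  picks (x ∷ xs) = (x , xs) ∷ map (λ { (y , r) → y , x ∷ r }) (picks xs)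

  picks-↭ : {A : Set} (xs : List A) {y : A} {r : List A} → (y , r) ∈ picks xs → xs ↭ y ∷ r
  picks-↭ (x ∷ xs) (here refl) = ↭-refl
  picks-↭ (x ∷ xs) (there m) with ∈-map⁻ _ m
  ... | (y , r) , m′ , refl = ↭-trans (prep x (picks-↭ xs m′)) (swap x y ↭-refl)

  module Active {A : Set} (V : A → Bool) where

    act : List A → ℕ
    act = count V

    actives : List A → List A
    actives []       = []
    actives (x ∷ xs) = if V x then x ∷ actives xs else actives xs

    act-++ : ∀ xs ys → act (xs ++ ys) ≡ act xs + act ys
    act-++ []       ys = refl
    act-++ (x ∷ xs) ys with V x
    ... | true  = cong suc (act-++ xs ys)
    ... | false = act-++ xs ys

    act-length : ∀ xs → act xs ≡ length (actives xs)
    act-length []       = refl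
    act-length (x ∷ xs) with V x
    ... | true  = cong suc (act-length xs)
    ... | false = act-length xs

    actives-++ : ∀ xs ys → actives (xs ++ ys) ≡ actives xs ++ actives ys
    actives-++ []       ys = refl
    actives-++ (x ∷ xs) ys with V x
    ... | true  = cong (x ∷_) (actives-++ xs ys)
    ... | false = actives-++ xs ys

    actives-↭ : ∀ {xs ys} → xs ↭ ys → actives xs ↭ actives ys
    actives-↭ refl = ↭-refl
    actives-↭ (prep x p) with V x
    ... | true  = prep x (actives-↭ p)
    ... | false = actives-↭ p
    actives-↭ (swap x y p) with V x | V y
    ... | true  | true  = swap x y (actives-↭ p)
    ... | true  | false = prep x (actives-↭ p)
    ... | false | true  = prep y (actives-↭ p)
    ... | false | false = actives-↭ p
    actives-↭ (trans p q) = ↭-trans (actives-↭ p) (actives-↭ q)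

    act-↭ : ∀ {xs ys} → xs ↭ ys → act xs ≡ act ys
    act-↭ {xs} {ys} p = ≡.trans (act-length xs) (≡.trans (Perm.↭-length (actives-↭ p)) (sym (act-length ys)))

    actives-∈⁻ : ∀ xs {x} → x ∈ actives xs → x ∈ xs × V x ≡ true
    actives-∈⁻ (y ∷ xs) m with V y in e
    actives-∈⁻ (y ∷ xs) (here refl) | true = here refl , e
    actives-∈⁻ (y ∷ xs) (there m)   | true with actives-∈⁻ xs m
    ... | k , v = there k , v
    actives-∈⁻ (y ∷ xs) m           | false with actives-∈⁻ xs m
    ... | k , v = there k , v

    actives-∈⁺ : ∀ xs {x} → x ∈ xs → V x ≡ true → x ∈ actives xs
    actives-∈⁺ (y ∷ xs) (here refl) v rewrite v = here refl
    actives-∈⁺ (y ∷ xs) (there m)   v with V y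
    ... | true  = there (actives-∈⁺ xs m v)
    ... | false = actives-∈⁺ xs m v

    actives-∷ : ∀ {x} xs → V x ≡ true → actives (x ∷ xs) ≡ x ∷ actives xs
    actives-∷ xs v rewrite v = refl

    actives-skip : ∀ {x} xs → V x ≡ false → actives (x ∷ xs) ≡ actives xs
    actives-skip xs v rewrite v = refl

    act-∷ : ∀ {x} xs → V x ≡ true → act (x ∷ xs) ≡ suc (act xs)
    act-∷ xs v rewrite v = refl

    act-skip : ∀ {x} xs → V x ≡ false → act (x ∷ xs) ≡ act xs
    act-skip xs v rewrite v = refl

    actives-unique : ∀ {xs} → Unique xs → Unique (actives xs)
    actives-unique {[]}     u = []
    actives-unique {x ∷ xs} (a ∷ u) with V x
    ... | true  = All.tabulate (λ m → All.lookup a (proj₁ (actives-∈⁻ xs m))) ∷ actives-unique u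
    ... | false = actives-unique u

    Split : Set
    Split = List A × A × List A

    consˢ : A → Split → Split
    consˢ x (p , i , q) = x ∷ p , i , q

    -- Cuts are made only at active points, which are the possible predecessors of an inserted
    -- point; inactive points stay inside the pieces.
    splits : List A → List Split
    splits []       = []
    splits (x ∷ xs) = if V x then ([] , x , xs) ∷ map (consˢ x) (splits xs) else map (consˢ x) (splits xs)

    splits-sound : ∀ w {p i q} → (p , i , q) ∈ splits w → w ≡ p ++ i ∷ q × V i ≡ true
    splits-sound (x ∷ xs) m with V x in e
    splits-sound (x ∷ xs) (here refl) | true = refl , e
    splits-sound (x ∷ xs) (there m)   | true with ∈-map⁻ (consˢ x) m
    ... | _ , m′ , refl with splits-sound xs m′
    ... | f , v = cong (x ∷_) f , v
    splits-sound (x ∷ xs) m           | false with ∈-map⁻ (consˢ x) m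
    ... | _ , m′ , refl with splits-sound xs m′
    ... | f , v = cong (x ∷_) f , v

    point : Split → A
    point (p , i , q) = i

    splits-points : ∀ w → map point (splits w) ≡ actives w
    splits-points []       = refl
    splits-points (x ∷ xs) with V x
    ... | true  = cong (x ∷_) (≡.trans (sym (List.map-∘ (splits xs))) (splits-points xs))
    ... | false = ≡.trans (sym (List.map-∘ (splits xs))) (splits-points xs)

    Move : Set
    Move = A × List A × List (List A)

    -- After either move the pending points follow i, because i takes over the old successor of y.
    -- Both new distinguished words therefore end in i.
    ownMove : A → List (List A) → Split → Move
    ownMove y cs (p , i , q) = i , p ++ i ∷ [] , (q ++ y ∷ []) ∷ cs

    joinMove : List A → A → List (List A) → Split → Move
    joinMove w y r (p , i , q) = i , w ++ y ∷ q ++ p ++ i ∷ [] , r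

    ownMoves : List A → A → List (List A) → List Move
    ownMoves w y cs = map (ownMove y cs) (splits w)

    joinMoves : List A → A → List (List A) → List Move
    joinMoves w y cs = concatMap (λ { (c , r) → map (joinMove w y r) (splits c) }) (picks cs)

    growMoves attachMoves : List A → A → List (List A) → List Move
    growMoves w y cs   = ownMoves w y cs ++ joinMoves w y cs
    attachMoves w x cs = joinMoves [] x (w ∷ cs)

    joinMoves-points : ∀ w y cs → map proj₁ (joinMoves w y cs) ≡ actives (concat cs)
    joinMoves-points w y cs = go cs id
      where
      jm : (List (List A) → List (List A)) → List A × List (List A) → List Move
      jm k (c , r) = map (joinMove w y (k r)) (splits c)
      block : ∀ r c → map proj₁ (map (joinMove w y r) (splits c)) ≡ actives c
      block r c = ≡.trans (sym (List.map-∘ (splits c))) (splits-points c)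
      -- The function k puts back the cycles that `picks` has already passed over.
      go : ∀ cs (k : List (List A) → List (List A)) → map proj₁ (concatMap (jm k) (picks cs)) ≡ actives (concat cs)
      go []       k = refl
      go (c ∷ cs) k = ≡.trans (List.map-++ proj₁ (jm k (c , cs)) _)
        (≡.trans (cong₂ _++_ (block (k cs) c)
          (≡.trans (cong (map proj₁ ∘ concat) (sym (List.map-∘ (picks cs)))) (go cs (k ∘ (c ∷_)))))
          (sym (actives-++ c (concat cs))))

    growMoves-points : ∀ w y cs → map proj₁ (growMoves w y cs) ≡ actives (concat (w ∷ cs))
    growMoves-points w y cs = ≡.trans (List.map-++ proj₁ (ownMoves w y cs) (joinMoves w y cs))
      (≡.trans (cong₂ _++_ (≡.trans (sym (List.map-∘ (splits w))) (splits-points w)) (joinMoves-points w y cs))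
               (sym (actives-++ w (concat cs))))

    attachMoves-points : ∀ w x cs → map proj₁ (attachMoves w x cs) ≡ actives (concat (w ∷ cs))
    attachMoves-points w x cs = joinMoves-points [] x (w ∷ cs)

    ownMoves-sound : ∀ w y cs {i w′ cs′} → (i , w′ , cs′) ∈ ownMoves w y cs →
                     ∃ λ p → ∃ λ q → w ≡ p ++ i ∷ q × V i ≡ true × w′ ≡ p ++ i ∷ [] × cs′ ≡ (q ++ y ∷ []) ∷ cs
    ownMoves-sound w y cs m with ∈-map⁻ (ownMove y cs) m
    ... | (p , i , q) , m′ , refl with splits-sound w m′
    ... | e , v = p , q , e , v , refl , refl

    joinMoves-sound : ∀ w y cs {i w′ r} → (i , w′ , r) ∈ joinMoves w y cs →
                      ∃ λ p → ∃ λ q → cs ↭ (p ++ i ∷ q) ∷ r × V i ≡ true × w′ ≡ w ++ y ∷ q ++ p ++ i ∷ []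
    joinMoves-sound w y cs m with find (∈-concatMap⁻ _ {xs = picks cs} m)
    ... | (c , r) , k , m′ with ∈-map⁻ (joinMove w y r) m′
    ... | (p , i , q) , m″ , refl with splits-sound c m″
    ... | refl , v = p , q , picks-↭ cs k , v , refl

  module _ {n : ℕ} where

    private X = Fin n

    -- Here e is the successor of the last entry, and points outside the list are fixed: `next u` is
    -- the cyclic permutation with word u, extended by the identity.
    nextIn : List X → X → X → X
    nextIn []      e z = z
    nextIn (x ∷ r) e z = if z == x then hd r e else nextIn r e z

    next : List X → X → X
    next u z = nextIn u (hd u z) z

    ins : X → X → List X → List X
    ins i y []      = []
    ins i y (a ∷ u) = if i == a then a ∷ y ∷ u else a ∷ ins i y u

    nextIn-∉ : ∀ u {e z} → z ∉ u → nextIn u e z ≡ z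
    nextIn-∉ []      m = refl
    nextIn-∉ (x ∷ u) m rewrite ==-false (m ∘ here) = nextIn-∉ u (m ∘ there)

    nextIn-at : ∀ p {e i} q → i ∉ p → nextIn (p ++ i ∷ q) e i ≡ hd q e
    nextIn-at []      {i = i} q m rewrite ==-refl i = refl
    nextIn-at (x ∷ p) q m rewrite ==-false (m ∘ here) = nextIn-at p q (m ∘ there)

    ins-split : ∀ p {i} y q → i ∉ p → ins i y (p ++ i ∷ q) ≡ p ++ i ∷ y ∷ q
    ins-split []      {i} y q m rewrite ==-refl i = refl
    ins-split (x ∷ p) y q m rewrite ==-false (m ∘ here) = cong (x ∷_) (ins-split p y q (m ∘ there))

    nextIn-ins : ∀ p {e i y z} q → z ≢ i → z ≢ y → nextIn (p ++ i ∷ y ∷ q) e z ≡ nextIn (p ++ i ∷ q) e z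
    nextIn-ins []      q a b rewrite ==-false a | ==-false b = refl
    nextIn-ins (x ∷ p) {e} {i} {y} {z} q a b with z == x
    ... | true  = ≡.trans (hd-++ p (i ∷ y ∷ q) e) (sym (hd-++ p (i ∷ q) e))
    ... | false = nextIn-ins p q a b

    split-at : ∀ {u : List X} {i} → Unique u → i ∈ u → ∃ λ p → ∃ λ q → u ≡ p ++ i ∷ q × i ∉ p
    split-at U m with ∈-∃++ m
    ... | p , q , refl = p , q , refl , λ k → unique-++-disjoint p U k (here refl)

    module _ {u : List X} {i y : X} (U : Unique u) (m : i ∈ u) (y∉ : y ∉ u) where

      private
        p = proj₁ (split-at U m)
        q = proj₁ (proj₂ (split-at U m))
        e : u ≡ p ++ i ∷ q
        e = proj₁ (proj₂ (proj₂ (split-at U m)))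
        i∉ : i ∉ p
        i∉ = proj₂ (proj₂ (proj₂ (split-at U m)))
        e′ : ins i y u ≡ p ++ i ∷ y ∷ q
        e′ = ≡.trans (cong (ins i y) e) (ins-split p y q i∉)
        y∉p : y ∉ p
        y∉p k = y∉ (subst (y ∈_) (sym e) (∈-++⁺ˡ k))
        y≢i : y ≢ i
        y≢i refl = y∉ m

      next-∉ : next u y ≡ y
      next-∉ = nextIn-∉ u y∉

      -- With the two equations that follow: inserting y after i composes `next u` with the
      -- transposition (i y), applied first.
      next-ins-i : next (ins i y u) i ≡ y
      next-ins-i rewrite e′ = nextIn-at p (y ∷ q) i∉

      next-ins-y : next (ins i y u) y ≡ next u i
      next-ins-y rewrite e′ = ≡.trans (cong (λ v → nextIn v (hd (p ++ i ∷ y ∷ q) y) y) (sym (List.++-assoc p (i ∷ []) (y ∷ q))))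
        (≡.trans (nextIn-at (p ++ i ∷ []) q y∉pi)
        (≡.trans (cong (hd q) (≡.trans (hd-++ p (i ∷ y ∷ q) y) (sym (hd-++ p (i ∷ q) i))))
        (≡.trans (sym (nextIn-at p q i∉)) (cong (λ v → next v i) (sym e)))))
        where
        y∉pi : y ∉ p ++ i ∷ []
        y∉pi k with ∈-++⁻ p k
        ... | inj₁ k′ = y∉p k′
        ... | inj₂ (here h) = y≢i h

      next-ins-z : ∀ {z} → z ≢ i → z ≢ y → next (ins i y u) z ≡ next u z
      next-ins-z {z} a b rewrite e′ = ≡.trans (cong (λ d → nextIn (p ++ i ∷ y ∷ q) d z) (≡.trans (hd-++ p (i ∷ y ∷ q) z) (sym (hd-++ p (i ∷ q) z))))
        (≡.trans (nextIn-ins p q a b) (cong (λ v → next v z) (sym e)))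

      ins-↭ : ins i y u ↭ y ∷ u
      ins-↭ = ↭-trans (↭-reflexive (≡.trans e′ (sym (List.++-assoc p (i ∷ []) (y ∷ q)))))
              (↭-trans (shift y (p ++ i ∷ []) q) (prep y (↭-reflexive (≡.trans (List.++-assoc p (i ∷ []) q) (sym e)))))

    ins-hd : ∀ i y u {d} → hd (ins i y u) d ≡ hd u d
    ins-hd i y [] = refl
    ins-hd i y (a ∷ u) with i == a
    ... | true  = refl
    ... | false = refl

-- Weight sums over all moves.

module MoveSums where

  open Integral
  open Weights
  open Moves
  open import Data.Nat using (ℕ; suc) renaming (_+_ to _+ℕ_)
  import Data.Nat.Properties as ℕ
  open import Data.Rational hiding (NonZero)
  open import Data.Rational.Properties
  open import Tactic.RingSolver using (solve-∀)
  open import Relation.Binary.PropositionalEquality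

  ∑-map : {A B : Set} (h : A → B) (xs : List A) (f : B → ℚ) → ∑ (map h xs) f ≡ ∑ xs (f ∘ h)
  ∑-map h []       f = refl
  ∑-map h (x ∷ xs) f = cong (λ z → f (h x) + z) (∑-map h xs f)

  ∑-++ : {A : Set} (xs ys : List A) (f : A → ℚ) → ∑ (xs ++ ys) f ≡ ∑ xs f + ∑ ys f
  ∑-++ []       ys f = sym (+-identityˡ (∑ ys f))
  ∑-++ (x ∷ xs) ys f = trans (cong (λ z → f x + z) (∑-++ xs ys f)) (sym (+-assoc (f x) (∑ xs f) (∑ ys f)))

  ∑-concatMap : {A B : Set} (h : A → List B) (xs : List A) (f : B → ℚ) → ∑ (concatMap h xs) f ≡ ∑ xs (λ x → ∑ (h x) f)
  ∑-concatMap h []       f = refl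
  ∑-concatMap h (x ∷ xs) f = trans (∑-++ (h x) (concatMap h xs) f) (cong (λ z → ∑ (h x) f + z) (∑-concatMap h xs f))

  ∑-picks : {A : Set} (a : A → ℕ) (xs : List A) (h : ℕ → List ℕ → ℚ) →
            ∑ (picks xs) (λ { (c , r) → h (a c) (map a r) }) ≡ pickSum (map a xs) h
  ∑-picks a []       h = refl
  ∑-picks a (x ∷ xs) h = cong (λ z → h (a x) (map a xs) + z)
    (trans (∑-map (λ { (y , r) → y , x ∷ r }) (picks xs) _) (∑-picks a xs (λ m r → h m (a x ∷ r))))

  module _ {A : Set} (V : A → Bool) where
    open Active V

    ∑-splits : ∀ w (g : ℕ → ℕ → ℚ) → ∑ (splits w) (λ { (p , i , q) → g (act p) (act q) }) ≡ splitSum (act w) g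
    ∑-splits []       g = refl
    ∑-splits (x ∷ xs) g with V x in e
    ... | true  = cong (λ z → g 0 (act xs) + z) (trans (∑-map (consˢ x) (splits xs) _)
                    (trans (∑-cong (splits xs) (λ { (p , i , q) → cong (λ z → g z (act q)) (act-∷ p e) })) (∑-splits xs (λ k k′ → g (suc k) k′))))
    ... | false = trans (∑-map (consˢ x) (splits xs) _)
                    (trans (∑-cong (splits xs) (λ { (p , i , q) → cong (λ z → g z (act q)) (act-skip p e) })) (∑-splits xs g))

    ∑-splits-const : ∀ w (f : Split → ℚ) k → (∀ p i q → w ≡ p ++ i ∷ q → V i ≡ true → f (p , i , q) ≡ k) →
                     ∑ (splits w) f ≡ ι (act w) * k
    ∑-splits-const []       f k h = sym (*-zeroˡ k)
    ∑-splits-const (x ∷ xs) f k h with V x in e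
    ... | true  = trans (cong₂ _+_ (h [] x xs refl e)
                    (trans (∑-map (consˢ x) (splits xs) f) (∑-splits-const xs (f ∘ consˢ x) k (λ p i q w v → h (x ∷ p) i q (cong (x ∷_) w) v))))
                    (lem k (ι (act xs)))
      where lem : ∀ k n → k + n * k ≡ (1ℚ + n) * k
            lem = solve-∀ R
    ... | false = trans (∑-map (consˢ x) (splits xs) f) (∑-splits-const xs (f ∘ consˢ x) k (λ p i q w v → h (x ∷ p) i q (cong (x ∷_) w) v))

    moveConfig : Move → Config
    moveConfig (i , w , cs) = act w , map act cs

    act-∷ʳ : ∀ xs {y} → V y ≡ true → act (xs ++ y ∷ []) ≡ suc (act xs)
    act-∷ʳ xs {y} v = trans (act-++ xs (y ∷ [])) (trans (cong (act xs +ℕ_) (act-∷ [] v)) (ℕ.+-comm (act xs) 1))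

    -- The size of a joined cycle does not depend on where the other cycle is cut, hence the factor
    -- m. For splits it does depend on the cut, hence `splitSum`.
    ∑-joinMoves : ∀ w {y} cs → V y ≡ true → ∀ g →
                  ∑ (joinMoves w y cs) (g ∘ moveConfig) ≡ pickSum (map act cs) (λ m r → ι m * g (act w +ℕ suc m , r))
    ∑-joinMoves w {y} cs v g = trans (∑-concatMap _ (picks cs) (g ∘ moveConfig))
      (trans (∑-cong (picks cs) (λ { (c , r) → trans (∑-map (joinMove w y r) (splits c) (g ∘ moveConfig))
                (∑-splits-const c _ (g (act w +ℕ suc (act c) , map act r)) (λ { p i q refl vi → cong (λ z → g (z , map act r)) (size p i q vi) })) }))
             (∑-picks act cs (λ m r → ι m * g (act w +ℕ suc m , r))))
      where
      size : ∀ p i q → V i ≡ true → act (w ++ y ∷ q ++ p ++ i ∷ []) ≡ act w +ℕ suc (act (p ++ i ∷ q))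
      size p i q vi = trans (act-++ w _) (cong (act w +ℕ_) (trans (act-∷ (q ++ p ++ i ∷ []) v) (cong suc
        (trans (act-++ q (p ++ i ∷ [])) (trans (cong (act q +ℕ_) (act-∷ʳ p vi)) (trans (ℕ.+-comm (act q) (suc (act p)))
        (trans (sym (ℕ.+-suc (act p) (act q))) (sym (trans (act-++ p (i ∷ q)) (cong (act p +ℕ_) (act-∷ q vi)))))))))))

    ∑-growMoves : ∀ w {y} cs → V y ≡ true → ∀ g →
                  ∑ (growMoves w y cs) (g ∘ moveConfig) ≡ grow g (act w , map act cs)
    ∑-growMoves w {y} cs v g = trans (∑-++ (ownMoves w y cs) (joinMoves w y cs) (g ∘ moveConfig))
      (cong₂ _+_ (trans (∑-map (ownMove y cs) (splits w) (g ∘ moveConfig)) (trans (∑-own-cong (splits w) (λ m → proj₂ (splits-sound w m))) (∑-splits w _)))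
                 (∑-joinMoves w cs v g))
      where
      open import Data.List.Membership.Propositional using (_∈_)
      open import Data.List.Relation.Unary.Any using (here; there)
      ∑-own-cong : ∀ ss → (∀ {p i q} → (p , i , q) ∈ ss → V i ≡ true) →
                   ∑ ss (g ∘ moveConfig ∘ ownMove y cs) ≡ ∑ ss (λ { (p , i , q) → g (suc (act p) , suc (act q) ∷ map act cs) })
      ∑-own-cong [] h = refl
      ∑-own-cong ((p , i , q) ∷ ss) h = cong₂ _+_ (cong₂ (λ a b → g (a , b ∷ map act cs)) (act-∷ʳ p (h (here refl))) (act-∷ʳ q v)) (∑-own-cong ss (h ∘ there))

    ∑-attachMoves : ∀ w {x} cs → V x ≡ true → ∀ g →
                    ∑ (attachMoves w x cs) (g ∘ moveConfig) ≡ attach g (act w , map act cs)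
    ∑-attachMoves w {x} cs v g = ∑-joinMoves [] (w ∷ cs) v g

-- How inserting one point of ν changes the cycles of the face map.

module Insertion where

  import Data.List.Relation.Binary.Permutation.Propositional as Perm
  import Data.List.Relation.Binary.Permutation.Propositional.Properties as Perm
  open Cycles
  open Moves
  open import Data.Nat using (ℕ; suc; _+_)
  import Data.Nat.Properties as ℕ
  open import Data.Fin using (Fin; suc; _≟_)
  open import Data.List.Relation.Binary.Permutation.Propositional using (_↭_; ↭-refl; ↭-sym; ↭-trans; ↭-reflexive; refl; prep; swap; trans)
  open import Data.List.Relation.Binary.Permutation.Propositional.Properties using (++⁺; ++⁺ˡ; ++⁺ʳ; shift; ++-commutativeMonoid; ∈-resp-↭; All-resp-↭; drop-mid)
  open import Relation.Binary.PropositionalEquality hiding (trans)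
  import Relation.Binary.PropositionalEquality as ≡
  open MoveSums
  open Weights using (Config; grow; attach; Partial; start-partial; grow-partial; attach-partial; complete; ∑)
  open import Data.Rational using (ℚ)

  unique-++ˡ : {A : Set} (xs : List A) {ys : List A} → Unique (xs ++ ys) → Unique xs
  unique-++ˡ []       u       = []
  unique-++ˡ (x ∷ xs) (a ∷ u) = All.++⁻ˡ xs a ∷ unique-++ˡ xs u

  module States {n : ℕ} (V : Fin n → Bool) (Θ : Fin n → Fin n) where
    open Active V

    private X = Fin n

    State : Set
    State = List X × List X × List (List X)

    -- The face map when only the points of u have been placed. Once u contains all of ν it is the
    -- face permutation of a reembedding (`table-face`).
    ζ : List X → X → X
    ζ u z = Θ (next u z)

    NonEmpty : List X → Set
    NonEmpty c = c ≢ []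

    Headed : List X → Set
    Headed c = ∃ λ x → ∃ λ t → c ≡ x ∷ t × V x ≡ true

    -- w ++ t is the cycle of ζ u through the pending points t, the cs are the
    -- other cycles meeting u, and the todo are cycles of Θ not meeting u.
    record Good (t : List X) (todo : List (List X)) (s : State) : Set where
      private
        u  = proj₁ s
        w  = proj₁ (proj₂ s)
        cs = proj₂ (proj₂ s)
      field
        cyclic   : All (Cyc (ζ u)) ((w ++ t) ∷ cs ++ todo)
        covers   : concat ((w ++ t) ∷ cs ++ todo) ↭ allFin n
        word     : actives (concat (w ∷ cs)) ↭ u
        nonempty : All NonEmpty (w ∷ cs)
    open Good

    covers-unique : ∀ {xs : List X} → xs ↭ allFin n → Unique xs
    covers-unique p = unique-↭ (↭-sym p) (Unique.allFin⁺ n)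

    nonempty-∷ʳ : ∀ q {y : X} → NonEmpty (q ++ y ∷ [])
    nonempty-∷ʳ []      ()
    nonempty-∷ʳ (_ ∷ _) ()

    nonempty-mid : ∀ w {y : X} {q} → NonEmpty (w ++ y ∷ q)
    nonempty-mid []      ()
    nonempty-mid (_ ∷ _) ()

    module Swapped {u : List X} {i y : X} {Z : List X}
                   (U : Unique (i ∷ y ∷ Z)) (wd : Unique u) (i∈ : i ∈ u) (y∉ : y ∉ u) where
      at-i : ζ (ins i y u) i ≡ ζ u y
      at-i = cong Θ (≡.trans (next-ins-i wd i∈ y∉) (sym (next-∉ wd i∈ y∉)))

      at-y : ζ (ins i y u) y ≡ ζ u i
      at-y = cong Θ (next-ins-y wd i∈ y∉)

      elsewhere : ∀ {x} → x ∈ Z → ζ (ins i y u) x ≡ ζ u x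
      elsewhere m = cong Θ (next-ins-z wd i∈ y∉
        (λ { refl → unique-∷ U (there m) }) (λ { refl → unique-∷ (AllPairs.tail U) m }))

    cyclic-rest : ∀ {f g : X → X} {css} → (∀ {x} → x ∈ concat css → g x ≡ f x) → All (Cyc f) css → All (Cyc g) css
    cyclic-rest e p = All.tabulate (λ {c} m → cyc-cong c (λ k → e (∈-concat⁺′ k m)) (All.lookup p m))

    open import Algebra.Solver.CommutativeMonoid (++-commutativeMonoid {A = X}) using (solve; _⊕_; _⊜_)

    module _ {w y t todo u} (CS : List (List X)) (cov : concat ((w ++ y ∷ t) ∷ CS ++ todo) ↭ allFin n)
             (wd : actives (concat (w ∷ CS)) ↭ u) where

      private
        U : Unique (concat (w ∷ CS) ++ (y ∷ t) ++ concat todo)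
        U = unique-↭ (↭-trans (++⁺ˡ (w ++ y ∷ t) (↭-reflexive (sym (List.concat-++ CS todo)))) (separate w y t (concat CS) (concat todo))) (covers-unique cov)
          where
          separate : ∀ w y t c r → (w ++ y ∷ t) ++ c ++ r ↭ (w ++ c) ++ (y ∷ t) ++ r
          separate w y t c r = solve 5 (λ w y t c r → (w ⊕ (y ⊕ t)) ⊕ (c ⊕ r) ⊜ (w ⊕ c) ⊕ ((y ⊕ t) ⊕ r)) ↭-refl w (y ∷ []) t c r

      word-unique : Unique u
      word-unique = unique-↭ wd (actives-unique {concat (w ∷ CS)} (unique-++ˡ (concat (w ∷ CS)) U))

      word-fresh : y ∉ u
      word-fresh m = unique-++-disjoint (concat (w ∷ CS)) U (proj₁ (actives-∈⁻ (concat (w ∷ CS)) (∈-resp-↭ (↭-sym wd) m))) (here refl)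

    own-good : ∀ {y t todo u p i q cs} → V y ≡ true → V i ≡ true → Good (y ∷ t) todo (u , p ++ i ∷ q , cs) →
               Good t todo (ins i y u , p ++ i ∷ [] , (q ++ y ∷ []) ∷ cs)
    own-good {y} {t} {todo} {u} {p} {i} {q} {cs} vy vi s = record
      { cyclic   = subst (Cyc _) (sym (List.++-assoc p (i ∷ []) t)) (proj₁ both) ∷ proj₂ both ∷ cyclic-rest (elsewhere ∘ ∈-++⁺ʳ (p ++ q ++ t)) (All.tail (cyclic s))
      ; covers   = ↭-trans (cov′ p i q y t rest) (covers s)
      ; word     = ↭-trans (actives-↭ (wd′ p i q y (concat cs))) (↭-trans (↭-reflexive (actives-∷ (concat ((p ++ i ∷ q) ∷ cs)) vy)) (↭-trans (prep y (word s)) (↭-sym (ins-↭ uu i∈ y∉))))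
      ; nonempty = nonempty-∷ʳ p ∷ nonempty-∷ʳ q ∷ All.tail (nonempty s)
      }
      where
      rest = concat (cs ++ todo)
      split≡ : (p ++ i ∷ q) ++ y ∷ t ≡ p ++ i ∷ q ++ y ∷ t
      split≡ = List.++-assoc p (i ∷ q) (y ∷ t)
      cov′ : ∀ p i q y t r → ((p ++ i ∷ []) ++ t) ++ (q ++ y ∷ []) ++ r ↭ ((p ++ i ∷ q) ++ y ∷ t) ++ r
      cov′ p i q y t r = solve 6 (λ p i q y t r → ((p ⊕ i) ⊕ t) ⊕ ((q ⊕ y) ⊕ r) ⊜ ((p ⊕ (i ⊕ q)) ⊕ (y ⊕ t)) ⊕ r) ↭-refl p (i ∷ []) q (y ∷ []) t r
      wd′ : ∀ p i q y r → (p ++ i ∷ []) ++ (q ++ y ∷ []) ++ r ↭ y ∷ (p ++ i ∷ q) ++ r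
      wd′ p i q y r = solve 5 (λ p i q y r → (p ⊕ i) ⊕ ((q ⊕ y) ⊕ r) ⊜ y ⊕ ((p ⊕ (i ⊕ q)) ⊕ r)) ↭-refl p (i ∷ []) q (y ∷ []) r
      out : ∀ p i q y t r → ((p ++ i ∷ q) ++ y ∷ t) ++ r ↭ i ∷ y ∷ (p ++ q ++ t) ++ r
      out p i q y t r = solve 6 (λ p i q y t r → ((p ⊕ (i ⊕ q)) ⊕ (y ⊕ t)) ⊕ r ⊜ i ⊕ (y ⊕ ((p ⊕ (q ⊕ t)) ⊕ r))) ↭-refl p (i ∷ []) q (y ∷ []) t r
      U : Unique (i ∷ y ∷ (p ++ q ++ t) ++ rest)
      U = unique-↭ (out p i q y t rest) (covers-unique (covers s))
      uu : Unique u
      uu = word-unique {p ++ i ∷ q} cs (covers s) (word s)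
      i∈ : i ∈ u
      i∈ = ∈-resp-↭ (word s) (actives-∈⁺ (concat ((p ++ i ∷ q) ∷ cs)) (∈-++⁺ˡ (∈-insert p)) vi)
      y∉ : y ∉ u
      y∉ = word-fresh {p ++ i ∷ q} cs (covers s) (word s)
      open Swapped U uu i∈ y∉
      both : Cyc (ζ (ins i y u)) (p ++ i ∷ t) × Cyc (ζ (ins i y u)) (q ++ y ∷ [])
      both = cyc-split p q t at-i at-y (elsewhere ∘ ∈-++⁺ˡ) (subst (Cyc (ζ u)) split≡ (All.head (cyclic s)))

    -- Stated with a general `CS` to serve both cases: for `attach` the word w is empty and `CS`
    -- includes the former distinguished cycle.
    join-good : ∀ {w y t todo u CS p i q r} → V y ≡ true → V i ≡ true →
                All (Cyc (ζ u)) ((w ++ y ∷ t) ∷ CS ++ todo) → concat ((w ++ y ∷ t) ∷ CS ++ todo) ↭ allFin n →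
                actives (concat (w ∷ CS)) ↭ u → All NonEmpty CS → CS ↭ (p ++ i ∷ q) ∷ r →
                Good t todo (ins i y u , w ++ y ∷ q ++ p ++ i ∷ [] , r)
    join-good {w} {y} {t} {todo} {u} {CS} {p} {i} {q} {r} vy vi cyc cov wd ne perm = record
      { cyclic   = subst (Cyc _) (lem₁ w y q p i t) joined ∷ cyclic-rest (elsewhere ∘ ∈-++⁺ʳ ((w ++ t) ++ (p ++ q))) (All.tail (All.tail cyc′))
      ; covers   = ↭-trans (cov₂ w y t p i q (concat (r ++ todo))) cov′
      ; word     = ↭-trans (actives-↭ (↭-trans (wd₂ w y p i q (concat r)) (prep y (++⁺ˡ w (↭-sym (concat-↭ perm))))))
                   (↭-trans (↭-reflexive (actives-∷ (concat (w ∷ CS)) vy)) (↭-trans (prep y wd) (↭-sym (ins-↭ uu i∈ y∉))))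
      ; nonempty = nonempty-mid w ∷ All.tail (All-resp-↭ perm ne)
      }
      where
      lem₁ : ∀ w y q p i t → w ++ y ∷ q ++ p ++ i ∷ t ≡ (w ++ y ∷ q ++ p ++ i ∷ []) ++ t
      lem₁ w y q p i t = sym (≡.trans (List.++-assoc w _ t) (cong (λ z → w ++ y ∷ z) (≡.trans (List.++-assoc q _ t) (cong (q ++_) (List.++-assoc p _ t)))))
      cov₂ : ∀ w y t p i q r → ((w ++ y ∷ q ++ p ++ i ∷ []) ++ t) ++ r ↭ (w ++ y ∷ t) ++ (p ++ i ∷ q) ++ r
      cov₂ w y t p i q r = solve 7 (λ w y t p i q r → ((w ⊕ (y ⊕ (q ⊕ (p ⊕ i)))) ⊕ t) ⊕ r ⊜ (w ⊕ (y ⊕ t)) ⊕ ((p ⊕ (i ⊕ q)) ⊕ r)) ↭-refl w (y ∷ []) t p (i ∷ []) q r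
      wd₂ : ∀ w y p i q r → (w ++ y ∷ q ++ p ++ i ∷ []) ++ r ↭ y ∷ w ++ (p ++ i ∷ q) ++ r
      wd₂ w y p i q r = solve 6 (λ w y p i q r → (w ⊕ (y ⊕ (q ⊕ (p ⊕ i)))) ⊕ r ⊜ y ⊕ (w ⊕ ((p ⊕ (i ⊕ q)) ⊕ r))) ↭-refl w (y ∷ []) p (i ∷ []) q r
      out : ∀ w y t p i q r → (w ++ y ∷ t) ++ (p ++ i ∷ q) ++ r ↭ i ∷ y ∷ ((w ++ t) ++ (p ++ q)) ++ r
      out w y t p i q r = solve 7 (λ w y t p i q r → (w ⊕ (y ⊕ t)) ⊕ ((p ⊕ (i ⊕ q)) ⊕ r) ⊜ i ⊕ (y ⊕ (((w ⊕ t) ⊕ (p ⊕ q)) ⊕ r))) ↭-refl w (y ∷ []) t p (i ∷ []) q r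
      perm′ : (w ++ y ∷ t) ∷ CS ++ todo ↭ (w ++ y ∷ t) ∷ (p ++ i ∷ q) ∷ r ++ todo
      perm′ = prep _ (++⁺ʳ todo perm)
      cyc′ = All-resp-↭ perm′ cyc
      cov′ : concat ((w ++ y ∷ t) ∷ (p ++ i ∷ q) ∷ r ++ todo) ↭ allFin n
      cov′ = ↭-trans (concat-↭ (↭-sym perm′)) cov
      U : Unique (i ∷ y ∷ ((w ++ t) ++ (p ++ q)) ++ concat (r ++ todo))
      U = unique-↭ (out w y t p i q (concat (r ++ todo))) (covers-unique cov′)
      uu : Unique u
      uu = word-unique {w} CS cov wd
      i∈ : i ∈ u
      i∈ = ∈-resp-↭ wd (actives-∈⁺ (concat (w ∷ CS)) (∈-++⁺ʳ w (∈-resp-↭ (↭-sym (concat-↭ perm)) (∈-++⁺ˡ (∈-insert p)))) vi)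
      y∉ : y ∉ u
      y∉ = word-fresh {w} CS cov wd
      open Swapped U uu i∈ y∉
      joined : Cyc (ζ (ins i y u)) (w ++ y ∷ q ++ p ++ i ∷ t)
      joined = cyc-join w p q t at-i at-y (elsewhere ∘ ∈-++⁺ˡ) (All.head cyc′) (All.head (All.tail cyc′))

    child : X → State → Move → State
    child y (u , _) (i , w , cs) = ins i y u , w , cs

    grow-good : ∀ {y t todo s mv} → V y ≡ true → Good (y ∷ t) todo s →
                mv ∈ growMoves (proj₁ (proj₂ s)) y (proj₂ (proj₂ s)) → Good t todo (child y s mv)
    grow-good {y} {s = u , w , cs} vy s m with ∈-++⁻ (ownMoves w y cs) m
    ... | inj₁ m′ with ownMoves-sound w y cs m′
    ...   | p , q , refl , vi , refl , refl = own-good {p = p} {q = q} vy vi s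
    grow-good {y} {s = u , w , cs} vy s m | inj₂ m′ with joinMoves-sound w y cs m′
    ...   | p , q , perm , vi , refl = join-good {p = p} {q = q} vy vi (cyclic s) (covers s) (word s) (All.tail (nonempty s)) perm

    attach-good : ∀ {x t todo s mv} → V x ≡ true → Good [] ((x ∷ t) ∷ todo) s →
                  mv ∈ attachMoves (proj₁ (proj₂ s)) x (proj₂ (proj₂ s)) → Good t todo (child x s mv)
    attach-good {x} {t} {todo} {s = u , w , cs} vx s m with joinMoves-sound [] x (w ∷ cs) m
    ... | p , q , perm , vi , refl = join-good {w = []} {p = p} {q = q} vx vi
            (All-resp-↭ front (cyclic s)) (↭-trans (concat-↭ (↭-sym front)) (covers s)) (word s) (nonempty s) perm
      where
      front : (w ++ []) ∷ cs ++ (x ∷ t) ∷ todo ↭ (x ∷ t) ∷ (w ∷ cs) ++ todo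
      front = ↭-trans (↭-reflexive (cong (_∷ cs ++ (x ∷ t) ∷ todo) (List.++-identityʳ w))) (shift (x ∷ t) (w ∷ cs) todo)

    skip : X → State → State
    skip y (u , w , cs) = u , w ++ y ∷ [] , cs

    -- A half-edge outside ν is never inserted; it only passes from the pending to the processed
    -- part of the same cycle.
    skip-good : ∀ {y t todo s} → V y ≡ false → Good (y ∷ t) todo s → Good t todo (skip y s)
    skip-good {y} {t} {todo} {u , w , cs} v s = record
      { cyclic   = subst (λ z → All (Cyc (ζ u)) (z ∷ cs ++ todo)) e (cyclic s)
      ; covers   = subst (λ z → concat (z ∷ cs ++ todo) ↭ allFin n) e (covers s)
      ; word     = ↭-trans (↭-reflexive (≡.trans (cong actives (List.++-assoc w (y ∷ []) (concat cs)))
                     (≡.trans (actives-++ w _) (≡.trans (cong (actives w ++_) (actives-skip (concat cs) v)) (sym (actives-++ w _)))))) (word s)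
      ; nonempty = nonempty-∷ʳ w ∷ All.tail (nonempty s)
      }
      where
      e : w ++ y ∷ t ≡ (w ++ y ∷ []) ++ t
      e = sym (List.++-assoc w (y ∷ []) t)

  unique-map : {A B : Set} (f : A → B) (xs : List A) → (∀ {x y} → x ∈ xs → y ∈ xs → f x ≡ f y → x ≡ y) →
               Unique xs → Unique (map f xs)
  unique-map f []       inj u       = []
  unique-map f (x ∷ xs) inj (a ∷ u) = All.tabulate fresh ∷ unique-map f xs (λ m m′ → inj (there m) (there m′)) u
    where
    fresh : ∀ {z} → z ∈ map f xs → f x ≢ z
    fresh m e with ∈-map⁻ f m
    ... | y , m′ , refl = All.lookup a m′ (inj (here refl) (there m′) e)

  unique-concatMap : {A B C : Set} (k : A → C) (f : A → List B) (xs : List A) →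
                     (∀ {x} → x ∈ xs → Unique (f x)) →
                     (∀ {x y b} → x ∈ xs → y ∈ xs → b ∈ f x → b ∈ f y → k x ≡ k y) →
                     Unique (map k xs) → Unique (concatMap f xs)
  unique-concatMap k f []       h d u       = []
  unique-concatMap k f (x ∷ xs) h d (a ∷ u) = Unique.++⁺ (h (here refl)) (unique-concatMap k f xs (h ∘ there) (λ m m′ → d (there m) (there m′)) u) disjoint
    where
    disjoint : ∀ {b} → b ∈ f x × b ∈ concatMap f xs → ⊥
    disjoint (m , m′) with find (∈-concatMap⁻ f {xs = xs} m′)
    ... | y , k∈ , m″ = All.lookup a (∈-map⁺ k k∈) (d (here refl) (there k∈) m m″)

  -- Enumeration of cyclic orders by successive insertion.

  module Words {n : ℕ} where
    private X = Fin n

    remove : X → List X → List X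
    remove y []      = []
    remove y (a ∷ u) = if a == y then remove y u else a ∷ remove y u

    remove-∉ : ∀ y u → y ∉ u → remove y u ≡ u
    remove-∉ y []      m = refl
    remove-∉ y (a ∷ u) m rewrite ==-false {x = a} {y} (m ∘ here ∘ sym) = cong (a ∷_) (remove-∉ y u (m ∘ there))

    remove-ins : ∀ i y u → y ∉ u → remove y (ins i y u) ≡ u
    remove-ins i y [] m = refl
    remove-ins i y (a ∷ u) m with i == a
    ... | true  rewrite ==-false {x = a} {y} (m ∘ here ∘ sym) | ==-refl y = cong (a ∷_) (remove-∉ y u (m ∘ there))
    ... | false rewrite ==-false {x = a} {y} (m ∘ here ∘ sym) = cong (a ∷_) (remove-ins i y u (m ∘ there))

    hd-∈ : ∀ {z : X} u {d} → z ∈ u → hd u d ∈ u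
    hd-∈ (a ∷ u) m = here refl

    ins-clash : ∀ {a u i y} → y ∉ a ∷ u → i ≢ a → i ∈ a ∷ u → a ∷ y ∷ u ≢ a ∷ ins i y u
    ins-clash y∉ ne (here e) h = ne e
    ins-clash {u = u} {i} {y} y∉ ne (there m) h =
      y∉ (there (subst (_∈ u) (≡.trans (sym (ins-hd i y u {y})) (cong (λ z → hd z y) (sym (List.∷-injectiveʳ h)))) (hd-∈ u m)))

    ins-injective : ∀ u {i i′ y} → y ∉ u → i ∈ u → i′ ∈ u → ins i y u ≡ ins i′ y u → i ≡ i′
    ins-injective (a ∷ u) {i} {i′} {y} y∉ m m′ e with i ≟ a | i′ ≟ a
    ... | yes p | yes p′ = ≡.trans p (sym p′)
    ... | yes p | no p′  = ⊥-elim (ins-clash y∉ p′ m′ e)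
    ... | no p  | yes p′ = ⊥-elim (ins-clash y∉ p m (sym e))
    ins-injective (a ∷ u) y∉ (here h)  m′ e | no p | no p′ = ⊥-elim (p h)
    ins-injective (a ∷ u) y∉ (there m) (here h) e | no p | no p′ = ⊥-elim (p′ h)
    ins-injective (a ∷ u) y∉ (there m) (there m′) e | no p | no p′ = ins-injective u (y∉ ∘ there) m m′ (List.∷-injectiveʳ e)

    -- Us lists, once each, the words on A starting with x₁, i.e. the cyclic
    -- permutations of A.
    record WordSet (x₁ : X) (A : List X) (Us : List (List X)) : Set where
      field
        distinct : Unique Us
        sound    : ∀ {u} → u ∈ Us → (∃ λ p → u ≡ x₁ ∷ p) × u ↭ A
        full     : ∀ p → x₁ ∷ p ↭ A → x₁ ∷ p ∈ Us
    open WordSet public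

    snoc-split : ∀ (a : X) xs → ∃ λ ys → ∃ λ z → a ∷ xs ≡ ys ++ z ∷ []
    snoc-split a []       = [] , a , refl
    snoc-split a (b ∷ xs) with snoc-split b xs
    ... | ys , z , e = a ∷ ys , z , cong (a ∷_) e

    module _ {S M : Set} (word : S → List X) (child : S → M → S) (point : M → X) (moves : S → List M)
             {x₁ y : X} {A : List X} (ext : ∀ s mv → word (child s mv) ≡ ins (point mv) y (word s)) where

      -- Deleting y recovers the parent word, and the predecessor of y recovers the move. A
      -- predecessor always exists, since the front position is held by x₁ ≠ y.
      insert-words : ∀ {Sts} → Unique A → y ∉ A → x₁ ∈ A → (∀ {s} → s ∈ Sts → map point (moves s) ↭ word s) →
                     WordSet x₁ A (map word Sts) →
                     WordSet x₁ (y ∷ A) (map word (concatMap (λ s → map (child s) (moves s)) Sts))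
      insert-words {Sts} UA y∉A x₁∈A pts ws = record
        { distinct = subst Unique (sym shape) (unique-concatMap word B Sts block-unique clash (distinct ws))
        ; sound    = λ m → snd (find (∈-concatMap⁻ B {xs = Sts} (subst (_ ∈_) shape m)))
        ; full     = ful
        }
        where
        B : S → List (List X)
        B s = map (λ i → ins i y (word s)) (map point (moves s))
        block : ∀ s → map word (map (child s) (moves s)) ≡ B s
        block s = ≡.trans (sym (List.map-∘ (moves s))) (≡.trans (List.map-cong (ext s) (moves s)) (List.map-∘ (moves s)))
        shape : map word (concatMap (λ s → map (child s) (moves s)) Sts) ≡ concatMap B Sts
        shape = go Sts
          where
          go : ∀ Sts → map word (concatMap (λ s → map (child s) (moves s)) Sts) ≡ concatMap B Sts
          go []        = refl
          go (s ∷ Sts) = ≡.trans (List.map-++ word (map (child s) (moves s)) _) (cong₂ _++_ (block s) (go Sts))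
        wA : ∀ {s} → s ∈ Sts → word s ↭ A
        wA m = proj₂ (sound ws (∈-map⁺ word m))
        y∉ : ∀ {s} → s ∈ Sts → y ∉ word s
        y∉ m k = y∉A (∈-resp-↭ (wA m) k)
        uw : ∀ {s} → s ∈ Sts → Unique (word s)
        uw m = unique-↭ (↭-sym (wA m)) UA
        block-unique : ∀ {s} → s ∈ Sts → Unique (B s)
        block-unique {s} m = unique-map _ (map point (moves s))
          (λ a b e → ins-injective (word s) (y∉ m) (∈-resp-↭ (pts m) a) (∈-resp-↭ (pts m) b) e) (unique-↭ (↭-sym (pts m)) (uw m))
        removed : ∀ {s b} → s ∈ Sts → b ∈ B s → remove y b ≡ word s
        removed {s} m k with ∈-map⁻ (λ i → ins i y (word s)) k
        ... | i , _ , refl = remove-ins i y (word s) (y∉ m)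
        clash : ∀ {s s′ b} → s ∈ Sts → s′ ∈ Sts → b ∈ B s → b ∈ B s′ → word s ≡ word s′
        clash m m′ k k′ = ≡.trans (sym (removed m k)) (removed m′ k′)
        snd : ∀ {u} → (∃ λ s → s ∈ Sts × u ∈ B s) → (∃ λ p → u ≡ x₁ ∷ p) × u ↭ y ∷ A
        snd {u} (s , m , k) with ∈-map⁻ (λ i → ins i y (word s)) k
        ... | i , k′ , refl = begins , ↭-trans (ins-↭ (uw m) (∈-resp-↭ (pts m) k′) (y∉ m)) (prep y (wA m))
          where
          begins : ∃ λ p → ins i y (word s) ≡ x₁ ∷ p
          begins with word s | sound ws (∈-map⁺ word m)
          ... | .(x₁ ∷ p) | (p , refl) , _ with i == x₁
          ... | true  = _ , refl
          ... | false = _ , refl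
        ful : ∀ p → x₁ ∷ p ↭ y ∷ A → x₁ ∷ p ∈ map word (concatMap (λ s → map (child s) (moves s)) Sts)
        ful p perm with ∈-resp-↭ (↭-sym perm) (here refl)
        ... | here y≡x₁ = ⊥-elim (y∉A (subst (_∈ A) (sym y≡x₁) x₁∈A))
        ... | there k with ∈-∃++ k
        ... | p₁ , p₂ , refl with drop-mid (x₁ ∷ p₁) [] perm | snoc-split x₁ p₁
        ... | perm′ | a , i , e with ∈-map⁻ word (full ws (p₁ ++ p₂) perm′)
        ... | s , m , ws≡ = subst (x₁ ∷ p₁ ++ y ∷ p₂ ∈_) (sym shape)
              (∈-concatMap⁺ B (lose m (subst (_∈ B s) inserted (∈-map⁺ (λ i → ins i y (word s)) (∈-resp-↭ (↭-sym (pts m)) i∈)))))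
          where
          w≡ : word s ≡ a ++ i ∷ p₂
          w≡ = ≡.trans (sym ws≡) (≡.trans (cong (_++ p₂) e) (List.++-assoc a (i ∷ []) p₂))
          i∈ : i ∈ word s
          i∈ = subst (i ∈_) (sym w≡) (∈-insert a)
          i∉a : i ∉ a
          i∉a k = unique-++-disjoint a (subst Unique w≡ (uw m)) k (here refl)
          inserted : ins i y (word s) ≡ x₁ ∷ p₁ ++ y ∷ p₂
          inserted = ≡.trans (cong (ins i y) w≡) (≡.trans (ins-split a y p₂ i∉a)
            (≡.trans (sym (List.++-assoc a (i ∷ []) (y ∷ p₂))) (cong (_++ y ∷ p₂) (sym e))))

  -- All cyclic orders of ν built simultaneously, together with their weights.

  module Stages {n : ℕ} (V : Fin n → Bool) (Θ : Fin n → Fin n) (x₁ : Fin n) where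
    open Active V
    open States V Θ
    open Good
    open Words {n}

    private X = Fin n

    config : State → Config
    config (u , w , cs) = act w , map act cs

    growMovesˢ attachMovesˢ : X → State → List Move
    growMovesˢ y (u , w , cs)   = growMoves w y cs
    attachMovesˢ x (u , w , cs) = attachMoves w x cs

    children : X → (State → List Move) → List State → List State
    children y moves = concatMap (λ s → map (child y s) (moves s))

    ∑-children : ∀ y moves Sts (k : (Config → ℚ) → Config → ℚ) →
                 (∀ s g → ∑ (moves s) (g ∘ moveConfig V) ≡ k g (config s)) →
                 ∀ g → ∑ (map config (children y moves Sts)) g ≡ ∑ (map config Sts) (k g)
    ∑-children y moves Sts k h g = ≡.trans (∑-map config (children y moves Sts) g)
      (≡.trans (∑-concatMap (λ s → map (child y s) (moves s)) Sts (g ∘ config))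
      (≡.trans (Weights.∑-cong Sts (λ s → ≡.trans (∑-map (child y s) (moves s) (g ∘ config)) (h s g))) (sym (∑-map config Sts (k g)))))

    -- The points of ν are inserted in the order in which the cycles of Θ list them, the same in
    -- every state. Hence the pending points and the closed form of the weights are common to the
    -- whole list of states.
    record Stage (ns : List ℕ) (l : ℕ) (t : List X) (todo : List (List X)) (A : List X) (Sts : List State) : Set where
      field
        good    : ∀ {s} → s ∈ Sts → Good t todo s
        words   : WordSet x₁ A (map proj₁ Sts)
        active  : A ++ actives (t ++ concat todo) ↭ actives (allFin n)
        first   : x₁ ∈ A
        weights : Partial ns l (map config Sts)
    open Stage public

    stage-unique : ∀ {ns l t todo A Sts} → Stage ns l t todo A Sts → Unique (A ++ actives (t ++ concat todo))
    stage-unique S = unique-↭ (↭-sym (active S)) (actives-unique (Unique.allFin⁺ n))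

    children-good : ∀ {y moves Sts t todo} → (∀ {s mv} → s ∈ Sts → mv ∈ moves s → Good t todo (child y s mv)) →
                    ∀ {s} → s ∈ children y moves Sts → Good t todo s
    children-good {y} {moves} {Sts} h m with find (∈-concatMap⁻ (λ s → map (child y s) (moves s)) {xs = Sts} m)
    ... | s , m′ , k with ∈-map⁻ (child y s) k
    ... | mv , m″ , refl = h m′ m″

    grow-stage : ∀ {ns l y t todo A Sts} → V y ≡ true → Stage ns l (y ∷ t) todo A Sts →
                 Stage ns (suc l) t todo (y ∷ A) (children y (growMovesˢ y) Sts)
    grow-stage {ns} {l} {y} {t} {todo} {A} {Sts} vy S = record
      { good    = children-good (λ m m′ → grow-good vy (good S m) m′)
      ; words   = insert-words proj₁ (child y) proj₁ (growMovesˢ y) (λ _ _ → refl) (unique-++ˡ A U) y∉A (first S)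
                    (λ { {u , w , cs} m → ↭-trans (↭-reflexive (growMoves-points w y cs)) (word (good S m)) }) (words S)
      ; active  = ↭-trans (↭-sym (shift y A _)) (↭-trans (↭-reflexive (cong (A ++_) (sym (actives-∷ (t ++ concat todo) vy)))) (active S))
      ; first   = there (first S)
      ; weights = grow-partial {C = map config Sts} (∑-children y (growMovesˢ y) Sts grow (λ { (u , w , cs) g → ∑-growMoves V w cs vy g })) (weights S)
      }
      where
      U = stage-unique S
      y∉A : y ∉ A
      y∉A m = unique-++-disjoint A U m (subst (y ∈_) (sym (actives-∷ (t ++ concat todo) vy)) (here refl))

    attach-stage : ∀ {ns l x t todo A Sts} → V x ≡ true → Stage ns l [] ((x ∷ t) ∷ todo) A Sts →
                   Stage (l ∷ ns) 1 t todo (x ∷ A) (children x (attachMovesˢ x) Sts)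
    attach-stage {ns} {l} {x} {t} {todo} {A} {Sts} vx S = record
      { good    = children-good (λ m m′ → attach-good vx (good S m) m′)
      ; words   = insert-words proj₁ (child x) proj₁ (attachMovesˢ x) (λ _ _ → refl) (unique-++ˡ A U) x∉A (first S)
                    (λ { {u , w , cs} m → ↭-trans (↭-reflexive (attachMoves-points w x cs)) (word (good S m)) }) (words S)
      ; active  = ↭-trans (↭-sym (shift x A _)) (↭-trans (↭-reflexive (cong (A ++_) (sym (actives-∷ (t ++ concat todo) vx)))) (active S))
      ; first   = there (first S)
      ; weights = attach-partial {C = map config Sts} (∑-children x (attachMovesˢ x) Sts attach (λ { (u , w , cs) g → ∑-attachMoves V w cs vx g })) (complete (weights S))
      }
      where
      U = stage-unique S
      x∉A : x ∉ A
      x∉A m = unique-++-disjoint A U m (subst (x ∈_) (sym (actives-∷ (t ++ concat todo) vx)) (here refl))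

    skip-stage : ∀ {ns l y t todo A Sts} → V y ≡ false → Stage ns l (y ∷ t) todo A Sts →
                 Stage ns l t todo A (map (skip y) Sts)
    skip-stage {ns} {l} {y} {t} {todo} {A} {Sts} vy S = record
      { good    = λ m → skipped (∈-map⁻ (skip y) m)
      ; words   = subst (WordSet x₁ A) (List.map-∘ Sts) (words S)
      ; active  = ↭-trans (↭-reflexive (cong (A ++_) (sym (actives-skip (t ++ concat todo) vy)))) (active S)
      ; first   = first S
      ; weights = subst (Partial ns l) (≡.trans (List.map-cong same Sts) (List.map-∘ Sts)) (weights S)
      }
      where
      skipped : ∀ {s} → (∃ λ s′ → s′ ∈ Sts × s ≡ skip y s′) → Good t todo s
      skipped (s′ , m , refl) = skip-good vy (good S m)
      same : ∀ s → config s ≡ config (skip y s)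
      same (u , w , cs) = cong (_, map act cs) (sym (≡.trans (act-++ w (y ∷ [])) (≡.trans (cong (act w +_) (act-skip [] vy)) (ℕ.+-identityʳ (act w)))))

    -- Finished lengths are pushed onto `ns`, so the cycle type is obtained only up to order.
    record Outcome (parts : List ℕ) : Set where
      field
        {ns}  : List ℕ
        {l}   : ℕ
        {A}   : List X
        {Sts} : List State
        stage   : Stage ns l [] [] A Sts
        types   : l ∷ ns ↭ parts

    run : ∀ {ns l A Sts} t todo → All Headed todo → Stage ns l t todo A Sts → Outcome (l + act t ∷ ns ++ map act todo)
    run {ns} {l} [] [] [] S = record { stage = S ; types = ↭-reflexive (cong₂ _∷_ (sym (ℕ.+-identityʳ l)) (sym (List.++-identityʳ ns))) }
    -- A new cycle of Θ is entered through its head, which must therefore be an active point; this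
    -- is the purpose of `Headed`.
    run {ns} {l} [] (.(x ∷ t) ∷ todo) ((x , t , refl , vx) ∷ hs) S with run t todo hs (attach-stage vx S)
    ... | O = record { stage = Outcome.stage O ; types = ↭-trans (Outcome.types O)
              (↭-trans (↭-reflexive (cong₂ (λ a b → a ∷ b ∷ ns ++ map act todo) (sym (act-∷ t vx)) (sym (ℕ.+-identityʳ l))))
              (↭-trans (swap _ _ ↭-refl) (prep _ (↭-sym (shift _ ns (map act todo)))))) }
    run {ns} {l} (y ∷ t) todo hs S with V y in vy
    ... | true  with run t todo hs (grow-stage vy S)
    ...   | O = record { stage = Outcome.stage O ; types = ↭-trans (Outcome.types O) (↭-reflexive (cong (λ a → a ∷ ns ++ map act todo) (sym (ℕ.+-suc l (act t))))) }
    run {ns} {l} (y ∷ t) todo hs S | false = run t todo hs (skip-stage vy S)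

    start : ∀ t todo → V x₁ ≡ true → All (Cyc Θ) ((x₁ ∷ t) ∷ todo) → concat ((x₁ ∷ t) ∷ todo) ↭ allFin n →
            Stage [] 1 t todo (x₁ ∷ []) ((x₁ ∷ [] , x₁ ∷ [] , []) ∷ [])
    start t todo v cyc cov = record
      { good    = λ { (here refl) → record
          { cyclic   = All.map (λ {c} → cyc-cong c (λ _ → cong Θ (trivial _))) cyc
          ; covers   = cov
          ; word     = ↭-reflexive (actives-∷ [] v)
          ; nonempty = (λ ()) ∷ [] } }
      ; words   = record
          { distinct = [] ∷ []
          ; sound    = λ { (here refl) → ([] , refl) , ↭-refl }
          ; full     = λ p perm → here (Perm.↭-singleton-inv perm) }
      ; active  = ↭-trans (↭-reflexive (sym (actives-∷ (t ++ concat todo) v))) (actives-↭ cov)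
      ; first   = here refl
      ; weights = subst (λ k → Partial [] 1 ((k , []) ∷ [])) (sym (act-∷ [] v)) start-partial
      }
      where
      trivial : ∀ z → next (x₁ ∷ []) z ≡ z
      trivial z with z ≟ x₁
      ... | yes e = sym e
      ... | no _  = refl

-- Cycle decomposition of an injective map on a finite set.

module Orbits where

  open Cycles
  open Moves
  open import Data.Nat using (ℕ; zero; suc; _+_)
  import Data.Nat.Properties as ℕ
  open import Data.Fin using (Fin; zero; suc; _≟_)
  open import Data.List.Relation.Binary.Permutation.Propositional using (_↭_)
  open import Relation.Binary.PropositionalEquality
  import Relation.Binary.PropositionalEquality as ≡
  open import Data.Fin.Base using (toℕ)
  import Data.Fin.Properties as Fin
  import Data.Vec
  open Insertion using (unique-map; unique-concatMap)
  open import Data.List.Relation.Binary.BagAndSetEquality using (∼bag⇒↭)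
  open import Data.List.Membership.Propositional.Properties.WithK using (unique∧set⇒bag)
  open import Function.Bundles using (mk⇔)

  same-members : {A : Set} {xs ys : List A} → Unique xs → Unique ys →
                 (∀ {x} → x ∈ xs → x ∈ ys) → (∀ {x} → x ∈ ys → x ∈ xs) → xs ↭ ys
  same-members u v f g = ∼bag⇒↭ (unique∧set⇒bag u v (mk⇔ f g))

  module _ {n : ℕ} {f : Fin n → Fin n} (inj : ∀ {a b} → f a ≡ f b → a ≡ b) where

    iter-cancel : ∀ i k x → iter f (i + k) x ≡ iter f i x → iter f k x ≡ x
    iter-cancel zero    k x e = e
    iter-cancel (suc i) k x e = iter-cancel i k x (inj e)

    -- Two of n + 1 iterates coincide, and injectivity cancels their common initial steps.
    returns : ∀ x → ∃ λ j → iter f j (f x) ≡ x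
    returns x with Fin.pigeonhole (ℕ.n<1+n n) (λ i → iter f (toℕ i) x)
    ... | i , j , i<j , e with ℕ.m≤n⇒∃[o]m+o≡n i<j
    ... | k , h = k , ≡.trans (iter-suc f k x) (iter-cancel (toℕ i) (suc k) x
            (≡.trans (cong (λ z → iter f z x) (≡.trans (ℕ.+-suc (toℕ i) k) h)) (sym e)))

    orbit : ∀ x → ∃ λ t → Cyc f (x ∷ t) × Unique (x ∷ t)
    orbit x with returns x
    ... | j , e with segment f j (f x) x e
    ... | t , p , h , x∉ = t , (λ _ → sym h , p) , All.tabulate (λ m x≡ → x∉ (subst (_∈ t) (sym x≡) m)) ∷ link-unique f t p x∉

    record Decomposition (vs : List (Fin n)) : Set where
      field
        cycles   : List (List (Fin n))
        heads    : ∀ {c} → c ∈ cycles → ∃ λ x → ∃ λ t → c ≡ x ∷ t × x ∈ vs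
        cyclic   : All (Cyc f) cycles
        distinct : Unique (concat cycles)
        contains : ∀ {v} → v ∈ vs → v ∈ concat cycles
    open Decomposition

    decompose : ∀ vs → Decomposition vs
    decompose [] = record { cycles = [] ; heads = λ () ; cyclic = [] ; distinct = [] ; contains = λ () }
    decompose (v ∷ vs) with decompose vs
    ... | D with v ∈? concat (cycles D)
      where open import Data.List.Membership.DecPropositional _≟_ using (_∈?_)
    ... | yes m = record
          { cycles = cycles D
          ; heads = λ k → let (x , t , e , m′) = heads D k in x , t , e , there m′
          ; cyclic = cyclic D ; distinct = distinct D
          ; contains = λ { (here refl) → m ; (there k) → contains D k } }
    ... | no v∉ with orbit v
    ... | t , c , u = record
          { cycles = (v ∷ t) ∷ cycles D
          ; heads = λ { (here refl) → v , t , refl , here refl ; (there k) → let (x , t , e , m′) = heads D k in x , t , e , there m′ }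
          ; cyclic = c ∷ cyclic D
          ; distinct = Unique.++⁺ u (distinct D) disjoint
          ; contains = λ { (here refl) → here refl ; (there k) → ∈-++⁺ʳ (v ∷ t) (contains D k) } }
      where
      disjoint : ∀ {z} → z ∈ v ∷ t × z ∈ concat (cycles D) → ⊥
      disjoint (a , b) with ∈-concat⁻′ (cycles D) b
      ... | c′ , m , k with cyc-iter f (v ∷ t) c a (here refl)
      ... | j , refl = v∉ (∈-concat⁺′ (cyc-iter-closed f c′ (All.lookup (cyclic D) k) m j) k)

    -- By injectivity the listed cycles are closed under preimages too, so they contain every point
    -- whose forward orbit meets `vs`.
    decomposition-back : ∀ {vs} (D : Decomposition vs) j {x} → iter f j x ∈ vs → x ∈ concat (cycles D)
    decomposition-back D zero    m = contains D m
    decomposition-back D (suc j) {x} m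
      with ∈-concat⁻′ (cycles D) (decomposition-back D j {f x} (subst (_∈ _) (sym (iter-suc f j x)) m))
    ... | c , k , l = ∈-concat⁺′ (cyc-back c inj (All.lookup (cyclic D) l) k) l

  module _ {n : ℕ} where

    nextIn-∈ : ∀ u {e z : Fin n} → z ∈ u → nextIn u e z ≡ e ⊎ nextIn u e z ∈ u
    nextIn-∈ (x ∷ u) {e} {z} m with z ≟ x
    nextIn-∈ (x ∷ [])    m | yes _ = inj₁ refl
    nextIn-∈ (x ∷ a ∷ u) m | yes _ = inj₂ (there (here refl))
    nextIn-∈ (x ∷ u) (here h)  | no ne = ⊥-elim (ne h)
    nextIn-∈ (x ∷ u) (there m) | no ne with nextIn-∈ u m
    ... | inj₁ e  = inj₁ e
    ... | inj₂ m′ = inj₂ (there m′)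

    next-∈ : ∀ u {z : Fin n} → z ∈ u → next u z ∈ u
    next-∈ (a ∷ u) {z} m with nextIn-∈ (a ∷ u) {a} m
    ... | inj₁ e  = subst (_∈ a ∷ u) (sym e) (here refl)
    ... | inj₂ m′ = m′

    cyc-next : ∀ (u : List (Fin n)) → Unique u → Cyc (next u) u
    cyc-next []      U d = tt
    cyc-next (a ∷ u) U d = go [] (a ∷ u) refl
      where
      go : ∀ p q → p ++ q ≡ a ∷ u → Link (next (a ∷ u)) q a
      go p []      e = tt
      go p (x ∷ q) e = ≡.trans (cong (λ v → nextIn v a x) (sym e)) (nextIn-at p q x∉) , go (p ++ x ∷ []) q (≡.trans (List.++-assoc p (x ∷ []) q) e)
        where
        x∉ : x ∉ p
        x∉ k = unique-++-disjoint p (subst Unique (sym e) U) k (here refl)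

    link-agree : ∀ {f g : Fin n → Fin n} xs {z x} → Link f xs z → Link g xs z → x ∈ xs → f x ≡ g x
    link-agree (x ∷ xs) (e , _) (e′ , _) (here refl) = ≡.trans e (sym e′)
    link-agree (x ∷ xs) (_ , p) (_ , q)  (there m)   = link-agree xs p q m

  allVecs-full : ∀ {n} k (v : Data.Vec.Vec (Fin n) k) → v ∈ allVecs k
  allVecs-full zero    Data.Vec.[]       = here refl
  allVecs-full (suc k) (x Data.Vec.∷ v) = ∈-concatMap⁺ _ (lose (∈-allFin x) (∈-map⁺ (x Data.Vec.∷_) (allVecs-full k v)))

  allVecs-unique : ∀ {n} k → Unique (allVecs {n} k)
  allVecs-unique zero    = [] ∷ []
  allVecs-unique {n} (suc k) = unique-concatMap id (λ i → map (i Data.Vec.∷_) (allVecs k)) (allFin n)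
    (λ _ → unique-map _ (allVecs k) (λ { _ _ refl → refl }) (allVecs-unique k)) clash
    (subst Unique (sym (List.map-id (allFin n))) (Unique.allFin⁺ n))
    where
    clash : ∀ {i j b} → i ∈ allFin n → j ∈ allFin n → b ∈ map (i Data.Vec.∷_) (allVecs k) → b ∈ map (j Data.Vec.∷_) (allVecs k) → i ≡ j
    clash _ _ m m′ with ∈-map⁻ _ m | ∈-map⁻ _ m′
    ... | _ , _ , refl | _ , _ , refl = refl

-- The map Θ at the vertex, its cycles and the diagonal.

module Localization where

  import Data.List.Relation.Binary.Permutation.Propositional as Perm
  import Data.List.Relation.Binary.Permutation.Propositional.Properties as Perm
  open Cycles
  open Moves
  open Insertion
  open Orbits
  open import Data.Nat using (ℕ; zero; suc; z≤n; s≤s; _+_; _≤_)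
  import Data.Nat.Properties as ℕ
  open import Data.Fin using (Fin; zero; suc)
  open import Data.List.Relation.Binary.Permutation.Propositional using (_↭_; ↭-sym; ↭-trans; ↭-reflexive; refl; trans)
  open import Data.List.Relation.Binary.Permutation.Propositional.Properties using (++-comm; ∈-resp-↭)
  open import Relation.Binary.PropositionalEquality hiding (trans)
  import Relation.Binary.PropositionalEquality as ≡
  open Integral using (moved; support)
  open Weights using (total)
  open import Data.Fin.Permutation using (Permutation′; _⟨$⟩ʳ_; _⟨$⟩ˡ_; inverseˡ; inverseʳ)
  open import Data.Vec using (Vec; lookup; tabulate)
  import Data.Vec.Properties as Vec

  null : {A : Set} → List A → Bool
  null []      = true
  null (_ ∷ _) = false

  true≢false : {b : Bool} → b ≡ true → b ≡ false → ⊥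
  true≢false refl ()

  ∧-sound : {a b : Bool} → a ∧ b ≡ true → a ≡ true × b ≡ true
  ∧-sound {true} e = refl , e

  if-true : {A : Set} {b : Bool} {x y : A} → b ≡ true → (if b then x else y) ≡ x
  if-true refl = refl

  if-false : {A : Set} {b : Bool} {x y : A} → b ≡ false → (if b then x else y) ≡ y
  if-false refl = refl

  count-cong : {A : Set} {p q : A → Bool} (xs : List A) → (∀ {x} → x ∈ xs → p x ≡ q x) → count p xs ≡ count q xs
  count-cong []       e = refl
  count-cong {p = p} {q} (x ∷ xs) e rewrite e (here refl) with q x
  ... | true  = cong suc (count-cong xs (e ∘ there))
  ... | false = count-cong xs (e ∘ there)

  count-map : {A B : Set} (p : B → Bool) (f : A → B) (xs : List A) → count p (map f xs) ≡ count (p ∘ f) xs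
  count-map p f []       = refl
  count-map p f (x ∷ xs) with p (f x)
  ... | true  = cong suc (count-map p f xs)
  ... | false = count-map p f xs

  count-same : {A : Set} (p : A → Bool) {xs ys : List A} → Unique xs → Unique ys →
               (∀ {x} → p x ≡ true → x ∈ xs → x ∈ ys) → (∀ {x} → p x ≡ true → x ∈ ys → x ∈ xs) → count p xs ≡ count p ys
  count-same p {xs} {ys} u v f g = ≡.trans (act-length xs) (≡.trans
    (Perm.↭-length (same-members (actives-unique u) (actives-unique v)
       (λ m → let (k , e) = actives-∈⁻ xs m in actives-∈⁺ ys (f e k) e)
       (λ m → let (k , e) = actives-∈⁻ ys m in actives-∈⁺ xs (g e k) e)))
    (sym (act-length ys)))
    where open Active p

  module Vertex {n : ℕ} (α β : Permutation′ n) (one : OneFace α β) (h : Fin n) where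

    private X = Fin n

    V : X → Bool
    V = inVertex β h

    α′ β′ γ Θ : X → X
    α′ = α ⟨$⟩ʳ_
    β′ = β ⟨$⟩ʳ_
    γ  = face α β
    Θ x = α′ (if V x then x else β′ x)

    open Active V
    open States V Θ
    open Good

    perm-injective : (π : Permutation′ n) → ∀ {x y} → π ⟨$⟩ʳ x ≡ π ⟨$⟩ʳ y → x ≡ y
    perm-injective π {x} {y} e = ≡.trans (sym (inverseˡ π)) (≡.trans (cong (π ⟨$⟩ˡ_) e) (inverseˡ π))

    V-h : V h ≡ true
    V-h = reach-complete β′ 0 refl

    V-β : ∀ {x} → V x ≡ true → V (β′ x) ≡ true
    V-β v with reach-sound β′ v
    ... | j , refl = reach-complete β′ (suc j) refl

    V-β⁻ : ∀ {x} → V (β′ x) ≡ true → V x ≡ true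
    V-β⁻ {x} v with reach-sound β′ {h} v
    ... | suc j , e = reach-complete β′ j (perm-injective β e)
    ... | zero  , e with returns (perm-injective β) h
    ... | p , e′ = reach-complete β′ p (perm-injective β (≡.trans (sym (iter-suc β′ p h)) (≡.trans e′ e)))

    Θ-active : ∀ {x} → V x ≡ true → Θ x ≡ α′ x
    Θ-active v = cong α′ (if-true v)

    Θ-inactive : ∀ {x} → V x ≡ false → Θ x ≡ γ x
    Θ-inactive v = cong α′ (if-false v)

    -- ν is closed under β in both directions, so replacing β by the identity on ν causes no
    -- collisions.
    Θ-injective : ∀ {x y} → Θ x ≡ Θ y → x ≡ y
    Θ-injective {x} {y} e with V x in vx | V y in vy | perm-injective α e
    ... | true  | true  | e′ = e′
    ... | true  | false | e′ = ⊥-elim (true≢false (V-β⁻ (subst (λ z → V z ≡ true) e′ vx)) vy)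
    ... | false | true  | e′ = ⊥-elim (true≢false (V-β⁻ (subst (λ z → V z ≡ true) (sym e′) vy)) vx)
    ... | false | false | e′ = perm-injective β e′

    -- γ and Θ agree until the first visit to ν. As the single face leads every half-edge to h,
    -- every cycle of Θ meets ν.
    meets : ∀ j {x} → V (iter γ j x) ≡ true → ∃ λ k → V (iter Θ k x) ≡ true
    meets zero    v = 0 , v
    meets (suc j) {x} v with V x in vx
    ... | true  = 0 , vx
    ... | false with meets j {γ x} (subst (λ z → V z ≡ true) (sym (iter-suc γ j x)) v)
    ... | k , v′ = suc k , subst (λ z → V z ≡ true) (iter-suc Θ k x) (subst (λ z → V (iter Θ k z) ≡ true) (sym (Θ-inactive vx)) v′)

    D : Decomposition Θ-injective (actives (allFin n))
    D = decompose Θ-injective (actives (allFin n))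

    open Decomposition D using (cycles; heads) renaming (cyclic to cycles-cyclic; distinct to cycles-distinct; contains to cycles-contains) public

    ∈-actives : ∀ {x} → V x ≡ true → x ∈ actives (allFin n)
    ∈-actives {x} v = actives-∈⁺ (allFin n) (∈-allFin x) v

    cycles-cover : concat cycles ↭ allFin n
    cycles-cover = same-members cycles-distinct (Unique.allFin⁺ n) (λ {x} _ → ∈-allFin x) covered
      where
      covered : ∀ {x} → x ∈ allFin n → x ∈ concat cycles
      covered {x} _ with one x h
      ... | j , e with meets j (subst (λ z → V z ≡ true) (sym e) V-h)
      ... | k , v = decomposition-back Θ-injective D k (∈-actives v)

    firstReturn-link : ∀ zs {e} k → Link Θ zs e → All (λ z → V z ≡ false) zs → V e ≡ true → length zs ≤ k →
                       firstReturn V γ k (hd zs e) ≡ e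
    firstReturn-link [] zero    p q v l = refl
    firstReturn-link [] (suc k) p q v l rewrite v = refl
    firstReturn-link (z ∷ zs) (suc k) (e , p) (vz ∷ q) v (s≤s l) =
      ≡.trans (if-false vz) (≡.trans (cong (firstReturn V γ k) (≡.trans (sym (Θ-inactive vz)) e)) (firstReturn-link zs k p q v l))

    first-active : ∀ r → (act r ≡ 0 × All (λ z → V z ≡ false) r)
                       ⊎ (∃ λ zs → ∃ λ e → ∃ λ s → r ≡ zs ++ e ∷ s × All (λ z → V z ≡ false) zs × V e ≡ true)
    first-active []      = inj₁ (refl , [])
    first-active (x ∷ r) with V x in v
    ... | true  = inj₂ ([] , x , r , refl , [] , v)
    ... | false with first-active r
    ...   | inj₁ (e , q) = inj₁ (e , v ∷ q)
    ...   | inj₂ (zs , e , s , eq , q , ve) = inj₂ (x ∷ zs , e , s , cong (x ∷_) eq , v ∷ q , ve)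

    is1 : ℕ → Bool
    is1 1 = true
    is1 _ = false

    -- β⁻¹ cancels against the β in the first step of γ, leaving α v, which is Θ v on ν.
    diagonal-Θ : ∀ {v} → V v ≡ true → diagonal α β h v ≡ firstReturn V γ n (Θ v)
    diagonal-Θ {v} vv = cong (firstReturn V γ n) (≡.trans (cong α′ (inverseʳ β)) (sym (Θ-active vv)))

    -- The diagonal visits the active points of a Θ-cycle in turn, so it fixes v exactly when v is
    -- the only one.
    diagonal-fixed : ∀ c {v} → Cyc Θ c → Unique c → v ∈ c → V v ≡ true → (diagonal α β h v == v) ≡ is1 (act c)
    diagonal-fixed c {v} cy u m vv with ∈-∃++ m
    ... | p , q , refl = ≡.trans (cong (_== v) (diagonal-Θ vv)) (≡.trans (body (first-active (q ++ p))) (cong is1 (sym size)))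
      where
      r = q ++ p
      rot : v ∷ r ↭ p ++ v ∷ q
      rot = ++-comm (v ∷ q) p
      size : act (p ++ v ∷ q) ≡ suc (act r)
      size = ≡.trans (sym (act-↭ rot)) (act-∷ r vv)
      L : Link Θ (v ∷ r) v
      L = cyc-rotate p (v ∷ q) cy v
      U : Unique (v ∷ r)
      U = unique-↭ (↭-sym rot) u
      -- A cycle without repetitions is no longer than n, so the fuel of `firstReturn` suffices.
      short : length r ≤ n
      short = ℕ.≤-trans (ℕ.n≤1+n _) (unique-length U)
      body : (act r ≡ 0 × All (λ z → V z ≡ false) r)
           ⊎ (∃ λ zs → ∃ λ e → ∃ λ s → r ≡ zs ++ e ∷ s × All (λ z → V z ≡ false) zs × V e ≡ true) →
           (firstReturn V γ n (Θ v) == v) ≡ is1 (suc (act r))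
      body (inj₁ (a , q)) = ≡.trans (==-true (≡.trans (cong (firstReturn V γ n) (proj₁ L)) (firstReturn-link r n (proj₂ L) q vv short)))
                                    (cong (is1 ∘ suc) (sym a))
      body (inj₂ (zs , e , s , eq , q , ve)) = ≡.trans (==-false (λ e≡v → e≢v (≡.trans (sym ret) e≡v))) (sym (big (act s) (≡.trans (cong act eq) (≡.trans (act-++ zs (e ∷ s)) (cong (act zs +_) (act-∷ s ve))))))
        where
        ret : firstReturn V γ n (Θ v) ≡ e
        ret = ≡.trans (cong (firstReturn V γ n) (≡.trans (proj₁ L) (≡.trans (cong (λ z → hd z v) eq) (hd-++ zs (e ∷ s) v))))
              (firstReturn-link zs n (proj₁ (link-++⁻ zs (e ∷ s) (subst (λ z → Link Θ z v) eq (proj₂ L)))) q ve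
                (ℕ.≤-trans (ℕ.m≤m+n (length zs) (length (e ∷ s))) (ℕ.≤-trans (ℕ.≤-reflexive (≡.trans (sym (List.length-++ zs)) (cong length (sym eq)))) short)))
        e≢v : e ≢ v
        e≢v refl = unique-∷ U (subst (v ∈_) (sym eq) (∈-insert zs))
        big : ∀ k {m} → act r ≡ m + suc k → is1 (suc (act r)) ≡ false
        big k {m} a rewrite a | ℕ.+-suc m k = refl

    fixed : X → Bool
    fixed v = V v ∧ (diagonal α β h v == v)

    count-fixed : ∀ c → Cyc Θ c → Unique c → count fixed c ≡ (if is1 (act c) then act c else 0)
    count-fixed c cy u = ≡.trans (count-cong {q = λ v → V v ∧ is1 (act c)} c same) (collapse (is1 (act c)) c)
      where
      same : ∀ {v} → v ∈ c → fixed v ≡ V v ∧ is1 (act c)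
      same {v} m with V v in vv
      ... | true  = diagonal-fixed c cy u m vv
      ... | false = refl
      collapse : ∀ b c → count (λ v → V v ∧ b) c ≡ (if b then act c else 0)
      collapse true  []      = refl
      collapse false []      = refl
      collapse true  (x ∷ c) with V x
      ... | true  = cong suc (collapse true c)
      ... | false = collapse true c
      collapse false (x ∷ c) with V x
      ... | true  = collapse false c
      ... | false = collapse false c

    cycles-headed : All Headed cycles
    cycles-headed = All.tabulate (λ m → let (x , t , e , k) = heads m in x , t , e , proj₂ (actives-∈⁻ (allFin n) k))

    headed-act : ∀ {c} → Headed c → 1 ≤ act c
    headed-act (x , t , refl , v) = ℕ.≤-trans (s≤s z≤n) (ℕ.≤-reflexive (sym (act-∷ t v)))

    total-act : ∀ css → total (map act css) ≡ act (concat css)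
    total-act []         = refl
    total-act (c ∷ css) = ≡.trans (cong (act c +_) (total-act css)) (sym (act-++ c (concat css)))

    -- Fixed points of the diagonal come from the cycles with one active point, which are precisely
    -- those that `moved` drops.
    fixed+support : ∀ css → All (Cyc Θ) css → Unique (concat css) → All Headed css →
                    count fixed (concat css) + support (map act css) ≡ act (concat css)
    fixed+support [] [] u [] = refl
    fixed+support (c ∷ css) (cy ∷ cys) u (hc ∷ hs) = ≡.trans
      (cong (_+ (moved (act c) + support (map act css))) (≡.trans (Active.act-++ fixed c (concat css)) (cong (_+ count fixed (concat css)) (count-fixed c cy (unique-++ˡ c u)))))
      (≡.trans (rearrange (if is1 (act c) then act c else 0) (count fixed (concat css)) (moved (act c)) (support (map act css)))
      (≡.trans (cong₂ _+_ (lem (act c) (headed-act hc)) (fixed+support css cys (unique-++ʳ c u) hs)) (sym (act-++ c (concat css)))))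
      where
      rearrange : ∀ a b c d → a + b + (c + d) ≡ (a + c) + (b + d)
      rearrange = solve-∀
        where open import Data.Nat.Tactic.RingSolver
      lem : ∀ m → 1 ≤ m → (if is1 m then m else 0) + moved m ≡ m
      lem 1             _ = refl
      lem (suc (suc m)) _ = refl
      unique-++ʳ : ∀ (xs : List X) {ys} → Unique (xs ++ ys) → Unique ys
      unique-++ʳ []       u       = u
      unique-++ʳ (x ∷ xs) (_ ∷ u) = unique-++ʳ xs u

    parts : List ℕ
    parts = map act cycles

    total-parts : total parts ≡ deg β h
    total-parts = ≡.trans (total-act cycles) (act-↭ cycles-cover)

    support-parts : a₁ α β h + support parts ≡ deg β h
    support-parts = ≡.trans (cong (_+ support parts) (sym (Active.act-↭ fixed cycles-cover)))
      (≡.trans (fixed+support cycles cycles-cyclic cycles-distinct cycles-headed) (act-↭ cycles-cover))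

    parts-positive : All (1 ≤_) parts
    parts-positive = All.map⁺ (All.map headed-act cycles-headed)

  count-positive : {A : Set} (p : A → Bool) (xs : List A) {x : A} → x ∈ xs → p x ≡ true → 1 ≤ count p xs
  count-positive p (x ∷ xs) (here refl) e rewrite e = s≤s z≤n
  count-positive p (x ∷ xs) (there m)   e with p x
  ... | true  = s≤s z≤n
  ... | false = count-positive p xs m e

  iter-ext : ∀ {n} {f g : Fin n → Fin n} → (∀ x → f x ≡ g x) → ∀ j x → iter f j x ≡ iter g j x
  iter-ext e zero    x = refl
  iter-ext {f = f} e (suc j) x = ≡.trans (cong f (iter-ext e j x)) (e _)

  singleCycle-complete : ∀ {n} {f : Fin n → Fin n} → (∀ x y → ∃ λ j → iter f j x ≡ y) → singleCycleB f ≡ true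
  singleCycle-complete {n} {f} h = all-true _ (allFin n) (λ {x} _ → all-true _ (allFin n) (λ {y} _ →
    reach-complete f (proj₁ (h x y)) (proj₂ (h x y))))

  singleCycle-sound : ∀ {n} {f : Fin n → Fin n} → singleCycleB f ≡ true → ∀ x y → ∃ λ j → iter f j x ≡ y
  singleCycle-sound {n} {f} h x y = reach-sound f (all-sound _ (allFin n) (all-sound _ (allFin n) h (∈-allFin x)) (∈-allFin y))

  -- Reembeddings correspond to words on ν.

  module Counting {n : ℕ} (α β : Permutation′ n) (one : OneFace α β) (h : Fin n) where
    open Vertex α β one h
    open Active V
    open States V Θ
    open Words {n}

    private X = Fin n

    isReembedding-complete : ∀ b → (∀ {x} → V x ≡ true → V (lookup b x) ≡ true) → (∀ {x} → V x ≡ false → lookup b x ≡ β′ x) →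
                             (∀ {x y} → V x ≡ true → V y ≡ true → ∃ λ j → iter (lookup b) j x ≡ y) → isReembedding β h b ≡ true
    isReembedding-complete b on off cyc = cong₂ _∧_ (all-true _ (allFin n) (λ {x} _ → local x))
        (all-true _ (allFin n) (λ {x} _ → all-true _ (allFin n) (λ {y} _ → joined x y)))
      where
      local : ∀ x → (if V x then V (lookup b x) else (lookup b x == β′ x)) ≡ true
      local x with V x in v
      ... | true  = on v
      ... | false = ==-true (off v)
      joined : ∀ x y → (if V x ∧ V y then reach (lookup b) x y else true) ≡ true
      joined x y with V x in v | V y in v′
      ... | true  | true  = let (j , e) = cyc v v′ in reach-complete (lookup b) j e
      ... | true  | false = refl
      ... | false | _     = refl

    isReembedding-sound : ∀ b → isReembedding β h b ≡ true →
                          ((∀ {x} → V x ≡ true → V (lookup b x) ≡ true) × (∀ {x} → V x ≡ false → lookup b x ≡ β′ x)) ×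
                          (∀ {x y} → V x ≡ true → V y ≡ true → ∃ λ j → iter (lookup b) j x ≡ y)
    isReembedding-sound b e with ∧-sound e
    ... | e₁ , e₂ = ((λ {x} v → ≡.trans (sym (if-true v)) (local x)) , (λ {x} v → ==-sound (≡.trans (sym (if-false v)) (local x)))) ,
                    (λ {x} {y} v v′ → reach-sound (lookup b) (≡.trans (sym (if-true (cong₂ _∧_ v v′))) (joined x y)))
      where
      local : ∀ x → (if V x then V (lookup b x) else (lookup b x == β′ x)) ≡ true
      local x = all-sound _ (allFin n) e₁ (∈-allFin x)
      joined : ∀ x y → (if V x ∧ V y then reach (lookup b) x y else true) ≡ true
      joined x y = all-sound _ (allFin n) (all-sound _ (allFin n) e₂ (∈-allFin x)) (∈-allFin y)

    onFaces : Vec X n → X → X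
    onFaces b x = α ⟨$⟩ʳ lookup b x

    counted : Vec X n → Bool
    counted b = isReembedding β h b ∧ singleCycleB (onFaces b)

    -- The witness is the table of β itself, whose face map is γ.
    counted-positive : 1 ≤ oneFaceReembeddings α β h
    counted-positive = count-positive counted (allVecs n) (allVecs-full n b) (cong₂ _∧_
      (isReembedding-complete b (λ {x} v → ≡.trans (cong V (tab x)) (V-β v)) (λ {x} _ → tab x) joined)
      (singleCycle-complete (λ x y → let (j , e) = one x y in j , ≡.trans (iter-ext (λ z → cong α′ (tab z)) j x) e)))
      where
      b = tabulate β′
      tab : ∀ x → lookup b x ≡ β′ x
      tab x = Vec.lookup∘tabulate β′ x
      O = orbit (perm-injective β) h
      ∈O : ∀ {x} → V x ≡ true → x ∈ h ∷ proj₁ O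
      ∈O v with reach-sound β′ v
      ... | j , refl = cyc-iter-closed β′ (h ∷ proj₁ O) (proj₁ (proj₂ O)) (here refl) j
      joined : ∀ {x y} → V x ≡ true → V y ≡ true → ∃ λ j → iter (lookup b) j x ≡ y
      joined v v′ = cyc-iter (lookup b) (h ∷ proj₁ O) (cyc-cong (h ∷ proj₁ O) (λ _ → tab _) (proj₁ (proj₂ O))) (∈O v) (∈O v′)

    module _ (x₁ : X) (v₁ : V x₁ ≡ true) where
      open Stages V Θ x₁ using (Stage; good; words; active)

      module Final {ns : List ℕ} {l : ℕ} {A : List X} {Sts : List State} (S : Stage ns l [] [] A Sts) where

        A-all : A ↭ actives (allFin n)
        A-all = ↭-trans (↭-reflexive (sym (List.++-identityʳ A))) (active S)

        A-unique : Unique A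
        A-unique = unique-↭ (↭-sym A-all) (actives-unique (Unique.allFin⁺ n))

        table : List X → Vec X n
        table u = tabulate (λ x → if V x then next u x else β′ x)

        table-on : ∀ u {x} → V x ≡ true → lookup (table u) x ≡ next u x
        table-on u {x} v = ≡.trans (Vec.lookup∘tabulate _ x) (if-true v)

        table-off : ∀ u {x} → V x ≡ false → lookup (table u) x ≡ β′ x
        table-off u {x} v = ≡.trans (Vec.lookup∘tabulate _ x) (if-false v)

        module _ {u : List X} (perm : u ↭ A) where

          u-unique : Unique u
          u-unique = unique-↭ (↭-sym perm) A-unique

          ∈u : ∀ {x} → V x ≡ true → x ∈ u
          ∈u v = ∈-resp-↭ (↭-sym (↭-trans perm A-all)) (∈-actives v)

          V-u : ∀ {x} → x ∈ u → V x ≡ true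
          V-u m = proj₂ (actives-∈⁻ (allFin n) (∈-resp-↭ (↭-trans perm A-all) m))

          table-cyc : Cyc (lookup (table u)) u
          table-cyc = cyc-cong u (λ m → table-on u (V-u m)) (cyc-next u u-unique)

          table-reembedding : isReembedding β h (table u) ≡ true
          table-reembedding = isReembedding-complete (table u)
            (λ v → subst (λ z → V z ≡ true) (sym (table-on u v)) (V-u (next-∈ u (∈u v)))) (table-off u)
            (λ v v′ → cyc-iter (lookup (table u)) u table-cyc (∈u v) (∈u v′))

          table-face : ∀ x → onFaces (table u) x ≡ ζ u x
          table-face x with V x in v
          ... | true  = ≡.trans (cong α′ (table-on u v)) (sym (Θ-active (V-u (next-∈ u (∈u v)))))
          ... | false = ≡.trans (cong α′ (table-off u v)) (≡.trans (sym (Θ-inactive v)) (cong Θ (sym (nextIn-∉ u (λ m → true≢false (V-u m) v)))))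

        word-perm : ∀ {s} → s ∈ Sts → proj₁ s ↭ A
        word-perm m = proj₂ (sound (words S) (∈-map⁺ proj₁ m))

        onlyOne : State → Bool
        onlyOne (u , w , cs) = null cs

        -- With nothing pending, the lists of a state cover all half-edges, so the face map is a
        -- single cycle when there is no further list. Conversely `nonempty` makes any further list
        -- an honest second cycle.
        single-iff : ∀ {s} → s ∈ Sts → singleCycleB (onFaces (table (proj₁ s))) ≡ onlyOne s
        single-iff {u , w , []} m = singleCycle-complete (λ x y → cyc-iter f (w ++ []) cy (∈w x) (∈w y))
          where
          f = onFaces (table u)
          G = good S m
          cy : Cyc f (w ++ [])
          cy = cyc-cong (w ++ []) (λ _ → table-face (word-perm m) _) (All.head (Good.cyclic G))
          ∈w : ∀ x → x ∈ w ++ []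
          ∈w x = subst (x ∈_) (List.++-identityʳ (w ++ [])) (∈-resp-↭ (↭-sym (Good.covers G)) (∈-allFin x))
        single-iff {u , [] , c ∷ cs} m = ⊥-elim (All.head (Good.nonempty (good S m)) refl)
        single-iff {u , x ∷ w , [] ∷ cs} m = ⊥-elim (All.head (All.tail (Good.nonempty (good S m))) refl)
        single-iff {u , x ∷ w , (y ∷ c) ∷ cs} m with singleCycleB (onFaces (table u)) in e
        ... | false = refl
        ... | true  = ⊥-elim (unique-++-disjoint ((x ∷ w) ++ []) (covers-unique (Good.covers G)) y∈ (here refl))
          where
          f = onFaces (table u)
          G = good S m
          cy : Cyc f ((x ∷ w) ++ [])
          cy = cyc-cong ((x ∷ w) ++ []) (λ _ → table-face (word-perm m) _) (All.head (Good.cyclic G))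
          y∈ : y ∈ (x ∷ w) ++ []
          y∈ = let (j , e′) = singleCycle-sound e x y in subst (_∈ (x ∷ w) ++ []) e′ (cyc-iter-closed f ((x ∷ w) ++ []) cy (here refl) j)

        -- The word is the orbit of x₁ under b up to its first return; starting at the fixed point
        -- x₁ selects one word for each cyclic order.
        complete-table : ∀ b → isReembedding β h b ≡ true → ∃ λ u → u ∈ map proj₁ Sts × table u ≡ b
        complete-table b e with isReembedding-sound b e
        ... | (on , off) , joined with joined (on v₁) v₁
        ... | j , back with segment (lookup b) j (lookup b x₁) x₁ back
        ... | xs , p , hx , x₁∉ = x₁ ∷ xs , full (words S) xs perm , ≡.trans (Vec.tabulate-cong same) (Vec.tabulate∘lookup b)
          where
          f = lookup b
          u = x₁ ∷ xs
          cy : Cyc f u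
          cy _ = sym hx , p
          U : Unique u
          U = All.tabulate (λ m x≡ → x₁∉ (subst (_∈ xs) (sym x≡) m)) ∷ link-unique f xs p x₁∉
          stays : ∀ j {x} → V x ≡ true → V (iter f j x) ≡ true
          stays zero    v = v
          stays (suc j) v = on (stays j v)
          Vu : ∀ {x} → x ∈ u → V x ≡ true
          Vu m with cyc-iter f u cy (here refl) m
          ... | j , refl = stays j v₁
          ∈u′ : ∀ {x} → V x ≡ true → x ∈ u
          ∈u′ v with joined v₁ v
          ... | j , refl = cyc-iter-closed f u cy (here refl) j
          perm : u ↭ A
          perm = ↭-trans (same-members U (actives-unique (Unique.allFin⁺ n)) (λ m → ∈-actives (Vu m)) (λ m → ∈u′ (proj₂ (actives-∈⁻ (allFin n) m)))) (↭-sym A-all)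
          same : ∀ x → (if V x then next u x else β′ x) ≡ f x
          same x with V x in v
          ... | true  = link-agree u (cyc-next u U x₁) (cy x₁) (∈u′ v)
          ... | false = sym (off v)

        table-injective : ∀ {u u′} → u ∈ map proj₁ Sts → u′ ∈ map proj₁ Sts → table u ≡ table u′ → u ≡ u′
        table-injective {u} {u′} m m′ e with sound (words S) m | sound (words S) m′
        ... | (p , refl) , perm | (p′ , refl) , perm′ = cong (x₁ ∷_) (link-det f p p′ (proj₂ L) (proj₂ L′)
                (unique-∷ (unique-↭ (↭-sym perm) A-unique)) (unique-∷ (unique-↭ (↭-sym perm′) A-unique)) (≡.trans (sym (proj₁ L)) (proj₁ L′)))
          where
          f = lookup (table u)
          L : Link f u x₁
          L = table-cyc perm x₁
          L′ : Link f u′ x₁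
          L′ = subst (λ t → Link (lookup t) u′ x₁) (sym e) (table-cyc perm′ x₁)

        count-reembeddings : oneFaceReembeddings α β h ≡ count onlyOne Sts
        count-reembeddings = ≡.trans
          (count-same counted (allVecs-unique n) tables-unique (λ e _ → listed _ (proj₁ (∧-sound e))) (λ _ _ → allVecs-full n _))
          (≡.trans (cong (count counted) (sym (List.map-∘ Sts))) (≡.trans (count-map counted (table ∘ proj₁) Sts)
            (count-cong Sts (λ {s} m → ≡.trans (cong (_∧ singleCycleB (onFaces (table (proj₁ s)))) (table-reembedding (word-perm m))) (single-iff m)))))
          where
          open Insertion using (unique-map)
          tables-unique : Unique (map table (map proj₁ Sts))
          tables-unique = unique-map table (map proj₁ Sts) table-injective (distinct (words S))
          listed : ∀ b → isReembedding β h b ≡ true → b ∈ map table (map proj₁ Sts)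
          listed b e with complete-table b e
          ... | u , m , refl = ∈-map⁺ table m

-- From the count of words to the bounds on the probability.

module Conclusion where

  import Data.List.Relation.Binary.Permutation.Propositional as Perm
  import Data.List.Relation.Binary.Permutation.Propositional.Properties as Perm
  open Integral
  open Weights
  open Moves
  open Insertion
  open MoveSums
  open Localization
  open import Data.Nat using (ℕ; zero; suc; s≤s; _∸_; _!; NonZero) renaming (_+_ to _+ℕ_; _≤_ to _≤ℕ_; _*_ to _*ℕ_)
  import Data.Nat.Properties as ℕ
  open import Data.Fin using (Fin)
  open import Data.Fin.Permutation using (Permutation′)
  import Data.Integer as ℤ
  import Data.Integer.Properties as ℤ
  open import Data.Integer using (+_)
  open import Data.Rational hiding (NonZero)
  open import Data.Rational.Properties
  import Data.Rational.Unnormalised as ℚᵘ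
  import Data.Rational.Unnormalised.Properties as ℚᵘ
  open import Tactic.RingSolver using (solve-∀)
  open import Data.List.Relation.Binary.Permutation.Propositional using (_↭_; ↭-sym; ↭-trans; refl; prep; swap; trans)
  open import Data.List.Relation.Binary.Permutation.Propositional.Properties using (All-resp-↭)
  open import Relation.Binary.PropositionalEquality hiding (trans)
  import Relation.Binary.PropositionalEquality as ≡

  total-↭ : ∀ {xs ys} → xs ↭ ys → total xs ≡ total ys
  total-↭ refl         = refl
  total-↭ (prep x p)   = cong (x +ℕ_) (total-↭ p)
  total-↭ (swap x y p) = ≡.trans (swap-+ x y _) (cong (λ z → y +ℕ (x +ℕ z)) (total-↭ p))
  total-↭ (trans p q)  = ≡.trans (total-↭ p) (total-↭ q)

  support-↭ : ∀ {xs ys} → xs ↭ ys → support xs ≡ support ys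
  support-↭ refl         = refl
  support-↭ (prep x p)   = cong (moved x +ℕ_) (support-↭ p)
  support-↭ (swap x y p) = ≡.trans (swap-+ (moved x) (moved y) _) (cong (λ z → moved y +ℕ (moved x +ℕ z)) (support-↭ p))
  support-↭ (trans p q)  = ≡.trans (support-↭ p) (support-↭ q)

  ι-toℚᵘ : ∀ n → toℚᵘ (ι n) ℚᵘ.≃ ℚᵘ.mkℚᵘ (+ n) 0
  ι-toℚᵘ zero    = ℚᵘ.≃-refl
  ι-toℚᵘ (suc n) = ℚᵘ.≃-trans (toℚᵘ-homo-+ 1ℚ (ι n)) (ℚᵘ.≃-trans (ℚᵘ.+-congʳ (toℚᵘ 1ℚ) (ι-toℚᵘ n))
    (ℚᵘ.*≡* (cong (λ z → z ℤ.* + 1) (≡.trans (cong (λ z → + 1 ℤ.+ z) (ℤ.*-identityʳ (+ n))) refl))))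

  /-*-ι : ∀ a d .{{_ : NonZero d}} → (+ a / d) * ι d ≡ ι a
  /-*-ι a (suc d) = toℚᵘ-injective (ℚᵘ.≃-trans (toℚᵘ-homo-* (+ a / suc d) (ι (suc d)))
    (ℚᵘ.≃-trans (ℚᵘ.*-cong (toℚᵘ-fromℚᵘ (ℚᵘ.mkℚᵘ (+ a) d)) (ι-toℚᵘ (suc d)))
    (ℚᵘ.≃-trans (ℚᵘ.*≡* (≡.trans (ℤ.*-identityʳ _) (cong (λ z → + a ℤ.* z) (sym (ℤ.*-identityʳ (+ suc d)))))) (ℚᵘ.≃-sym (ι-toℚᵘ a)))))

  ι-! : ∀ n → ι (n !) ≡ fact n
  ι-! zero    = +-identityʳ 1ℚ
  ι-! (suc n) = ≡.trans (ι-* (suc n) (n !)) (cong (λ z → ι (suc n) * z) (ι-! n))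

  ι-positive : ∀ d .{{_ : NonZero d}} → Positive (ι d)
  ι-positive (suc d) = ι-pos d

  /-≤ : ∀ a d {x} .{{_ : NonZero d}} → ι a ≤ ι d * x → + a / d ≤ x
  /-≤ a d {x} h = *-cancelʳ-≤-pos (ι d) {{ι-positive d}} (≤-trans (≤-reflexive (/-*-ι a d)) (≤-trans h (≤-reflexive (*-comm (ι d) x))))

  ≤-/ : ∀ a d {x} .{{_ : NonZero d}} → x * ι d ≤ ι a → x ≤ + a / d
  ≤-/ a d h = *-cancelʳ-≤-pos (ι d) {{ι-positive d}} (≤-trans h (≤-reflexive (sym (/-*-ι a d))))

  *-cancelˡ-pos : ∀ c {x y} → Positive c → c * x ≡ c * y → x ≡ y
  *-cancelˡ-pos c p e = ≤-antisym (*-cancelˡ-≤-pos c {{p}} (≤-reflexive e)) (*-cancelˡ-≤-pos c {{p}} (≤-reflexive (sym e)))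

  ∑-indicator : {A : Set} (b : A → Bool) (f : A → ℚ) (k : ℚ) (xs : List A) →
                (∀ {x} → x ∈ xs → b x ≡ true → f x ≡ k) → (∀ {x} → x ∈ xs → b x ≡ false → f x ≡ 0ℚ) →
                ∑ xs f ≡ ι (count b xs) * k
  ∑-indicator b f k [] t e = sym (*-zeroˡ k)
  ∑-indicator b f k (x ∷ xs) t e with b x in v
  ... | true  = ≡.trans (cong₂ _+_ (t (here refl) v) (∑-indicator b f k xs (t ∘ there) (e ∘ there))) (lem k (ι (count b xs)))
    where lem : ∀ k n → k + n * k ≡ (1ℚ + n) * k
          lem = solve-∀ R
  ... | false = ≡.trans (cong₂ _+_ (e (here refl) v) (∑-indicator b f k xs (t ∘ there) (e ∘ there))) (+-identityˡ (ι (count b xs) * k))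

  module Probability {n : ℕ} (α β : Permutation′ n) (one : OneFace α β) (h : Fin n) where
    open Vertex α β one h
    open Counting α β one h
    open Active V
    open States V Θ

    private
      K = deg β h
      C = oneFaceReembeddings α β h

    -- `Complete` at the functional `unit`: on the left each single-cycle state contributes K (K +
    -- 1) and the others 0; on the right stands (K + 1)! times the integral.
    outcome : ∃ λ ps → ps ↭ parts × ι C * (ι K * ι (suc K)) ≡ fact (suc K) * I ps
    outcome = go cycles refl cycles-headed cycles-cyclic cycles-cover
      where
      -- Generalised over the list so that its first cycle can be matched as x₁ ∷ t. The list is not
      -- empty because h has to be covered.
      go : ∀ css → css ≡ cycles → All Headed css → All (Cycles.Cyc Θ) css → concat css ↭ allFin n →
           ∃ λ ps → ps ↭ parts × ι C * (ι K * ι (suc K)) ≡ fact (suc K) * I ps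
      go [] e hs cs cov with Perm.∈-resp-↭ (↭-sym cov) (∈-allFin h)
      ... | ()
      go (.(x₁ ∷ t) ∷ todo) e ((x₁ , t , refl , v) ∷ hs) cs cov = l ∷ ns , perm ,
        ≡.trans (cong (λ c → ι c * (ι K * ι (suc K))) count-reembeddings)
        (≡.trans (sym (∑-indicator onlyOne (pR (σ unit) ∘ config) (ι K * ι (suc K)) Sts one-cycle more-cycles))
        (≡.trans (sym (∑-map config Sts (pR (σ unit)))) (≡.trans (complete {C = map config Sts} (weights stage) unit)
        (≡.trans (hat-unit (l ∷ ns)) (cong (λ z → fact (suc z) * I (l ∷ ns)) (≡.trans (total-↭ perm) total-parts))))))
        where
        open Stages V Θ x₁
        open Outcome (run t todo hs (start t todo v cs cov))
        open Final x₁ v stage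
        perm : l ∷ ns ↭ parts
        perm = ↭-trans types (↭-trans (Perm.↭-reflexive
                 (cong (_∷ map act todo) (sym (act-∷ t v)))) (Perm.↭-reflexive (cong (map act) e)))
        one-cycle : ∀ {s} → s ∈ Sts → onlyOne s ≡ true → pR (σ unit) (config s) ≡ ι K * ι (suc K)
        one-cycle {u , w , []} m _ = ≡.trans (pR-single (act w)) (cong (λ z → ι z * ι (suc z))
          (≡.trans (cong act (sym (≡.trans (List.++-identityʳ (w ++ [])) (List.++-identityʳ w)))) (act-↭ (Good.covers (good stage m)))))
        more-cycles : ∀ {s} → s ∈ Sts → onlyOne s ≡ false → pR (σ unit) (config s) ≡ 0ℚ
        more-cycles {u , w , c ∷ cs} m _ = pR-multiple (act w) (act c) (map act cs)

    ps : List ℕ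
    ps = proj₁ outcome

    ps-↭ : ps ↭ parts
    ps-↭ = proj₁ (proj₂ outcome)

    ps-positive : All (1 ≤ℕ_) ps
    ps-positive = All-resp-↭ (↭-sym ps-↭) parts-positive

    N≡ : K ∸ a₁ α β h ≡ support ps
    N≡ = ≡.trans (cong (_∸ a₁ α β h) (sym support-parts)) (≡.trans (ℕ.m+n∸m≡n (a₁ α β h) (support parts)) (support-↭ (↭-sym ps-↭)))

    K-positive : 1 ≤ℕ K
    K-positive = count-positive V (allFin n) (∈-allFin h) V-h

    -- (K + 1)! divided by K (K + 1) is (K - 1)!, the number of all reembeddings, so the integral is
    -- exactly the proportion.
    count-formula : ∀ k c x → 1 ≤ℕ k → c * (ι k * ι (suc k)) ≡ fact (suc k) * x → c ≡ ι ((k ∸ 1) !) * x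
    count-formula (suc k) c x _ e = *-cancelˡ-pos (ι (suc k) * ι (suc (suc k)))
        (subst Positive (ι-* (suc k) (suc (suc k))) (ι-pos (suc k +ℕ k *ℕ suc (suc k))))
        (≡.trans (*-comm (ι (suc k) * ι (suc (suc k))) c) (≡.trans e (≡.trans (lem (ι (suc (suc k))) (ι (suc k)) (fact k) x)
          (cong (λ z → ι (suc k) * ι (suc (suc k)) * (z * x)) (sym (ι-! k))))))
      where lem : ∀ a b f x → a * (b * f) * x ≡ b * a * (f * x)
            lem = solve-∀ R

    C≡ : ι C ≡ ι ((K ∸ 1) !) * I ps
    C≡ = count-formula K (ι C) (I ps) K-positive (proj₂ (proj₂ outcome))

    prob≡ : prob₁ α β h ≡ I ps
    prob≡ = *-cancelˡ-pos (ι ((K ∸ 1) !)) (ι-positive ((K ∸ 1) !))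
      (≡.trans (*-comm (ι ((K ∸ 1) !)) (prob₁ α β h)) (≡.trans (/-*-ι C ((K ∸ 1) !)) C≡))
      where instance _ = ((K ∸ 1) ℕ.!≢0)

    I-nonzero : I ps ≢ 0ℚ
    I-nonzero z = <-irrefl refl (<-≤-trans (positive⁻¹ 1ℚ) (≤-trans (ι-mono counted-positive) (≤-reflexive
      (≡.trans C≡ (≡.trans (cong (λ x → ι ((K ∸ 1) !) * x) z) (*-zeroʳ (ι ((K ∸ 1) !))))))))

    lower : ι 2 ≤ ι (2 +ℕ support ps) * I ps
    lower = [ (λ z → ⊥-elim (I-nonzero z)) , (λ p → p) ]′ (I-lower ps ps-positive)

    lower-bound : + 2 / (2 +ℕ (K ∸ a₁ α β h)) ≤ prob₁ α β h
    lower-bound = /-≤ 2 (2 +ℕ (K ∸ a₁ α β h)) (subst₂ (λ N x → ι 2 ≤ ι (2 +ℕ N) * x) (sym N≡) (sym prob≡) lower)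

    -- 2/(N + 19/29) expanded by 29.
    upper-bound : prob₁ α β h ≤ + 58 / (19 +ℕ 29 *ℕ (K ∸ a₁ α β h))
    upper-bound = ≤-/ 58 (19 +ℕ 29 *ℕ (K ∸ a₁ α β h)) (subst₂ (λ N x → x * ι (19 +ℕ 29 *ℕ N) ≤ ι 58) (sym N≡) (sym prob≡) (I-upper ps ps-positive))

    coarse-bound : + 2 / (2 +ℕ K) ≤ prob₁ α β h
    coarse-bound = /-≤ 2 (2 +ℕ K) (subst (λ x → ι 2 ≤ ι (2 +ℕ K) * x) (sym prob≡)
      (≤-trans lower (*-monoʳ-≤-nonNeg (I ps) {{nonNegative (I-nonneg ps)}} (ι-mono (s≤s (s≤s N≤K))))))
      where
      N≤K : support ps ≤ℕ K
      N≤K = ℕ.≤-trans (ℕ.≤-reflexive (sym N≡)) (ℕ.m∸n≤m K (a₁ α β h))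

open import Data.Nat using (ℕ; _+_; _*_; _∸_)
open import Data.Fin using (Fin)
open import Data.Fin.Permutation using (Permutation′)
open import Data.Integer using (+_)
open import Data.Rational using (_/_; _≤_)
open import Data.Product using (_×_)

theorem3p3 : (m : ℕ) (α β : Permutation′ (2 * m)) →
    IsFPFInvolution α → OneFace α β → (h : Fin (2 * m)) →
    ((+ 2) / (2 + (deg β h ∸ a₁ α β h)) ≤ prob₁ α β h
    × prob₁ α β h ≤ (+ 58) / (19 + 29 * (deg β h ∸ a₁ α β h)))
    × (+ 2) / (2 + deg β h) ≤ prob₁ α β h
theorem3p3 m α β _ one h = (lower-bound , upper-bound) , coarse-bound
  where open Conclusion.Probability α β one h
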